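{- Let $B_q$ be the set of complete flags $(V_1,V_2)$ in $\mathbb{F}_q^3$ ($0<V_1<V_2<\mathbb{F}_q^3$, $\dim V_1=1$, $\dim V_2=2$) and $\Phi_q:\mathrm{SL}_3(\mathbb{Z})\to\mathrm{Sym}(B_q)$ the action via reduction modulo $q$. There exists a constant $C>0$ such that for every $\epsilon>0$ there is a constant $A_\epsilon$ such that for every prime $q$ and every $T\le Cq^3$, \[ \left|\left\{(\gamma,x)\in\mathrm{SL}_3(\mathbb{Z})\times B_q:\|\gamma\|_\infty\|\gamma^{ -1}\|_\infty\le T,\ \Phi_q(\gamma)(x)=x\right\}\right|\le A_\epsilon\,q^{3+\epsilon}T. \]
   Context: $\|\gamma\|_\infty$ denotes the maximum absolute value of the entries of $\gamma$. -}

module Defs where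

open import Data.Nat as ℕ using (ℕ; _⊔_)
open import Data.Nat using () renaming (_*_ to _*ℕ_; _≤_ to _≤ℕ_)
open import Data.Integer as ℤ using (ℤ; +_; _+_; _*_; _-_; ∣_∣; 0ℤ; 1ℤ)
open import Data.Integer.Divisibility using (_∣_)
open import Data.Fin using (Fin; zero; suc)
open import Data.Product using (_×_; Σ; ∃; ∃-syntax; proj₁; proj₂; _,_)
open import Data.List using (List; foldr; map)
open import Data.List.Relation.Unary.AllPairs using (AllPairs)
open import Relation.Binary.PropositionalEquality using (_≡_)
open import Relation.Nullary using (¬_)

Vec3 : Set
Vec3 = Fin 3 → ℤ

Mat3 : Set
Mat3 = Fin 3 → Fin 3 → ℤ

i0 i1 i2 : Fin 3
i0 = zero
i1 = suc zero
i2 = suc (suc zero)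

sum3 : (Fin 3 → ℤ) → ℤ
sum3 f = f i0 + f i1 + f i2

_·ₘ_ : Mat3 → Mat3 → Mat3
(γ ·ₘ δ) i j = sum3 (λ k → γ i k * δ k j)

_·ᵥ_ : Mat3 → Vec3 → Vec3
(γ ·ᵥ v) i = sum3 (λ k → γ i k * v k)

idMat : Mat3
idMat zero zero = 1ℤ
idMat (suc zero) (suc zero) = 1ℤ
idMat (suc (suc zero)) (suc (suc zero)) = 1ℤ
idMat _ _ = 0ℤ

det3 : Mat3 → ℤ
det3 g =
    g i0 i0 * (g i1 i1 * g i2 i2 - g i1 i2 * g i2 i1)
  - g i0 i1 * (g i1 i0 * g i2 i2 - g i1 i2 * g i2 i0)
  + g i0 i2 * (g i1 i0 * g i2 i1 - g i1 i1 * g i2 i0)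

MatEq : Mat3 → Mat3 → Set
MatEq γ δ = ∀ i j → γ i j ≡ δ i j

InSL3 : Mat3 → Set
InSL3 γ = det3 γ ≡ 1ℤ

maxAbs3 : (Fin 3 → ℤ) → ℕ
maxAbs3 f = ∣ f i0 ∣ ⊔ ∣ f i1 ∣ ⊔ ∣ f i2 ∣

max3 : (Fin 3 → ℕ) → ℕ
max3 f = f i0 ⊔ f i1 ⊔ f i2

normInf : Mat3 → ℕ
normInf γ = max3 (λ i → maxAbs3 (γ i))

NormCond : Mat3 → ℕ → Set
NormCond γ T = ∃[ δ ] (MatEq (γ ·ₘ δ) idMat × MatEq (δ ·ₘ γ) idMat
                        × (normInf γ *ℕ normInf δ) ≤ℕ T)

-- Linear algebra over 𝔽_q, with 𝔽_q = ℤ/qℤ (q prime), vectors represented by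
-- integer lifts and all equalities taken modulo q.

_≡[_]_ : ℤ → ℕ → ℤ → Set
a ≡[ q ] b = (+ q) ∣ (a - b)

VecEq : ℕ → Vec3 → Vec3 → Set
VecEq q u v = ∀ i → u i ≡[ q ] v i

_•_ : ℤ → Vec3 → Vec3
(a • v) i = a * v i

_⊕_ : Vec3 → Vec3 → Vec3
(u ⊕ v) i = u i + v i

zeroV : Vec3
zeroV _ = 0ℤ

InSpan1 : ℕ → Vec3 → Vec3 → Set
InSpan1 q u v = ∃[ a ] VecEq q u (a • v)

InSpan2 : ℕ → Vec3 → Vec3 → Vec3 → Set
InSpan2 q u v w = ∃[ a ] ∃[ b ] VecEq q u ((a • v) ⊕ (b • w))

Indep : ℕ → Vec3 → Vec3 → Set
Indep q v w = ∀ a b → VecEq q ((a • v) ⊕ (b • w)) zeroV → (a ≡[ q ] 0ℤ) × (b ≡[ q ] 0ℤ)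

-- A complete flag (V₁, V₂) in 𝔽_q^3 is presented by a basis-start (v, w) with
-- v, w independent: V₁ = span v (dim 1), V₂ = span (v, w) (dim 2).
-- Every complete flag arises this way.
FlagRep : ℕ → Set
FlagRep q = Σ (Vec3 × Vec3) λ p → Indep q (proj₁ p) (proj₂ p)

SameFlag : ℕ → Vec3 × Vec3 → Vec3 × Vec3 → Set
SameFlag q (v , w) (v' , w') =
  (InSpan1 q v v' × InSpan1 q v' v)
  × ((InSpan2 q v v' w' × InSpan2 q w v' w')
   × (InSpan2 q v' v w × InSpan2 q w' v w))

act : Mat3 → Vec3 × Vec3 → Vec3 × Vec3
act γ (v , w) = (γ ·ᵥ v , γ ·ᵥ w)

Fixes : (q : ℕ) → Mat3 → FlagRep q → Set
Fixes q γ x = SameFlag q (act γ (proj₁ x)) (proj₁ x)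

Good : (q T : ℕ) → Mat3 × FlagRep q → Set
Good q T (γ , x) = InSL3 γ × NormCond γ T × Fixes q γ x

Distinct : (q : ℕ) → Mat3 × FlagRep q → Mat3 × FlagRep q → Set
Distinct q (γ , x) (γ' , x') = ¬ (MatEq γ γ' × SameFlag q (proj₁ x) (proj₁ x'))

{-# OPTIONS --safe #-}
module Submission where

-- A flag in 𝔽_q³ is recorded by its line and by the functional f = v × w cutting out its plane; γ fixes it iff both are
-- eigenvectors. Hence γ fixes at most 9 flags, unless γ - α has rank at most one mod q for some α, when it fixes O(q)
-- flags, or γ is scalar mod q, when it fixes O(q³). With h = γ⁻¹ it remains to bound by T^(2+ε), q^(2+ε) T and q^ε T the
-- number of γ of size T in these three classes.
--
-- All γ: a column x of γ and a row y of h with x · y = 0 and |x| |y| ≤ T are counted by factoring the three products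
-- x_a y_a, which sum to zero; if they are chosen extremal, boundedly many γ share the same x and y.
--
-- The other two classes: replacing γ by h one may assume |γ| ≤ |h|. The entries γ_ii and h_ii determine the products
-- γ_ij γ_ji and, through det γ = 1, the sum of the two 3-cycles, hence by the divisor bound all of γ up to q^ε choices,
-- unless some row or column of γ vanishes off the diagonal; such γ are few, as they come from GL₂. If γ is ≡ α mod q,
-- all γ_ii and h_ii are known mod q, and α³ ≡ 1 leaves three α.
-- If γ - α has rank one mod q, then α is a double root of the characteristic polynomial mod q, even a root mod q²; so
-- O(q) triples (α, tr γ, tr h) occur, and α and tr γ determine h_ii mod q from γ_ii.

-- The condition T ≤ C q³ does two things. It turns T², the cost of the matrices with few fixed
-- flags, into q³ T. It also turns congruences modulo q² into equations: |γ| ≤ |h| and |h| ≤ 2 |γ|²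
-- give |h|³ ≤ 2 (|γ| |h|)² ≤ 2 T², so both norms stay below a small multiple of q², and differences
-- of traces below q² itself. This is why a root modulo q², and not only modulo q, leaves O(q)
-- triples: once one reference triple is chosen for each α, the difference of any other triple from
-- its reference recovers α.
--
-- The exponent ε is a fraction n / d, and the inequality is raised to the power d. All losses are
-- powers of one maximal divisor count Δ. Even the dyadic ranges of the two norms are indexed by
-- divisors of a power of two, so their logarithmic number is absorbed in Δ.
--
-- No set is enumerated. A cardinality bound is a bound for the length of lists of pairwise distinct
-- elements, and it is proved by fixing one coordinate after another, each from an explicit list of
-- candidates that may depend on the earlier ones.

open import Defs
open import Data.Bool.Base using (Bool; true; false)
open import Data.Fin.Base using (Fin; zero; suc)
open import Data.Fin.Properties using (all?; ¬∀⟶∃¬)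
open import Data.Integer.Base as ℤ using (ℤ; +_; -[1+_]; 0ℤ; 1ℤ; -1ℤ; ∣_∣)
import Data.Integer.DivMod as ℤ÷
open import Data.Integer.Divisibility.Signed as ℤ∣ using (_∣_; divides; _∣?_; ∣ᵤ⇒∣; ∣⇒∣ᵤ)
import Data.Integer.Properties as ℤₚ
open import Data.Integer.Tactic.RingSolver using (solve-∀)
open import Data.List using (List; []; _∷_; length; _++_; map; filter; upTo; cartesianProduct)
open import Data.List.Membership.Propositional using (_∈_; lose; find)
open import Data.List.Membership.Propositional.Properties
  using (∈-upTo⁺; ∈-upTo⁻; ∈-map⁺; ∈-map⁻; ∈-filter⁺; ∈-++⁺ˡ; ∈-++⁺ʳ; ∈-cartesianProduct⁺)
open import Data.List.Properties using (length-map; length-upTo; length-++)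
open import Data.List.Relation.Unary.All as All using (All; []; _∷_)
import Data.List.Relation.Unary.All.Properties as Allₚ
open import Data.List.Relation.Unary.AllPairs as AllPairs using (AllPairs; []; _∷_)
import Data.List.Relation.Unary.AllPairs.Properties as AllPairsₚ
open import Data.List.Relation.Unary.Any as Any using (Any; here; there)
import Data.List.Relation.Unary.Unique.Propositional.Properties as Uniqueₚ
open import Data.Maybe.Base using (Maybe; just; nothing)
open import Data.Nat.Base using
  (ℕ; zero; suc; z≤n; s≤s; s≤s⁻¹; NonZero; nonZero; >-nonZero; >-nonZero⁻¹; n>1⇒nonTrivial)
import Data.Nat.Base as ℕ
open import Data.Nat.Coprimality using (coprime-Bézout)
import Data.Nat.DivMod as ℕ÷
open import Data.Nat.Divisibility as ℕ∣ using () renaming (_∣_ to _∣ℕ_; _∣?_ to _∣ℕ?_; divides to dividesℕ)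
open import Data.Nat.GCD using (module Bézout)
open import Data.Nat.Induction using (<-rec)
open import Data.Nat.ListAction using (product)
open import Data.Nat.ListAction.Properties using (∈⇒∣product)
open import Data.Nat.Primality
  using (Prime; euclidsLemma; _Rough_; 2-rough; ∤⇒rough-suc; rough∧∣⇒rough; rough⇒≤; rough∧∣⇒prime;
         prime⇒nonZero; prime⇒nonTrivial; prime⇒irreducible; ¬prime[1])
open import Data.Nat.Primality.Factorisation using (PrimeFactorisation; factorise)
import Data.Nat.Properties as ℕₚ
open import Data.Nat.Tactic.RingSolver using () renaming (solve-∀ to solveℕ-∀)
open import Data.Product using (Σ; _×_; _,_; proj₁; proj₂; ∃-syntax)
import Data.Product.Properties as Productₚ
open import Data.Sum using (_⊎_; inj₁; inj₂; swap)
open import Data.Unit using (⊤; tt)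
open import Function using (_∘_; _⟨_⟩_)
open import Relation.Binary.PropositionalEquality
open import Relation.Nullary using (¬_; Dec; yes; no; contradiction)
open import Relation.Nullary.Decidable using (_×-dec_; _⊎-dec_)

-- Lists of pairwise distinct elements of a set

module _ where
  open import Data.Nat.Base using (_+_; _*_; _≤_)

  -- An upper bound for cardinality relative to an apartness `R`. Sets taken up to an equivalence,
  -- such as flags or residues, are counted without forming a quotient, and infinite types need no
  -- finiteness proof.
  Bounded : {X : Set} → (X → X → Set) → (X → Set) → ℕ → Set
  Bounded R P N = ∀ L → AllPairs R L → All P L → length L ≤ N

  ×-distrib-⊎ : {A B C : Set} → A → B ⊎ C → (A × B) ⊎ (A × C)
  ×-distrib-⊎ a (inj₁ b) = inj₁ (a , b)
  ×-distrib-⊎ a (inj₂ c) = inj₂ (a , c)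

  ×-decide : {A B : Set} → A → Dec B → (A × B) ⊎ (A × ¬ B)
  ×-decide a (yes b) = inj₁ (a , b)
  ×-decide a (no n) = inj₂ (a , n)

  private
    variable
      X Y : Set
      R S : X → X → Set
      P Q O : X → Set
      M N : ℕ

  private
    record Split {X : Set} (R : X → X → Set) (P Q : X → Set) (L : List X) : Set₁ where
      field
        left right : List X
        left-pairs : AllPairs R left
        right-pairs : AllPairs R right
        left-all : All P left
        right-all : All Q right
        -- Being a sublist is recorded through its effect on `All`, which carries the apartness of a
        -- head from the whole list to its part.
        left-⊆ : ∀ {Z : X → Set} → All Z L → All Z left
        right-⊆ : ∀ {Z : X → Set} → All Z L → All Z right
        total : length L ≡ length left + length right

    split : {R : X → X → Set} (L : List X) → AllPairs R L → All (λ x → P x ⊎ Q x) L → Split R P Q L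
    split [] [] [] = record
      { left-pairs = [] ; right-pairs = [] ; left-all = [] ; right-all = []
      ; left-⊆ = λ a → a ; right-⊆ = λ a → a ; total = refl }
    split (x ∷ L) (r ∷ rs) (inj₁ p ∷ ps) = record
      { left-pairs = S.left-⊆ r ∷ S.left-pairs ; right-pairs = S.right-pairs
      ; left-all = p ∷ S.left-all ; right-all = S.right-all
      ; left-⊆ = λ { (a ∷ as) → a ∷ S.left-⊆ as } ; right-⊆ = λ { (_ ∷ as) → S.right-⊆ as }
      ; total = cong suc S.total }
      where module S = Split (split L rs ps)
    split (x ∷ L) (r ∷ rs) (inj₂ q ∷ ps) = record
      { left-pairs = S.left-pairs ; right-pairs = S.right-⊆ r ∷ S.right-pairs
      ; left-all = S.left-all ; right-all = q ∷ S.right-all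
      ; left-⊆ = λ { (_ ∷ as) → S.left-⊆ as } ; right-⊆ = λ { (a ∷ as) → a ∷ S.right-⊆ as }
      ; total = trans (cong suc S.total) (sym (ℕₚ.+-suc (length S.left) (length S.right))) }
      where module S = Split (split L rs ps)

  bounded-⊆ : (∀ x → P x → Q x) → Bounded R Q N → Bounded R P N
  bounded-⊆ f b L rs ps = b L rs (All.map (f _) ps)

  bounded-≤ : M ≤ N → Bounded R P M → Bounded R P N
  bounded-≤ M≤N b L rs ps = ℕₚ.≤-trans (b L rs ps) M≤N

  bounded-empty : (∀ x → ¬ P x) → Bounded R P 0
  bounded-empty f [] _ _ = z≤n
  bounded-empty f (x ∷ L) _ (p ∷ _) = contradiction p (f x)

  bounded-⊎ : (∀ x → P x → Q x ⊎ O x) → Bounded R Q M → Bounded R O N → Bounded R P (M + N)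
  bounded-⊎ f b c L rs ps = subst (_≤ _) (sym S.total)
    (ℕₚ.+-mono-≤ (b S.left S.left-pairs S.left-all) (c S.right S.right-pairs S.right-all))
    where module S = Split (split L rs (All.map (f _) ps))

  bounded-one : (∀ x y → P x → P y → ¬ R x y) → Bounded R P 1
  bounded-one f [] _ _ = z≤n
  bounded-one f (x ∷ []) _ _ = s≤s z≤n
  bounded-one f (x ∷ y ∷ L) ((r ∷ _) ∷ _) (p ∷ p′ ∷ _) = contradiction r (f x y p p′)

  -- A bound may be proved relative to a member of the set: a nonempty list supplies its own
  -- reference point.
  bounded-based : (∀ x → P x → Bounded R P N) → Bounded R P N
  bounded-based f [] _ _ = z≤n
  bounded-based f (x ∷ L) rs (p ∷ ps) = f x p (x ∷ L) rs (p ∷ ps)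

  -- Chaining this lemma is the basic counting method: each use fixes one more code, adds that
  -- information to the property, and multiplies the bound by the number of codes. Codes need not be
  -- unique, since overcounting is harmless.
  bounded-cover : {C : Set} {R : X → X → Set} {P : X → Set} (Q : X → C → Set) (K : List C) →
                  (∀ x → P x → Any (Q x) K) →
                  (∀ c → Bounded R (λ x → P x × Q x c) N) → Bounded R P (length K * N)
  bounded-cover Q [] f b = bounded-empty (λ x p → case-[] (f x p))
    where
    case-[] : ∀ {x} → ¬ Any (Q x) []
    case-[] ()
  bounded-cover {P = P} Q (c ∷ K) f b =
    bounded-⊎ {Q = λ x → P x × Q x c} {O = λ x → P x × Any (Q x) K}
      (λ x p → classify x p (f x p)) (b c)
      (bounded-cover Q K (λ x → proj₂) λ c → bounded-⊆ (λ x ((p , _) , q) → p , q) (b c))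
    where
    classify : ∀ x → P x → Any (Q x) (c ∷ K) → (P x × Q x c) ⊎ (P x × Any (Q x) K)
    classify x p (here q) = inj₁ (p , q)
    classify x p (there a) = inj₂ (p , a)

  bounded-fix : {C : Set} {R : X → X → Set} {P : X → Set} (f : X → C) (K : List C) →
                (∀ x → P x → f x ∈ K) →
                (∀ c → Bounded R (λ x → P x × f x ≡ c) N) → Bounded R P (length K * N)
  bounded-fix f = bounded-cover (λ x c → f x ≡ c)

  bounded-map : (f : X → Y) → (∀ x y → P x → P y → R x y → S (f x) (f y)) → (∀ x → P x → Q (f x)) →
                Bounded S Q N → Bounded R P N
  bounded-map {X = X} {Y = Y} {P = P} {R = R} {S = S} {Q = Q} f g h b L rs ps = 
    subst (_≤ _) (length-map f L) (b (map f L) (pairs L rs ps) (all ps))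
    where
    all : ∀ {L} → All P L → All Q (map f L)
    all [] = []
    all (p ∷ ps) = h _ p ∷ all ps
    heads : ∀ {x} L → P x → All P L → All (R x) L → All (S (f x)) (map f L)
    heads [] _ _ _ = []
    heads (y ∷ L) p (p′ ∷ ps) (r ∷ rs) = g _ y p p′ r ∷ heads L p ps rs
    pairs : ∀ L → AllPairs R L → All P L → AllPairs S (map f L)
    pairs [] _ _ = []
    pairs (x ∷ L) (r ∷ rs) (p ∷ ps) = heads L p ps r ∷ pairs L rs ps

  -- The witnesses are read off from the proofs stored in the list, so they become data on which a
  -- later step can branch. Apartness still concerns the first component alone.
  bounded-choose : {C : Set} {R : X → X → Set} {Q : X → C → Set} →
                   Bounded (λ (x , _) (y , _) → R x y) (λ (x , c) → Q x c) N →
                   Bounded R (λ x → ∃[ c ] Q x c) N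
  bounded-choose {X = X} {C = C} {R = R} {Q = Q} b L rs ps =
    subst (_≤ _) (size ps) (b (zip ps) (pairs L rs ps) (all ps))
    where
    zip : ∀ {L} → All (λ x → ∃[ c ] Q x c) L → List (X × C)
    zip [] = []
    zip {x ∷ _} ((c , _) ∷ ps) = (x , c) ∷ zip ps
    size : ∀ {L} (ps : All (λ x → ∃[ c ] Q x c) L) → length (zip ps) ≡ length L
    size [] = refl
    size (_ ∷ ps) = cong suc (size ps)
    all : ∀ {L} (ps : All (λ x → ∃[ c ] Q x c) L) → All (λ (x , c) → Q x c) (zip ps)
    all [] = []
    all ((c , q) ∷ ps) = q ∷ all ps
    heads : ∀ {x L} (ps : All (λ x → ∃[ c ] Q x c) L) → All (R x) L → All (λ (y , _) → R x y) (zip ps)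
    heads [] [] = []
    heads (_ ∷ ps) (r ∷ rs) = r ∷ heads ps rs
    pairs : ∀ L → AllPairs R L → (ps : All (λ x → ∃[ c ] Q x c) L) → AllPairs _ (zip ps)
    pairs [] [] [] = []
    pairs (x ∷ L) (r ∷ rs) (_ ∷ ps) = heads ps r ∷ pairs L rs ps

  -- Values times fibre size, by induction on the number of values: the fibre through the head is
  -- split off, and since the remaining values are all apart from `f x`, they can only be one fewer.
  -- The values need no enumeration, only a decidable relation.
  bounded-fiber : {R : X → X → Set} {P : X → Set} {_~_ : Y → Y → Set} {S : Y → Set} (f : X → Y) →
                  (∀ y z → Dec (y ~ z)) →
                  Bounded (λ y z → ¬ y ~ z) S N → (∀ x → P x → S (f x)) →
                  (∀ x → P x → Bounded R (λ z → P z × f x ~ f z) M) → Bounded R P (N * M)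
  bounded-fiber {N = zero} f dec b s fiber [] _ _ = z≤n
  bounded-fiber {N = zero} f dec b s fiber (x ∷ L) _ (p ∷ _) =
    contradiction (b (f x ∷ []) ([] ∷ []) (s x p ∷ [])) λ ()
  bounded-fiber {N = suc N} {P = P} {_~_ = _~_} {S = S} f dec b s fiber = bounded-based λ x p →
    bounded-⊎ {Q = λ z → P z × f x ~ f z} {O = λ z → P z × ¬ f x ~ f z}
      (λ z p′ → ×-decide p′ (dec (f x) (f z)))
      (fiber x p)
      (bounded-fiber {S = λ y → S y × ¬ f x ~ y} f dec
        (λ L rs ss → s≤s⁻¹ (b (f x ∷ L) (All.map proj₂ ss ∷ rs) (s x p ∷ All.map proj₁ ss)))
        (λ z (p′ , n) → s z p′ , n)
        (λ z (p′ , _) → bounded-⊆ (λ w ((a , _) , c) → a , c) (fiber z p′)))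

  bounded-cover-≤ : ∀ {k} {C : Set} {R : X → X → Set} {P : X → Set} (Q : X → C → Set) (K : List C) →
                    length K ≤ k → (∀ x → P x → Any (Q x) K) →
                    (∀ c → Bounded R (λ x → P x × Q x c) N) → Bounded R P (k * N)
  bounded-cover-≤ {N = N} Q K le f b = bounded-≤ (ℕₚ.*-monoˡ-≤ N le) (bounded-cover Q K f b)

  bounded-fix-≤ : ∀ {k} {C : Set} {R : X → X → Set} {P : X → Set} (f : X → C) (K : List C) →
                  length K ≤ k → (∀ x → P x → f x ∈ K) →
                  (∀ c → Bounded R (λ x → P x × f x ≡ c) N) → Bounded R P (k * N)
  bounded-fix-≤ f = bounded-cover-≤ (λ x c → f x ≡ c)

-- The divisor bound

module _ where
  open import Data.Nat.Base using (_+_; _*_; _^_; _≤_; _<_; _⊔_)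
  open ℕₚ.≤-Reasoning

  suc-≤-2^ : ∀ n → suc n ≤ 2 ^ n
  suc-≤-2^ zero = ℕₚ.≤-refl
  suc-≤-2^ (suc n) = ℕₚ.+-mono-≤ (ℕₚ.m^n>0 2 n) (ℕₚ.≤-trans (suc-≤-2^ n) (ℕₚ.m≤m+n (2 ^ n) 0))

  ^-distribʳ-* : ∀ m n k → (m * n) ^ k ≡ m ^ k * n ^ k
  ^-distribʳ-* m n zero = refl
  ^-distribʳ-* m n (suc k) = trans (cong (m * n *_) (^-distribʳ-* m n k)) (rearrange m n (m ^ k) (n ^ k))
    where
    rearrange : ∀ a b c d → a * b * (c * d) ≡ a * c * (b * d)
    rearrange = solveℕ-∀

  -- Raise e + 1 ≤ k (e/k + 1) ≤ k 2^(e/k), with integer quotients, to the power k. This is the cost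
  -- k^k of one small prime in the divisor bound.
  suc^-≤-2^ : ∀ k .{{_ : NonZero k}} e → suc e ^ k ≤ k ^ k * 2 ^ e
  suc^-≤-2^ k e = begin
    suc e ^ k                 ≤⟨ ℕₚ.^-monoˡ-≤ k suc-e≤ ⟩
    (k * 2 ^ (e ℕ÷./ k)) ^ k     ≡⟨ ^-distribʳ-* k (2 ^ (e ℕ÷./ k)) k ⟩
    k ^ k * (2 ^ (e ℕ÷./ k)) ^ k ≡⟨ cong (k ^ k *_) (ℕₚ.^-*-assoc 2 (e ℕ÷./ k) k) ⟩
    k ^ k * 2 ^ (e ℕ÷./ k * k)   ≤⟨ ℕₚ.*-monoʳ-≤ (k ^ k) (ℕₚ.^-monoʳ-≤ 2 e/k*k≤e) ⟩
    k ^ k * 2 ^ e             ∎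
    where
    e/k*k≤e : e ℕ÷./ k * k ≤ e
    e/k*k≤e = subst (e ℕ÷./ k * k ≤_) (sym (ℕ÷.m≡m%n+[m/n]*n e k)) (ℕₚ.m≤n+m (e ℕ÷./ k * k) (e ℕ÷.% k))
    suc-e≤ : suc e ≤ k * 2 ^ (e ℕ÷./ k)
    suc-e≤ = begin
      suc e                     ≡⟨ cong suc (ℕ÷.m≡m%n+[m/n]*n e k) ⟩
      suc (e ℕ÷.% k) + e ℕ÷./ k * k   ≤⟨ ℕₚ.+-monoˡ-≤ (e ℕ÷./ k * k) (ℕ÷.m%n<n e k) ⟩
      suc (e ℕ÷./ k) * k           ≤⟨ ℕₚ.*-monoˡ-≤ k (suc-≤-2^ (e ℕ÷./ k)) ⟩
      2 ^ (e ℕ÷./ k) * k           ≡⟨ ℕₚ.*-comm _ k ⟩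
      k * 2 ^ (e ℕ÷./ k)           ∎

  DivisorBound : ℕ → ℕ → Set
  DivisorBound n N = Bounded (λ d e → ¬ d ≡ e) (_∣ℕ n) N

  ∣-prime*⇒ : ∀ {p d} m → Prime p → d ∣ℕ p * m → d ∣ℕ m ⊎ ∃[ e ] (d ≡ p * e × e ∣ℕ m)
  ∣-prime*⇒ {p} {d} m pr (dividesℕ c eq) with euclidsLemma c d pr (dividesℕ m (trans (sym eq) (ℕₚ.*-comm p m)))
  ... | inj₁ (dividesℕ c′ refl) = inj₁ (dividesℕ c′ (ℕₚ.*-cancelˡ-≡ m (c′ * d) p {{prime⇒nonZero pr}}
    (trans eq (rearrange c′ p d))))
    where
    rearrange : ∀ a b c → a * b * c ≡ b * (a * c)
    rearrange = solveℕ-∀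
  ... | inj₂ (dividesℕ e refl) = inj₂ (e , ℕₚ.*-comm e p , dividesℕ c (ℕₚ.*-cancelˡ-≡ m (c * e) p {{prime⇒nonZero pr}}
    (trans eq (rearrange c e p))))
    where
    rearrange : ∀ a b c → a * (b * c) ≡ c * (a * b)
    rearrange = solveℕ-∀

  ∣-prime^*⇒ : ∀ {p d} m → Prime p → ∀ e → d ∣ℕ p ^ e * m → ∃[ i ] (i < suc e × ∃[ c ] (d ≡ p ^ i * c × c ∣ℕ m))
  ∣-prime^*⇒ {d = d} m pr zero d∣ = 0 , s≤s z≤n , d , sym (ℕₚ.*-identityˡ d) , subst (_ ∣ℕ_) (ℕₚ.*-identityˡ m) d∣
  ∣-prime^*⇒ {p} {d} m pr (suc e) d∣ with ∣-prime*⇒ {p} {d} (p ^ e * m) pr (subst (d ∣ℕ_) (ℕₚ.*-assoc p (p ^ e) m) d∣)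
  ... | inj₁ d∣m = let i , i<e , rest = ∣-prime^*⇒ m pr e d∣m in i , ℕₚ.m<n⇒m<1+n i<e , rest
  ... | inj₂ (d′ , refl , d′∣m) = let i , i<e , c , d′≡ , c∣m = ∣-prime^*⇒ m pr e d′∣m in
    suc i , s≤s i<e , c , trans (cong (p *_) d′≡) (sym (ℕₚ.*-assoc p (p ^ i) c)) , c∣m

  -- A divisor is p^i c with i ≤ e and c a divisor of m. If p divides m this overcounts, which an
  -- upper bound permits.
  divisorBound-prime^* : ∀ {p} m {N} → Prime p → ∀ e → DivisorBound m N → DivisorBound (p ^ e * m) (suc e * N)
  divisorBound-prime^* {p} m {N} pr e b = subst (λ l → DivisorBound (p ^ e * m) (l * N)) (length-upTo (suc e))
    (bounded-cover (λ d i → ∃[ c ] (d ≡ p ^ i * c × c ∣ℕ m)) (upTo (suc e))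
      (λ d d∣ → let i , i<e , rest = ∣-prime^*⇒ m pr e d∣ in lose (∈-upTo⁺ i<e) rest)
      (λ i → bounded-⊆ (λ d → proj₂) (bounded-choose (bounded-map proj₂
        (λ { (_ , c) (_ , c′) (refl , _) (refl , _) ne refl → ne refl }) (λ _ → proj₂) b))))

  -- Each prime factor, repeated or not, at most doubles the number of divisors, and 2^k ≤ p pays
  -- for the doubling in the k-th power.
  divisorBound-product : ∀ k ps → All Prime ps → All (2 ^ k ≤_) ps →
                         ∃[ N ] (DivisorBound (product ps) N × N ^ k ≤ product ps)
  divisorBound-product k [] [] [] = 1 , bounded-one (λ x y p q ne → ne (trans (ℕ∣.∣1⇒≡1 p) (sym (ℕ∣.∣1⇒≡1 q))))
    , ℕₚ.≤-reflexive (ℕₚ.^-zeroˡ k)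
  divisorBound-product k (p ∷ ps) (pr ∷ prs) (large ∷ larges) =
    let N , b , N≤ = divisorBound-product k ps prs larges in
    2 * N ,
    subst (λ x → DivisorBound (x * product ps) (2 * N)) (ℕₚ.^-identityʳ p) (divisorBound-prime^* (product ps) pr 1 b)
      ,
    (begin
      (2 * N) ^ k    ≡⟨ ^-distribʳ-* 2 N k ⟩
      2 ^ k * N ^ k  ≤⟨ ℕₚ.*-mono-≤ large N≤ ⟩
      p * product ps ∎)

  extract-power : ∀ b → 1 < b → ∀ n → 0 < n → ∃[ e ] ∃[ m ] (n ≡ b ^ e * m × ¬ b ∣ℕ m)
  extract-power b 1<b = <-rec _ λ n rec 0<n → go n rec 0<n (b ∣ℕ? n)
    where
    go : ∀ n → (∀ {m} → m < n → 0 < m → ∃[ e ] ∃[ l ] (m ≡ b ^ e * l × ¬ b ∣ℕ l)) → 0 < n → Dec (b ∣ℕ n) →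
         ∃[ e ] ∃[ m ] (n ≡ b ^ e * m × ¬ b ∣ℕ m)
    go n rec 0<n (no ∤) = 0 , n , sym (ℕₚ.*-identityˡ n) , ∤
    go n rec 0<n (yes b∣n@(dividesℕ c refl)) =
      let e , m , c≡ , ∤ = rec (ℕ∣.quotient-< b∣n {{n>1⇒nonTrivial 1<b}} {{>-nonZero 0<n}})
                              (>-nonZero⁻¹ c {{ℕ∣.quotient≢0 b∣n {{>-nonZero 0<n}}}})
      in suc e , m , trans (ℕₚ.*-comm c b) (trans (cong (b *_) c≡) (sym (ℕₚ.*-assoc b (b ^ e) m))) , ∤

  -- Primes p ≥ 2^k contribute a factor (e+1)^k ≤ p^e and cost nothing; the finitely many smaller ones
  -- each cost a constant factor k^k.
  RoughDivisorBound : ℕ → ℕ → Set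
  RoughDivisorBound k b = ∃[ C ] ∀ n → 0 < n → b Rough n → ∃[ N ] (DivisorBound n N × N ^ k ≤ C * n)

  roughDivisorBound-large : ∀ k b → 2 ^ k ≤ b → RoughDivisorBound k b
  roughDivisorBound-large k b 2^k≤b = 1 , λ n 0<n rough →
    let open PrimeFactorisation (factorise n {{>-nonZero 0<n}})
        N , bd , N≤ = divisorBound-product k factors factorsPrime (All.tabulate λ {p} p∈ →
          ℕₚ.≤-trans 2^k≤b (rough⇒≤ {{prime⇒nonTrivial (All.lookup factorsPrime p∈)}}
            (rough∧∣⇒rough rough (subst (p ∣ℕ_) (sym isFactorisation) (∈⇒∣product p∈)))))
    in N , subst (λ x → DivisorBound x N) (sym isFactorisation) bd ,
       ℕₚ.≤-trans N≤ (ℕₚ.≤-reflexive (trans (sym isFactorisation) (sym (ℕₚ.*-identityˡ n))))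

  roughDivisorBound-pred : ∀ k .{{_ : NonZero k}} b → 1 < b → RoughDivisorBound k (suc b) → RoughDivisorBound k b
  roughDivisorBound-pred k b 1<b (C , bound) = k ^ k * C , λ n 0<n rough → go n 0<n rough (b ∣ℕ? n)
    where
    1≤k^k : 1 ≤ k ^ k
    1≤k^k = ℕₚ.m^n>0 k k
    go : ∀ n → 0 < n → b Rough n → Dec (b ∣ℕ n) → ∃[ N ] (DivisorBound n N × N ^ k ≤ k ^ k * C * n)
    go n 0<n rough (no ∤) = let N , bd , N≤ = bound n 0<n (∤⇒rough-suc ∤ rough) in
      N , bd , (begin
        N ^ k             ≤⟨ N≤ ⟩
        C * n             ≡⟨ ℕₚ.*-identityˡ (C * n) ⟨
        1 * (C * n)       ≤⟨ ℕₚ.*-monoˡ-≤ (C * n) 1≤k^k ⟩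
        k ^ k * (C * n)   ≡⟨ ℕₚ.*-assoc (k ^ k) C n ⟨
        k ^ k * C * n     ∎)
    go n 0<n rough (yes b∣n) with extract-power b 1<b n 0<n
    ... | e , m , refl , ∤ =
      -- A `b`-rough number has no divisor between 1 and b, so b itself is prime as soon as it
      -- divides n.
      let pr = rough∧∣⇒prime {{n>1⇒nonTrivial 1<b}} rough b∣n
          0<m = >-nonZero⁻¹ m {{ℕₚ.m*n≢0⇒n≢0 (b ^ e) {{>-nonZero 0<n}}}}
          N , bd , N≤ = bound m 0<m (∤⇒rough-suc ∤ (rough∧∣⇒rough rough (ℕ∣.n∣m*n (b ^ e))))
      in suc e * N , divisorBound-prime^* m pr e bd , (begin
        (suc e * N) ^ k               ≡⟨ ^-distribʳ-* (suc e) N k ⟩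
        suc e ^ k * N ^ k             ≤⟨ ℕₚ.*-mono-≤ (suc^-≤-2^ k e) N≤ ⟩
        k ^ k * 2 ^ e * (C * m)       ≤⟨ ℕₚ.*-monoˡ-≤ (C * m) (ℕₚ.*-monoʳ-≤ (k ^ k) (ℕₚ.^-monoˡ-≤ e 1<b)) ⟩
        k ^ k * b ^ e * (C * m)       ≡⟨ rearrange (k ^ k) (b ^ e) C m ⟩
        k ^ k * C * (b ^ e * m)       ∎)
      where
      rearrange : ∀ a b c d → a * b * (c * d) ≡ a * c * (b * d)
      rearrange = solveℕ-∀

  -- Descent from the threshold 2^k, where all primes are large, to `b`; `j` bounds the remaining
  -- distance.
  roughDivisorBound : ∀ k .{{_ : NonZero k}} j b → 1 < b → 2 ^ k ≤ j + b → RoughDivisorBound k b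
  roughDivisorBound k zero b _ 2^k≤ = roughDivisorBound-large k b 2^k≤
  roughDivisorBound k (suc j) b 1<b 2^k≤ = roughDivisorBound-pred k b 1<b
    (roughDivisorBound k j (suc b) (ℕₚ.m<n⇒m<1+n 1<b) (subst (2 ^ k ≤_) (sym (ℕₚ.+-suc j b)) 2^k≤))

  divisorList : ℕ → List ℕ
  divisorList n = filter (_∣ℕ? n) (map suc (upTo n))

  ∈-divisorList : ∀ {d n} → d ∣ℕ n → 0 < n → d ∈ divisorList n
  ∈-divisorList {zero} d∣n 0<n = contradiction (ℕ∣.0∣⇒≡0 d∣n) (ℕₚ.>⇒≢ 0<n)
  ∈-divisorList {suc d} {n} d∣n 0<n =
    ∈-filter⁺ (_∣ℕ? n) (∈-map⁺ suc (∈-upTo⁺ (ℕ∣.∣⇒≤ {{>-nonZero 0<n}} d∣n))) d∣n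

  divisorList-bound : ∀ {n N} → DivisorBound n N → length (divisorList n) ≤ N
  divisorList-bound {n} b = b (divisorList n)
    (AllPairsₚ.filter⁺ (_∣ℕ? n) (AllPairsₚ.map⁺ (AllPairs.map (λ ne eq → ne (ℕₚ.suc-injective eq))
      (Uniqueₚ.upTo⁺ n))))
    (Allₚ.all-filter (_∣ℕ? n) (map suc (upTo n)))

  -- One monotone quantity for all numbers up to a bound, so that the length of a list of candidates
  -- does not depend on which number is being factored. The value 1 at zero keeps it positive.
  maxDivisors : ℕ → ℕ
  maxDivisors zero = 1
  maxDivisors (suc n) = length (divisorList (suc n)) ⊔ maxDivisors n

  divisorList-≤-max : ∀ X n → n ≤ X → length (divisorList n) ≤ maxDivisors X
  divisorList-≤-max zero .zero z≤n = z≤n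
  divisorList-≤-max (suc X) n n≤X with ℕₚ.m≤n⇒m<n∨m≡n n≤X
  ... | inj₁ n<X = ℕₚ.≤-trans (divisorList-≤-max X n (s≤s⁻¹ n<X)) (ℕₚ.m≤n⊔m _ _)
  ... | inj₂ refl = ℕₚ.m≤m⊔n _ _

  maxDivisors≥1 : ∀ X → 1 ≤ maxDivisors X
  maxDivisors≥1 zero = ℕₚ.≤-refl
  maxDivisors≥1 (suc X) = ℕₚ.≤-trans (maxDivisors≥1 X) (ℕₚ.m≤n⊔m _ _)

  maxDivisors-bound : ∀ k .{{_ : NonZero k}} → ∃[ C ] ∀ X → maxDivisors X ^ k ≤ suc C * suc X
  maxDivisors-bound k = C , go
    where
    C = proj₁ (roughDivisorBound k (2 ^ k) 2 ℕₚ.≤-refl (ℕₚ.m≤m+n (2 ^ k) 2))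
    go : ∀ X → maxDivisors X ^ k ≤ suc C * suc X
    go zero = ℕₚ.≤-trans (ℕₚ.≤-reflexive (ℕₚ.^-zeroˡ k)) (s≤s z≤n)
    go (suc X) with ℕₚ.⊔-sel (length (divisorList (suc X))) (maxDivisors X)
    ... | inj₁ eq = let N , b , N≤ = proj₂ (roughDivisorBound k (2 ^ k) 2 ℕₚ.≤-refl (ℕₚ.m≤m+n (2 ^ k) 2)) (suc X)
                          (s≤s z≤n) 2-rough in begin
      maxDivisors (suc X) ^ k            ≡⟨ cong (_^ k) eq ⟩
      length (divisorList (suc X)) ^ k   ≤⟨ ℕₚ.^-monoˡ-≤ k (divisorList-bound b) ⟩
      N ^ k                              ≤⟨ N≤ ⟩
      C * suc X                          ≤⟨ ℕₚ.*-mono-≤ (ℕₚ.n≤1+n C) (ℕₚ.n≤1+n (suc X)) ⟩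
      suc C * suc (suc X)                ∎
    ... | inj₂ eq = begin
      maxDivisors (suc X) ^ k            ≡⟨ cong (_^ k) eq ⟩
      maxDivisors X ^ k                  ≤⟨ go X ⟩
      suc C * suc X                      ≤⟨ ℕₚ.*-monoʳ-≤ (suc C) (ℕₚ.n≤1+n (suc X)) ⟩
      suc C * suc (suc X)                ∎

-- Divisibility, residue classes and divisors of integers

module _ where
  open import Data.Integer.Base using (_+_; _*_; _-_; -_)

  ∣-resp-≡ : ∀ {m x y} → y ≡ x → m ∣ x → m ∣ y
  ∣-resp-≡ refl d = d

  ∣-combine₁ : ∀ {m x} a {y} → y ≡ a * x → m ∣ x → m ∣ y
  ∣-combine₁ a eq d = ∣-resp-≡ eq (ℤ∣.∣n⇒∣m*n a d)

  ∣-combine₂ : ∀ {m x x′} a a′ {y} → y ≡ a * x + a′ * x′ → m ∣ x → m ∣ x′ → m ∣ y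
  ∣-combine₂ a a′ eq d d′ = ∣-resp-≡ eq (ℤ∣.∣m∣n⇒∣m+n (ℤ∣.∣n⇒∣m*n a d) (ℤ∣.∣n⇒∣m*n a′ d′))

  ∣-combine₃ : ∀ {m x x′ x″} a a′ a″ {y} → y ≡ a * x + a′ * x′ + a″ * x″ → m ∣ x → m ∣ x′ → m ∣ x″ → m ∣ y
  ∣-combine₃ a a′ a″ eq d d′ d″ = ∣-resp-≡ eq
    (ℤ∣.∣m∣n⇒∣m+n (ℤ∣.∣m∣n⇒∣m+n (ℤ∣.∣n⇒∣m*n a d) (ℤ∣.∣n⇒∣m*n a′ d′)) (ℤ∣.∣n⇒∣m*n a″ d″))

  ∣-combine₄ : ∀ {m x x′ x″ x‴} a a′ a″ a‴ {y} → y ≡ a * x + a′ * x′ + a″ * x″ + a‴ * x‴ →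
               m ∣ x → m ∣ x′ → m ∣ x″ → m ∣ x‴ → m ∣ y
  ∣-combine₄ a a′ a″ a‴ eq d d′ d″ d‴ = ∣-resp-≡ eq (ℤ∣.∣m∣n⇒∣m+n
    (ℤ∣.∣m∣n⇒∣m+n (ℤ∣.∣m∣n⇒∣m+n (ℤ∣.∣n⇒∣m*n a d) (ℤ∣.∣n⇒∣m*n a′ d′)) (ℤ∣.∣n⇒∣m*n a″ d″)) (ℤ∣.∣n⇒∣m*n a‴ d‴))

  ∣-zero : ∀ {m x} → x ≡ 0ℤ → m ∣ x
  ∣-zero eq = ∣-resp-≡ eq (divides 0ℤ refl)

  ∣-small⇒≡0 : ∀ {m x} → + m ∣ x → ∣ x ∣ ℕ.< m → x ≡ 0ℤ
  ∣-small⇒≡0 {m} {x} d lt with ∣ x ∣ in eq | ∣⇒∣ᵤ d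
  ... | zero  | _ = ℤₚ.∣i∣≡0⇒i≡0 eq
  ... | suc n | d′ = contradiction (ℕ∣.∣⇒≤ d′) (ℕₚ.<⇒≱ lt)

  m-n≡0⇒m≡n : ∀ {x y} → x - y ≡ 0ℤ → x ≡ y
  m-n≡0⇒m≡n {x} {y} = ℤₚ.i-j≡0⇒i≡j x y

  residue-unique : ∀ {q a b} → a ℕ.< q → b ℕ.< q → + q ∣ + a - + b → a ≡ b
  residue-unique {q} {a} {b} a<q b<q d = ℤₚ.+-injective (m-n≡0⇒m≡n (∣-small⇒≡0 d
    (subst (λ z → ∣ z ∣ ℕ.< q) (sym (ℤₚ.[+m]-[+n]≡m⊖n a b))
      (ℕₚ.≤-<-trans (ℤₚ.∣m⊝n∣≤m⊔n a b) (ℕₚ.⊔-lub a<q b<q)))))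

  -- Translation by A reduces residue classes in [-A, A] to division with remainder of naturals.
  shift : ∀ A x → ∣ x ∣ ℕ.≤ A → ∃[ Y ] (x ≡ + Y - + A × Y ℕ.≤ A ℕ.+ A)
  shift A (+ n) n≤A = A ℕ.+ n , identity (+ A) (+ n) , ℕₚ.+-monoʳ-≤ A n≤A
    where
    identity : ∀ a n → n ≡ a + n - a
    identity = solve-∀
  shift A -[1+ n ] n<A = A ℕ.∸ suc n , eq , ℕₚ.≤-trans (ℕₚ.m∸n≤m A (suc n)) (ℕₚ.m≤m+n A A)
    where
    identity : ∀ a n → - n ≡ a - n - a
    identity = solve-∀
    eq : -[1+ n ] ≡ + (A ℕ.∸ suc n) - + A
    eq = trans (identity (+ A) (+ suc n))
      (cong (_- + A) (trans (ℤₚ.[+m]-[+n]≡m⊖n A (suc n)) (ℤₚ.⊖-≥ n<A)))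

  module _ (q : ℕ) .{{_ : NonZero q}} where

    -- Contains all x ≡ r modulo q with |x| ≤ A, as translates of ρ + k q, where ρ is the remainder
    -- of r + A and k ≤ 2A/q. The last member may exceed A; in return the length depends on A and q
    -- alone.
    residueClass : ℕ → ℤ → List ℤ
    residueClass A r = map (λ k → + ((r + + A) ℤ÷.%ℕ q ℕ.+ k ℕ.* q) - + A) (upTo (suc ((A ℕ.+ A) ℕ÷./ q)))

    residueClass-length : ∀ A r → length (residueClass A r) ℕ.* q ℕ.≤ A ℕ.+ A ℕ.+ q
    residueClass-length A r = begin
      length (residueClass A r) ℕ.* q         ≡⟨ cong (ℕ._* q) (trans (length-map _ (upTo (suc n)))
        (length-upTo (suc n))) ⟩
      q ℕ.+ n ℕ.* q                           ≤⟨ ℕₚ.+-monoʳ-≤ q (ℕ÷.m/n*n≤m (A ℕ.+ A) q) ⟩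
      q ℕ.+ (A ℕ.+ A)                         ≡⟨ ℕₚ.+-comm q _ ⟩
      A ℕ.+ A ℕ.+ q                           ∎
      where
      open ℕₚ.≤-Reasoning
      n = (A ℕ.+ A) ℕ÷./ q

    residueClass-length-≡ : ∀ A r → length (residueClass A r) ≡ suc ((A ℕ.+ A) ℕ÷./ q)
    residueClass-length-≡ A r = trans (length-map _ (upTo (suc n))) (length-upTo (suc n))
      where n = (A ℕ.+ A) ℕ÷./ q

    ∈-residueClass : ∀ {A x} r → ∣ x ∣ ℕ.≤ A → + q ∣ x - r → x ∈ residueClass A r
    ∈-residueClass {A} {x} r x≤A d with shift A x x≤A
    ... | Y , refl , Y≤ = subst (_∈ residueClass A r) (cong (λ z → + z - + A) (sym Y≡))
      (∈-map⁺ _ (∈-upTo⁺ (s≤s (ℕ÷./-monoˡ-≤ q Y≤))))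
      where
      ρ = (r + + A) ℤ÷.%ℕ q
      κ = (r + + A) ℤ÷./ℕ q
      ρ≡ : Y ℕ÷.% q ≡ ρ
      identity : ∀ y a r ρ κ c m q → y ≡ m + c * q → r + a ≡ ρ + κ * q → m - ρ ≡ 1ℤ * (y - a - r) + (κ - c) * q
      identity y a r ρ κ c m q e₁ e₂ = m-n≡0⇒m≡n (trans (rearrange y a r ρ κ c m q)
        (cong₂ (λ s t → s - t) (ℤₚ.i≡j⇒i-j≡0 e₂) (ℤₚ.i≡j⇒i-j≡0 e₁)))
        where
        rearrange : ∀ y a r ρ κ c m q → m - ρ - (1ℤ * (y - a - r) + (κ - c) * q) ≡
                    (r + a - (ρ + κ * q)) - (y - (m + c * q))
        rearrange = solve-∀
      ρ≡ = residue-unique (ℕ÷.m%n<n Y q) (ℤ÷.n%ℕd<d (r + + A) q)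
        (∣-combine₂ 1ℤ (κ - + (Y ℕ÷./ q))
          (identity (+ Y) (+ A) r (+ ρ) κ (+ (Y ℕ÷./ q)) (+ (Y ℕ÷.% q)) (+ q)
            (trans (cong +_ (ℕ÷.m≡m%n+[m/n]*n Y q)) (cong (λ z → + (Y ℕ÷.% q) + z) (ℤₚ.pos-* (Y ℕ÷./ q) q)))
            (ℤ÷.a≡a%ℕn+[a/ℕn]*n (r + + A) q))
          d ℤ∣.∣-refl)
      Y≡ : Y ≡ ρ ℕ.+ Y ℕ÷./ q ℕ.* q
      Y≡ = trans (ℕ÷.m≡m%n+[m/n]*n Y q) (cong (ℕ._+ Y ℕ÷./ q ℕ.* q) ρ≡)

  interval : ℕ → List ℤ
  interval A = residueClass 1 A 0ℤ

  ∈-interval : ∀ {A x} → ∣ x ∣ ℕ.≤ A → x ∈ interval A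
  ∈-interval x≤A = ∈-residueClass 1 0ℤ x≤A (∣ᵤ⇒∣ (ℕ∣.1∣ _))

  interval-length : ∀ A → 1 ℕ.≤ A → length (interval A) ℕ.≤ 3 ℕ.* A
  interval-length A 1≤A = begin
    length (interval A)         ≡⟨ ℕₚ.*-identityʳ _ ⟨
    length (interval A) ℕ.* 1   ≤⟨ residueClass-length 1 A 0ℤ ⟩
    A ℕ.+ A ℕ.+ 1               ≤⟨ ℕₚ.+-monoʳ-≤ (A ℕ.+ A) 1≤A ⟩
    A ℕ.+ A ℕ.+ A               ≡⟨ identity A ⟩
    3 ℕ.* A                     ∎
    where
    open ℕₚ.≤-Reasoning
    identity : ∀ a → a ℕ.+ a ℕ.+ a ≡ 3 ℕ.* a
    identity = solveℕ-∀

  -- The size test makes the bound on the length unconditional: the list is also formed for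
  -- candidate values n that no matrix attains, and there it may be empty.
  signedDivisors : ℕ → ℤ → List ℤ
  signedDivisors X n with ∣ n ∣ ℕₚ.≤? X
  ... | yes _ = map +_ (divisorList ∣ n ∣) ++ map (λ d → - + d) (divisorList ∣ n ∣)
  ... | no _ = []

  ∈-signedDivisors : ∀ {X d n} → ∣ n ∣ ℕ.≤ X → d ∣ n → n ≢ 0ℤ → d ∈ signedDivisors X n
  ∈-signedDivisors {X} {d} {n} n≤X d∣n n≢0 with ∣ n ∣ ℕₚ.≤? X
  ... | no n≰X = contradiction n≤X n≰X
  ... | yes _ = go d (∈-divisorList (∣⇒∣ᵤ d∣n) (ℕₚ.n≢0⇒n>0 λ eq → n≢0 (ℤₚ.∣i∣≡0⇒i≡0 eq)))
    where
    go : ∀ d → ∣ d ∣ ∈ divisorList ∣ n ∣ → d ∈ map +_ (divisorList ∣ n ∣) ++ map (λ d → - + d) (divisorList ∣ n ∣)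
    go (+ d) d∈ = ∈-++⁺ˡ (∈-map⁺ +_ d∈)
    go -[1+ d ] d∈ = ∈-++⁺ʳ (map +_ (divisorList ∣ n ∣)) (∈-map⁺ (λ d → - + d) d∈)

  signedDivisors-length : ∀ X n → length (signedDivisors X n) ℕ.≤ 2 ℕ.* maxDivisors X
  signedDivisors-length X n with ∣ n ∣ ℕₚ.≤? X
  ... | no _ = z≤n
  ... | yes n≤X = begin
    length (map +_ D ++ map (λ d → - + d) D)  ≡⟨ length-++ (map +_ D) ⟩
    length (map +_ D) ℕ.+ length (map (λ d → - + d) D)
                                              ≡⟨ cong₂ ℕ._+_ (length-map +_ D) (length-map (λ d → - + d) D) ⟩
    length D ℕ.+ length D                     ≤⟨ ℕₚ.+-mono-≤ (divisorList-≤-max X _ n≤X) (divisorList-≤-max X _ n≤X) ⟩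
    maxDivisors X ℕ.+ maxDivisors X           ≡⟨ cong (maxDivisors X ℕ.+_) (ℕₚ.+-identityʳ _) ⟨
    2 ℕ.* maxDivisors X                       ∎
    where
    open ℕₚ.≤-Reasoning
    D = divisorList ∣ n ∣

  module _ {q : ℕ} (pr : Prime q) where

    prime-∣-* : ∀ x y → + q ∣ x * y → (+ q ∣ x) ⊎ (+ q ∣ y)
    prime-∣-* x y d with euclidsLemma ∣ x ∣ ∣ y ∣ pr (subst (q ∣ℕ_) (ℤₚ.abs-* x y) (∣⇒∣ᵤ d))
    ... | inj₁ d′ = inj₁ (∣ᵤ⇒∣ d′)
    ... | inj₂ d′ = inj₂ (∣ᵤ⇒∣ d′)

    prime-cancel : ∀ x y → ¬ + q ∣ x → + q ∣ x * y → + q ∣ y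
    prime-cancel x y ∤ d with prime-∣-* x y d
    ... | inj₁ d′ = contradiction d′ ∤
    ... | inj₂ d′ = d′

    -- The factor q is removed twice: y = y′ q by primality, and after cancelling one q the same
    -- argument applies to y′.
    prime-square-cancel : ∀ x y → ¬ + q ∣ x → + q * + q ∣ x * y → + q * + q ∣ y
    prime-square-cancel x y ∤ d@(divides c eq)
      with prime-cancel x y ∤ (divides (c * + q) (trans eq (sym (ℤₚ.*-assoc c (+ q) (+ q)))))
    ... | divides y′ refl = ℤ∣.*-monoˡ-∣ (+ q) (prime-cancel x y′ ∤
      (ℤ∣.*-cancelʳ-∣ (+ q) {{ q≢0 }} (∣-resp-≡ (ℤₚ.*-assoc x y′ (+ q)) d)))
      where
      q≢0 : ℤ.NonZero (+ q)
      q≢0 = prime⇒nonZero pr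

    prime-inverse : ∀ x → ¬ + q ∣ x → ∃[ u ] (+ q ∣ x * u - 1ℤ)
    prime-inverse x ∤ with coprime-Bézout {∣ x ∣} {q} coprime
      where
      coprime : ∀ {d} → d ∣ℕ ∣ x ∣ × d ∣ℕ q → d ≡ 1
      coprime (d∣x , d∣q) with prime⇒irreducible pr d∣q
      ... | inj₁ d≡1 = d≡1
      ... | inj₂ refl = contradiction (∣ᵤ⇒∣ d∣x) ∤
    ... | bez = from-abs x (abs-inverse bez)
      where
      abs-inverse : ∀ {n} → Bézout.Identity.Identity 1 n q → ∃[ u ] (+ q ∣ + n * u - 1ℤ)
      abs-inverse {n} (Bézout.Identity.+- a b eq) = + a , divides (+ b)
        (trans (cong (_- 1ℤ) (trans (sym (ℤₚ.pos-* n a)) (cong +_ (trans (ℕₚ.*-comm n a) (sym eq)))))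
          (trans (cong (λ z → 1ℤ + z - 1ℤ) (ℤₚ.pos-* b q)) (identity (+ b * + q))))
        where
        identity : ∀ z → 1ℤ + z - 1ℤ ≡ z
        identity = solve-∀
      abs-inverse {n} (Bézout.Identity.-+ a b eq) = - + a , divides (- + b)
        (trans (identity (+ n) (+ a)) (trans (cong -_ (trans (cong (λ z → 1ℤ + z) (sym (ℤₚ.pos-* a n)))
          (trans (cong +_ eq) (ℤₚ.pos-* b q)))) (ℤₚ.neg-distribˡ-* (+ b) (+ q))))
        where
        identity : ∀ n a → n * - a - 1ℤ ≡ - (1ℤ + a * n)
        identity = solve-∀
      from-abs : ∀ x → ∃[ u ] (+ q ∣ + ∣ x ∣ * u - 1ℤ) → ∃[ u ] (+ q ∣ x * u - 1ℤ)
      from-abs (+ n) r = r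
      from-abs -[1+ n ] (u , d) = - u , ∣-resp-≡ (identity (+ suc n) u) d
        where
        identity : ∀ n u → - n * - u - 1ℤ ≡ n * u - 1ℤ
        identity = solve-∀

    prime-∤-1 : ¬ + q ∣ 1ℤ
    prime-∤-1 d = prime≢1 (ℕ∣.∣1⇒≡1 (∣⇒∣ᵤ d))
      where
      prime≢1 : q ≢ 1
      prime≢1 refl = ¬prime[1] pr

-- Adjugates of 3 × 3 matrices

module _ where
  open import Data.Integer.Base using (_+_; _*_; _-_; -_)

  pattern 0F = zero
  pattern 1F = suc zero
  pattern 2F = suc (suc zero)

  next : Fin 3 → Fin 3
  next 0F = 1F
  next 1F = 2F
  next 2F = 0F

  prev : Fin 3 → Fin 3
  prev i = next (next i)

  +-rotateˡ : ∀ a b c → b + c + a ≡ a + b + c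
  +-rotateˡ = solve-∀

  +-rotateʳ : ∀ a b c → c + a + b ≡ a + b + c
  +-rotateʳ = solve-∀

  -- Cyclic indices absorb the signs of the cofactors, and they make `adj` commute with `rot` by
  -- computation.
  adj : Mat3 → Mat3
  adj g i j = g (next j) (next i) * g (prev j) (prev i)
            - g (next j) (prev i) * g (prev j) (next i)

  rot transpose : Mat3 → Mat3
  rot g i j = g (next i) (next j)
  transpose g i j = g j i

  _∸scalar_ : Mat3 → ℤ → Mat3
  (g ∸scalar α) i j = g i j - α * idMat i j

  tr : Mat3 → ℤ
  tr g = g i0 i0 + g i1 i1 + g i2 i2

  private
    offDiagonal : ∀ {m} d → m ≡ 0ℤ → m ≡ d * 0ℤ
    offDiagonal d eq = trans eq (sym (ℤₚ.*-zeroʳ d))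

  ·-adj : ∀ g i j → (g ·ₘ adj g) i j ≡ det3 g * idMat i j
  ·-adj γ = λ { 0F 0F → lem00 (γ i0 i0) (γ i0 i1) (γ i0 i2) (γ i1 i0) (γ i1 i1) (γ i1 i2) (γ i2 i0) (γ i2 i1)
    (γ i2 i2)
              ; 0F 1F → offDiagonal (det3 γ) (repeat₂ (γ i0 i0) (γ i0 i1) (γ i0 i2) (γ i2 i0) (γ i2 i1) (γ i2 i2))
              ; 0F 2F → offDiagonal (det3 γ) (repeat₁ (γ i0 i0) (γ i0 i1) (γ i0 i2) (γ i1 i0) (γ i1 i1) (γ i1 i2))
              ; 1F 0F → offDiagonal (det3 γ) (repeat₁ (γ i1 i0) (γ i1 i1) (γ i1 i2) (γ i2 i0) (γ i2 i1) (γ i2 i2))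
              ; 1F 1F → lem11 (γ i0 i0) (γ i0 i1) (γ i0 i2) (γ i1 i0) (γ i1 i1) (γ i1 i2) (γ i2 i0) (γ i2 i1)
                (γ i2 i2)
              ; 1F 2F → offDiagonal (det3 γ) (repeat₂ (γ i1 i0) (γ i1 i1) (γ i1 i2) (γ i0 i0) (γ i0 i1) (γ i0 i2))
              ; 2F 0F → offDiagonal (det3 γ) (repeat₂ (γ i2 i0) (γ i2 i1) (γ i2 i2) (γ i1 i0) (γ i1 i1) (γ i1 i2))
              ; 2F 1F → offDiagonal (det3 γ) (repeat₁ (γ i2 i0) (γ i2 i1) (γ i2 i2) (γ i0 i0) (γ i0 i1) (γ i0 i2))
              ; 2F 2F → lem22 (γ i0 i0) (γ i0 i1) (γ i0 i2) (γ i1 i0) (γ i1 i1) (γ i1 i2) (γ i2 i0) (γ i2 i1)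
                (γ i2 i2) }
    where
    lem00 : ∀ a b c d e f g h i → a * (e * i - f * h) + b * (f * g - d * i) + c * (d * h - e * g) ≡
            (a * (e * i - f * h) - b * (d * i - f * g) + c * (d * h - e * g)) * 1ℤ
    lem00 = solve-∀
    lem11 : ∀ a b c d e f g h i → d * (h * c - i * b) + e * (i * a - g * c) + f * (g * b - h * a) ≡
            (a * (e * i - f * h) - b * (d * i - f * g) + c * (d * h - e * g)) * 1ℤ
    lem11 = solve-∀
    lem22 : ∀ a b c d e f g h i → g * (b * f - c * e) + h * (c * d - a * f) + i * (a * e - b * d) ≡
            (a * (e * i - f * h) - b * (d * i - f * g) + c * (d * h - e * g)) * 1ℤ
    lem22 = solve-∀
    repeat₁ : ∀ a b c d e f → a * (b * f - c * e) + b * (c * d - a * f) + c * (a * e - b * d) ≡ 0ℤ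
    repeat₁ = solve-∀
    repeat₂ : ∀ a b c d e f → a * (e * c - f * b) + b * (f * a - d * c) + c * (d * b - e * a) ≡ 0ℤ
    repeat₂ = solve-∀

  transpose-adj : ∀ g i j → adj (transpose g) i j ≡ adj g j i
  transpose-adj γ i j = identity (γ (next i) (next j)) (γ (prev i) (prev j))
                                 (γ (prev i) (next j)) (γ (next i) (prev j))
    where
    identity : ∀ a b c d → a * b - c * d ≡ a * b - d * c
    identity = solve-∀

  det-transpose : ∀ g → det3 (transpose g) ≡ det3 g
  det-transpose γ = identity (γ i0 i0) (γ i0 i1) (γ i0 i2) (γ i1 i0) (γ i1 i1) (γ i1 i2) (γ i2 i0) (γ i2 i1) (γ i2 i2)
    where
    identity : ∀ a b c d e f g h i → a * (e * i - h * f) - d * (b * i - h * c) + g * (b * f - e * c) ≡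
               a * (e * i - f * h) - b * (d * i - f * g) + c * (d * h - e * g)
    identity = solve-∀

  det-rot : ∀ g → det3 (rot g) ≡ det3 g
  det-rot γ = identity (γ i0 i0) (γ i0 i1) (γ i0 i2) (γ i1 i0) (γ i1 i1) (γ i1 i2) (γ i2 i0) (γ i2 i1) (γ i2 i2)
    where
    identity : ∀ a b c d e f g h i → e * (i * a - g * c) - f * (h * a - g * b) + d * (h * c - i * b) ≡
               a * (e * i - f * h) - b * (d * i - f * g) + c * (d * h - e * g)
    identity = solve-∀

  sum3-cong : ∀ {f g : Fin 3 → ℤ} → (∀ k → f k ≡ g k) → sum3 f ≡ sum3 g
  sum3-cong eq = cong₂ _+_ (cong₂ _+_ (eq i0) (eq i1)) (eq i2)

  idMat-sym : ∀ i j → idMat i j ≡ idMat j i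
  idMat-sym 0F 0F = refl
  idMat-sym 0F 1F = refl
  idMat-sym 0F 2F = refl
  idMat-sym 1F 0F = refl
  idMat-sym 1F 1F = refl
  idMat-sym 1F 2F = refl
  idMat-sym 2F 0F = refl
  idMat-sym 2F 1F = refl
  idMat-sym 2F 2F = refl

  adj-· : ∀ g i j → (adj g ·ₘ g) i j ≡ det3 g * idMat i j
  adj-· γ i j = trans (sum3-cong λ k → trans (ℤₚ.*-comm (adj γ i k) (γ k j))
    (cong (γ k j *_) (sym (transpose-adj γ k i))))
    (trans (·-adj (transpose γ) j i) (cong₂ _*_ (det-transpose γ) (idMat-sym j i)))

  -- Only row 0 is a ring identity. The other rows are row 0 of a rotated matrix.
  adj-adj : ∀ g i j → adj (adj g) i j ≡ det3 g * g i j
  adj-adj γ = λ { 0F j → row γ j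
                ; 1F j → subst (λ j → adj (adj γ) 1F j ≡ det3 γ * γ 1F j) (next³ j)
                    (trans (row (rot γ) (prev j)) (cong (_* γ 1F (next (prev j))) (det-rot γ)))
                ; 2F j → subst (λ j → adj (adj γ) 2F j ≡ det3 γ * γ 2F j) (next³ j)
                    (trans (row (rot (rot γ)) (next j)) (cong (_* γ 2F (next (prev j)))
                      (trans (det-rot (rot γ)) (det-rot γ)))) }
    where
    next³ : ∀ j → next (prev j) ≡ j
    next³ 0F = refl
    next³ 1F = refl
    next³ 2F = refl
    identity₀ : ∀ a b c d e f g h i →
      (i * a - g * c) * (a * e - b * d) - (c * d - a * f) * (g * b - h * a) ≡
      (a * (e * i - f * h) - b * (d * i - f * g) + c * (d * h - e * g)) * a
    identity₀ = solve-∀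
    identity₁ : ∀ a b c d e f g h i →
      (g * b - h * a) * (b * f - c * e) - (a * e - b * d) * (h * c - i * b) ≡
      (a * (e * i - f * h) - b * (d * i - f * g) + c * (d * h - e * g)) * b
    identity₁ = solve-∀
    identity₂ : ∀ a b c d e f g h i →
      (h * c - i * b) * (c * d - a * f) - (b * f - c * e) * (i * a - g * c) ≡
      (a * (e * i - f * h) - b * (d * i - f * g) + c * (d * h - e * g)) * c
    identity₂ = solve-∀
    row : ∀ γ j → adj (adj γ) 0F j ≡ det3 γ * γ 0F j
    row γ 0F = identity₀ (γ i0 i0) (γ i0 i1) (γ i0 i2) (γ i1 i0) (γ i1 i1) (γ i1 i2) (γ i2 i0) (γ i2 i1) (γ i2 i2)
    row γ 1F = identity₁ (γ i0 i0) (γ i0 i1) (γ i0 i2) (γ i1 i0) (γ i1 i1) (γ i1 i2) (γ i2 i0) (γ i2 i1) (γ i2 i2)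
    row γ 2F = identity₂ (γ i0 i0) (γ i0 i1) (γ i0 i2) (γ i1 i0) (γ i1 i1) (γ i1 i2) (γ i2 i0) (γ i2 i1) (γ i2 i2)

  -- Comparing one entry of `adj g` times its own adjugate avoids the expansion of a polynomial of
  -- degree six.
  det-adj : ∀ g → det3 (adj g) ≡ det3 g * det3 g
  det-adj γ = begin
    det3 (adj γ)                                       ≡⟨ ℤₚ.*-identityʳ _ ⟨
    det3 (adj γ) * 1ℤ                                  ≡⟨ ·-adj (adj γ) i0 i0 ⟨
    (adj γ ·ₘ adj (adj γ)) i0 i0                       ≡⟨ sum3-cong (λ k → cong (adj γ i0 k *_) (adj-adj γ k i0)) ⟩
    sum3 (λ k → adj γ i0 k * (det3 γ * γ k i0))        ≡⟨ identity (det3 γ) (adj γ i0 i0) (adj γ i0 i1) (adj γ i0 i2)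
      (γ i0 i0) (γ i1 i0) (γ i2 i0) ⟩
    det3 γ * (adj γ ·ₘ γ) i0 i0                        ≡⟨ cong (det3 γ *_) (adj-· γ i0 i0) ⟩
    det3 γ * (det3 γ * 1ℤ)                             ≡⟨ cong (det3 γ *_) (ℤₚ.*-identityʳ _) ⟩
    det3 γ * det3 γ                                    ∎
    where
    open ≡-Reasoning
    identity : ∀ m a b c d e f → a * (m * d) + b * (m * e) + c * (m * f) ≡ m * (a * d + b * e + c * f)
    identity = solve-∀

  char-poly : ∀ g α → det3 (g ∸scalar α) ≡ det3 g - (α * α * α - tr g * (α * α) + tr (adj g) * α)
  char-poly γ α = identity (γ i0 i0) (γ i0 i1) (γ i0 i2) (γ i1 i0) (γ i1 i1) (γ i1 i2) (γ i2 i0) (γ i2 i1) (γ i2 i2) α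
    where
    identity : ∀ a b c d e f g h i x →
      (a - x * 1ℤ) * ((e - x * 1ℤ) * (i - x * 1ℤ) - (f - x * 0ℤ) * (h - x * 0ℤ))
      - (b - x * 0ℤ) * ((d - x * 0ℤ) * (i - x * 1ℤ) - (f - x * 0ℤ) * (g - x * 0ℤ))
      + (c - x * 0ℤ) * ((d - x * 0ℤ) * (h - x * 0ℤ) - (e - x * 1ℤ) * (g - x * 0ℤ)) ≡
      a * (e * i - f * h) - b * (d * i - f * g) + c * (d * h - e * g)
      - (x * x * x - (a + e + i) * (x * x) + ((e * i - f * h) + (i * a - g * c) + (a * e - b * d)) * x)
    identity = solve-∀

  ·ₘ-assoc : ∀ a b c i j → ((a ·ₘ b) ·ₘ c) i j ≡ (a ·ₘ (b ·ₘ c)) i j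
  ·ₘ-assoc a b c i j = identity (a i i0) (a i i1) (a i i2)
    (b i0 i0) (b i0 i1) (b i0 i2) (b i1 i0) (b i1 i1) (b i1 i2) (b i2 i0) (b i2 i1) (b i2 i2)
    (c i0 j) (c i1 j) (c i2 j)
    where
    identity : ∀ x y z a b c d e f g h i u v w →
      (x * a + y * d + z * g) * u + (x * b + y * e + z * h) * v + (x * c + y * f + z * i) * w ≡
      x * (a * u + b * v + c * w) + y * (d * u + e * v + f * w) + z * (g * u + h * v + i * w)
    identity = solve-∀

  sum3-idʳ : ∀ (f : Fin 3 → ℤ) j → sum3 (λ k → f k * idMat k j) ≡ f j
  sum3-idʳ f = λ { 0F → identity₀ (f i0) (f i1) (f i2) ; 1F → identity₁ (f i0) (f i1) (f i2) ; 2F → identity₂ (f i0)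
    (f i1) (f i2) }
    where
    identity₀ : ∀ a b c → a * 1ℤ + b * 0ℤ + c * 0ℤ ≡ a
    identity₀ = solve-∀
    identity₁ : ∀ a b c → a * 0ℤ + b * 1ℤ + c * 0ℤ ≡ b
    identity₁ = solve-∀
    identity₂ : ∀ a b c → a * 0ℤ + b * 0ℤ + c * 1ℤ ≡ c
    identity₂ = solve-∀

  sum3-idˡ : ∀ (f : Fin 3 → ℤ) j → sum3 (λ k → idMat j k * f k) ≡ f j
  sum3-idˡ f j = trans (sum3-cong λ k → trans (ℤₚ.*-comm (idMat j k) (f k)) (cong (f k *_) (idMat-sym j k)))
    (sum3-idʳ f j)

  -- Identifies the inverse supplied by `NormCond` with `adj g`, which stands for the inverse from
  -- here on.
  right-inverse≡adj : ∀ g h → InSL3 g → MatEq (g ·ₘ h) idMat → MatEq h (adj g)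
  right-inverse≡adj g h det≡1 gh≡1 i j = begin
    h i j                               ≡⟨ sum3-idˡ (λ k → h k j) i ⟨
    (idMat ·ₘ h) i j                    ≡⟨ sum3-cong (λ k → cong (_* h k j) (sym (inverse i k))) ⟩
    ((adj g ·ₘ g) ·ₘ h) i j             ≡⟨ ·ₘ-assoc (adj g) g h i j ⟩
    (adj g ·ₘ (g ·ₘ h)) i j             ≡⟨ sum3-cong (λ k → cong (adj g i k *_) (gh≡1 k j)) ⟩
    (adj g ·ₘ idMat) i j                ≡⟨ sum3-idʳ (adj g i) j ⟩
    adj g i j                           ∎
    where
    open ≡-Reasoning
    inverse : ∀ i k → (adj g ·ₘ g) i k ≡ idMat i k
    inverse i k = trans (adj-· g i k) (trans (cong (_* idMat i k) det≡1) (ℤₚ.*-identityˡ _))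

  max3-upper : ∀ f i → f i ℕ.≤ max3 f
  max3-upper f 0F = ℕₚ.≤-trans (ℕₚ.m≤m⊔n (f i0) (f i1)) (ℕₚ.m≤m⊔n _ (f i2))
  max3-upper f 1F = ℕₚ.≤-trans (ℕₚ.m≤n⊔m (f i0) (f i1)) (ℕₚ.m≤m⊔n _ (f i2))
  max3-upper f 2F = ℕₚ.m≤n⊔m _ (f i2)

  max3-least : ∀ f {A} → (∀ i → f i ℕ.≤ A) → max3 f ℕ.≤ A
  max3-least f le = ℕₚ.⊔-lub (ℕₚ.⊔-lub (le i0) (le i1)) (le i2)

  entry≤norm : ∀ g i j → ∣ g i j ∣ ℕ.≤ normInf g
  entry≤norm g i j = ℕₚ.≤-trans (max3-upper (λ k → ∣ g i k ∣) j) (max3-upper (λ k → maxAbs3 (g k)) i)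

  norm-least : ∀ g {A} → (∀ i j → ∣ g i j ∣ ℕ.≤ A) → normInf g ℕ.≤ A
  norm-least g le = max3-least (λ k → maxAbs3 (g k)) λ i → max3-least (λ k → ∣ g i k ∣) (le i)

  norm-cong : ∀ {g h} → MatEq g h → normInf g ≡ normInf h
  norm-cong {g} {h} eq = ℕₚ.≤-antisym (norm-least g λ i j → subst (λ z → ∣ z ∣ ℕ.≤ normInf h) (sym (eq i j))
    (entry≤norm h i j))
                              (norm-least h λ i j → subst (λ z → ∣ z ∣ ℕ.≤ normInf g) (eq i j) (entry≤norm g i j))

  abs-*-≤ : ∀ {x y A B} → ∣ x ∣ ℕ.≤ A → ∣ y ∣ ℕ.≤ B → ∣ x * y ∣ ℕ.≤ A ℕ.* B
  abs-*-≤ {x} {y} x≤ y≤ = subst (ℕ._≤ _) (sym (ℤₚ.abs-* x y)) (ℕₚ.*-mono-≤ x≤ y≤)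

  abs-+-≤ : ∀ {x y A B} → ∣ x ∣ ℕ.≤ A → ∣ y ∣ ℕ.≤ B → ∣ x + y ∣ ℕ.≤ A ℕ.+ B
  abs-+-≤ {x} {y} x≤ y≤ = ℕₚ.≤-trans (ℤₚ.∣i+j∣≤∣i∣+∣j∣ x y) (ℕₚ.+-mono-≤ x≤ y≤)

  abs---≤ : ∀ {x y A B} → ∣ x ∣ ℕ.≤ A → ∣ y ∣ ℕ.≤ B → ∣ x - y ∣ ℕ.≤ A ℕ.+ B
  abs---≤ {x} {y} x≤ y≤ = ℕₚ.≤-trans (ℤₚ.∣i-j∣≤∣i∣+∣j∣ x y) (ℕₚ.+-mono-≤ x≤ y≤)

  adj-≤ : ∀ g {A} → (∀ i j → ∣ g i j ∣ ℕ.≤ A) → ∀ i j → ∣ adj g i j ∣ ℕ.≤ A ℕ.* A ℕ.+ A ℕ.* A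
  adj-≤ g le i j = abs---≤ {g (next j) (next i) * g (prev j) (prev i)}
    (abs-*-≤ {g (next j) (next i)} (le _ _) (le _ _)) (abs-*-≤ {g (next j) (prev i)} (le _ _) (le _ _))

-- Matrices of bounded size

module _ where
  open import Data.Integer.Base using (_+_; _*_; _-_; -_)

  indices : List (Fin 3)
  indices = i0 ∷ i1 ∷ i2 ∷ []

  ∈-indices : ∀ k → k ∈ indices
  ∈-indices 0F = here refl
  ∈-indices 1F = there (here refl)
  ∈-indices 2F = there (there (here refl))

  dot : Vec3 → Vec3 → ℤ
  dot x y = sum3 λ k → x k * y k

  nonzero⇒1≤∣∣ : ∀ {x} → x ≢ 0ℤ → 1 ℕ.≤ ∣ x ∣
  nonzero⇒1≤∣∣ x≢0 = ℕₚ.n≢0⇒n>0 λ eq → x≢0 (ℤₚ.∣i∣≡0⇒i≡0 eq)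

  abs-factorˡ : ∀ {x y T} → y ≢ 0ℤ → ∣ x * y ∣ ℕ.≤ T → ∣ x ∣ ℕ.≤ T
  abs-factorˡ {x} {y} y≢0 le = ℕₚ.≤-trans (ℕₚ.m≤m*n ∣ x ∣ ∣ y ∣ {{>-nonZero (nonzero⇒1≤∣∣ y≢0)}})
    (subst (ℕ._≤ _) (ℤₚ.abs-* x y) le)

  abs-factorʳ : ∀ {x y T} → x ≢ 0ℤ → ∣ x * y ∣ ℕ.≤ T → ∣ y ∣ ℕ.≤ T
  abs-factorʳ {x} {y} x≢0 le = abs-factorˡ {y} {x} x≢0 (subst (λ z → ∣ z ∣ ℕ.≤ _) (ℤₚ.*-comm x y) le)

  NonzeroVec : Vec3 → Set
  NonzeroVec x = ∃[ a ] x a ≢ 0ℤ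

  ZeroOrDivides : ℤ → ℤ → Set
  ZeroOrDivides n x = x ≡ 0ℤ ⊎ x ∣ n

  -- The case of an orthogonal pair in which the product at k vanishes. A single nonzero n of size
  -- at most T controls the four coordinates away from k up to divisors, and at k one coordinate is
  -- zero and the other at most T. So this case also costs T² up to divisors.
  record Degenerate (T : ℕ) (k : Fin 3) (x y : Vec3) (n : ℤ) : Set where
    field
      nonzero : n ≢ 0ℤ
      small : ∣ n ∣ ℕ.≤ T
      x-next : ZeroOrDivides n (x (next k))
      y-next : ZeroOrDivides n (y (next k))
      x-next² : ZeroOrDivides n (x (prev k))
      y-next² : ZeroOrDivides n (y (prev k))
      rest : (x k ≡ 0ℤ × ∣ y k ∣ ℕ.≤ T) ⊎ (y k ≡ 0ℤ × ∣ x k ∣ ℕ.≤ T)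

  degenerate-swap : ∀ {T k x y n} → Degenerate T k y x n → Degenerate T k x y n
  degenerate-swap d = record
    { nonzero = nonzero ; small = small ; x-next = y-next ; y-next = x-next ; x-next² = y-next² ; y-next² = x-next²
      ; rest = swap rest }
    where open Degenerate d

  -- The case in which all three products vanish: n pairs a nonzero coordinate of x with a nonzero
  -- coordinate of y at another place.
  crossed : ∀ {T x y} → (∀ a b → ∣ x a * y b ∣ ℕ.≤ T) → ∀ k → x k * y k ≡ 0ℤ → x (next k) ≢ 0ℤ → y (next k) ≡ 0ℤ → x
    (prev k) ≡ 0ℤ → y (prev k) ≢ 0ℤ →
            Degenerate T k x y (x (next k) * y (prev k))
  crossed {T} {x} {y} small k mk≡0 x≢0 y≡0 x≡0 y≢0 = record
    { nonzero = λ eq → case (ℤₚ.i*j≡0⇒i≡0∨j≡0 (x (next k)) eq)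
    ; small = small _ _
    ; x-next = inj₂ (ℤ∣.∣m⇒∣m*n (y (prev k)) ℤ∣.∣-refl) ; y-next = inj₁ y≡0
    ; x-next² = inj₁ x≡0 ; y-next² = inj₂ (ℤ∣.∣n⇒∣m*n (x (next k)) ℤ∣.∣-refl)
    ; rest = rest (ℤₚ.i*j≡0⇒i≡0∨j≡0 (x k) mk≡0) }
    where
    case : ¬ (x (next k) ≡ 0ℤ ⊎ y (prev k) ≡ 0ℤ)
    case (inj₁ eq) = x≢0 eq
    case (inj₂ eq) = y≢0 eq
    rest : x k ≡ 0ℤ ⊎ y k ≡ 0ℤ → (x k ≡ 0ℤ × ∣ y k ∣ ℕ.≤ T) ⊎ (y k ≡ 0ℤ × ∣ x k ∣ ℕ.≤ T)
    rest (inj₁ eq) = inj₁ (eq , abs-factorʳ {x (next k)} x≢0 (small (next k) k))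
    rest (inj₂ eq) = inj₂ (eq , abs-factorˡ {x k} {y (prev k)} y≢0 (small k (prev k)))

  module _ {T : ℕ} {x y : Vec3} (orth : dot x y ≡ 0ℤ) (small : ∀ a b → ∣ x a * y b ∣ ℕ.≤ T) where

    private
      rotated-dot : ∀ k → x k * y k + x (next k) * y (next k) + x (prev k) * y (prev k) ≡ 0ℤ
      rotated-dot 0F = orth
      rotated-dot 1F = trans (+-rotateˡ (x i0 * y i0) (x i1 * y i1) (x i2 * y i2)) orth
      rotated-dot 2F = trans (+-rotateʳ (x i0 * y i0) (x i1 * y i1) (x i2 * y i2)) orth

      -- By orthogonality the two remaining products are opposite, so one of them serves as n for
      -- all four coordinates.
      mixed : ∀ k → x k * y k ≡ 0ℤ → x (next k) * y (next k) ≢ 0ℤ → Degenerate T k x y (x (next k) * y (next k))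
      mixed k mk≡0 m≢0 = record
        { nonzero = m≢0 ; small = small _ _
        ; x-next = inj₂ (ℤ∣.∣m⇒∣m*n (y (next k)) ℤ∣.∣-refl)
        ; y-next = inj₂ (ℤ∣.∣n⇒∣m*n (x (next k)) ℤ∣.∣-refl)
        ; x-next² = inj₂ (divides (- y (prev k)) (trans third (identity (x (prev k)) (y (prev k)))))
        ; y-next² = inj₂ (divides (- x (prev k)) (trans third (ℤₚ.neg-distribˡ-* (x (prev k)) (y (prev k)))))
        ; rest = rest (ℤₚ.i*j≡0⇒i≡0∨j≡0 (x k) mk≡0) }
        where
        identity : ∀ a b → - (a * b) ≡ - b * a
        identity = solve-∀
        third : x (next k) * y (next k) ≡ - (x (prev k) * y (prev k))
        third = trans (sym (ℤₚ.+-identityˡ _)) (trans (cong (_+ x (next k) * y (next k)) (sym mk≡0))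
          (trans (rearrange (x k * y k) (x (next k) * y (next k)) (x (prev k) * y (prev k)))
            (cong (_- x (prev k) * y (prev k)) (rotated-dot k) ⟨ trans ⟩ ℤₚ.+-identityˡ _)))
          where
          rearrange : ∀ a b c → a + b ≡ a + b + c - c
          rearrange = solve-∀
        x≢0 : x (next k) ≢ 0ℤ
        x≢0 eq = m≢0 (cong (_* y (next k)) eq)
        y≢0 : y (next k) ≢ 0ℤ
        y≢0 eq = m≢0 (trans (cong (x (next k) *_) eq) (ℤₚ.*-zeroʳ (x (next k))))
        rest : x k ≡ 0ℤ ⊎ y k ≡ 0ℤ → (x k ≡ 0ℤ × ∣ y k ∣ ℕ.≤ T) ⊎ (y k ≡ 0ℤ × ∣ x k ∣ ℕ.≤ T)
        rest (inj₁ eq) = inj₁ (eq , abs-factorʳ {x (next k)} x≢0 (small (next k) k))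
        rest (inj₂ eq) = inj₂ (eq , abs-factorˡ {x k} {y (next k)} y≢0 (small k (next k)))

      crossed′ : ∀ k → x k * y k ≡ 0ℤ → x (next k) ≡ 0ℤ → y (next k) ≢ 0ℤ → x (prev k) ≢ 0ℤ → y (prev k) ≡ 0ℤ →
                 Degenerate T k x y (y (next k) * x (prev k))
      crossed′ k mk≡0 x≡0 y≢0 x≢0 y≡0 = degenerate-swap (crossed
        (λ a b → subst (λ z → ∣ z ∣ ℕ.≤ T) (ℤₚ.*-comm (x b) (y a)) (small b a)) k
          (trans (ℤₚ.*-comm (y k) (x k)) mk≡0) y≢0 x≡0 y≡0 x≢0)

      zero-factor : ∀ {a b} → a * b ≡ 0ℤ → a ≢ 0ℤ → b ≡ 0ℤ
      zero-factor {a} eq a≢0 with ℤₚ.i*j≡0⇒i≡0∨j≡0 a eq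
      ... | inj₁ a≡0 = contradiction a≡0 a≢0
      ... | inj₂ b≡0 = b≡0

      zero-factor′ : ∀ {a b} → a * b ≡ 0ℤ → b ≢ 0ℤ → a ≡ 0ℤ
      zero-factor′ {a} {b} eq b≢0 with ℤₚ.i*j≡0⇒i≡0∨j≡0 a eq
      ... | inj₁ a≡0 = a≡0
      ... | inj₂ b≡0 = contradiction b≡0 b≢0

      all-zero : (∀ a → x a * y a ≡ 0ℤ) → NonzeroVec x → NonzeroVec y → ∃[ k ] ∃[ n ] Degenerate T k x y n
      all-zero z (0F , xa) (0F , yb) = contradiction (zero-factor (z 0F) xa) yb
      all-zero z (1F , xa) (1F , yb) = contradiction (zero-factor (z 1F) xa) yb
      all-zero z (2F , xa) (2F , yb) = contradiction (zero-factor (z 2F) xa) yb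
      all-zero z (0F , xa) (1F , yb) = 2F , _ , crossed small 2F (z _) xa (zero-factor (z 0F) xa)
        (zero-factor′ (z 1F) yb) yb
      all-zero z (1F , xa) (2F , yb) = 0F , _ , crossed small 0F (z _) xa (zero-factor (z 1F) xa)
        (zero-factor′ (z 2F) yb) yb
      all-zero z (2F , xa) (0F , yb) = 1F , _ , crossed small 1F (z _) xa (zero-factor (z 2F) xa)
        (zero-factor′ (z 0F) yb) yb
      all-zero z (0F , xa) (2F , yb) = 1F , _ , crossed′ 1F (z _) (zero-factor′ (z 2F) yb) yb xa
        (zero-factor (z 0F) xa)
      all-zero z (1F , xa) (0F , yb) = 2F , _ , crossed′ 2F (z _) (zero-factor′ (z 0F) yb) yb xa
        (zero-factor (z 1F) xa)
      all-zero z (2F , xa) (1F , yb) = 0F , _ , crossed′ 0F (z _) (zero-factor′ (z 1F) yb) yb xa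
        (zero-factor (z 2F) xa)

      third-zero : ∀ k → x k * y k ≡ 0ℤ → x (next k) * y (next k) ≡ 0ℤ → x (prev k) * y (prev k) ≡ 0ℤ
      third-zero k e₁ e₂ = trans (sym (ℤₚ.+-identityˡ _))
        (trans (cong₂ (λ a b → a + b + x (prev k) * y (prev k)) (sym e₁) (sym e₂)) (rotated-dot k))

      at : ∀ k → x k * y k ≡ 0ℤ → NonzeroVec x → NonzeroVec y → ∃[ k ] ∃[ n ] Degenerate T k x y n
      at k mk≡0 nx ny with x (next k) * y (next k) ℤₚ.≟ 0ℤ
      ... | no m≢0 = k , _ , mixed k mk≡0 m≢0
      ... | yes m≡0 = all-zero (everywhere k mk≡0 m≡0 (third-zero k mk≡0 m≡0)) nx ny
        where
        everywhere : ∀ k → x k * y k ≡ 0ℤ → x (next k) * y (next k) ≡ 0ℤ → x (prev k) * y (prev k) ≡ 0ℤ →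
                     ∀ a → x a * y a ≡ 0ℤ
        everywhere 0F a b c = λ { 0F → a ; 1F → b ; 2F → c }
        everywhere 1F a b c = λ { 1F → a ; 2F → b ; 0F → c }
        everywhere 2F a b c = λ { 2F → a ; 0F → b ; 1F → c }

    orthogonal-cases : NonzeroVec x → NonzeroVec y →
                       (∀ a → x a * y a ≢ 0ℤ) ⊎ (∃[ k ] ∃[ n ] Degenerate T k x y n)
    orthogonal-cases nx ny with x i0 * y i0 ℤₚ.≟ 0ℤ | x i1 * y i1 ℤₚ.≟ 0ℤ | x i2 * y i2 ℤₚ.≟ 0ℤ
    ... | yes e | _ | _ = inj₂ (at i0 e nx ny)
    ... | no _ | yes e | _ = inj₂ (at i1 e nx ny)
    ... | no _ | no _ | yes e = inj₂ (at i2 e nx ny)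
    ... | no a | no b | no c = inj₁ λ { 0F → a ; 1F → b ; 2F → c }

-- Counting orthogonal pairs of vectors

module _ where
  open import Data.Integer.Base using (_+_; _*_; _-_; -_)

  zeroOrDivisor : ℕ → ℤ → List ℤ
  zeroOrDivisor X n = 0ℤ ∷ signedDivisors X n

  ∈-zeroOrDivisor : ∀ {X n x} → ∣ n ∣ ℕ.≤ X → n ≢ 0ℤ → ZeroOrDivides n x → x ∈ zeroOrDivisor X n
  ∈-zeroOrDivisor _ _ (inj₁ refl) = here refl
  ∈-zeroOrDivisor le n≢0 (inj₂ d) = there (∈-signedDivisors le d n≢0)

  zeroOrDivisor-length : ∀ X n → length (zeroOrDivisor X n) ℕ.≤ 3 ℕ.* maxDivisors X
  zeroOrDivisor-length X n = ℕₚ.+-mono-≤ (maxDivisors≥1 X) (signedDivisors-length X n)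

  vec : ℤ → ℤ → ℤ → Vec3
  vec a b c 0F = a
  vec a b c 1F = b
  vec a b c 2F = c

  module _ {Ω : Set} {R : Ω → Ω → Set} {P : Ω → Set} (x y : Ω → Vec3) {T X M : ℕ} (1≤T : 1 ℕ.≤ T)
      (T+T≤X : T ℕ.+ T ℕ.≤ X)
    (orth : ∀ ω → P ω → dot (x ω) (y ω) ≡ 0ℤ) (small : ∀ ω → P ω → ∀ a b → ∣ x ω a * y ω b ∣ ℕ.≤ T)
    (x≢0 : ∀ ω → P ω → NonzeroVec (x ω)) (y≢0 : ∀ ω → P ω → NonzeroVec (y ω))
    (fiber : ∀ (x₀ y₀ : Vec3) → Bounded R (λ ω → P ω × (∀ a → x ω a ≡ x₀ a) × (∀ a → y ω a ≡ y₀ a)) M) where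

    private
      Δ = maxDivisors X

      T≤X : T ℕ.≤ X
      T≤X = ℕₚ.≤-trans (ℕₚ.m≤m+n T T) T+T≤X

      leaf : ∀ a b c a′ b′ c′ → Bounded R (λ ω → P ω × (x ω i0 ≡ a × x ω i1 ≡ b × x ω i2 ≡ c) ×
                                                     (y ω i0 ≡ a′ × y ω i1 ≡ b′ × y ω i2 ≡ c′)) M
      leaf a b c a′ b′ c′ = bounded-⊆ (λ { ω (p , (e₀ , e₁ , e₂) , (f₀ , f₁ , f₂)) →
        p , (λ { 0F → e₀ ; 1F → e₁ ; 2F → e₂ }) , (λ { 0F → f₀ ; 1F → f₁ ; 2F → f₂ }) })
          (fiber (vec a b c) (vec a′ b′ c′))

      regular : Bounded R (λ ω → P ω × (∀ a → x ω a * y ω a ≢ 0ℤ))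
        (3 ℕ.* T ℕ.* (3 ℕ.* T ℕ.*
          (2 ℕ.* Δ ℕ.* (2 ℕ.* Δ ℕ.* (2 ℕ.* Δ ℕ.* (2 ℕ.* Δ ℕ.* (2 ℕ.* Δ ℕ.* (2 ℕ.* Δ ℕ.* M))))))))
      regular =
        bounded-fix-≤ (λ ω → x ω i0 * y ω i0) (interval T) (interval-length T 1≤T)
          (λ ω (p , _) → ∈-interval (small ω p i0 i0)) λ m₀ →
        bounded-fix-≤ (λ ω → x ω i1 * y ω i1) (interval T) (interval-length T 1≤T) (λ ω ((p , _) , _) → ∈-interval
          (small ω p i1 i1)) λ m₁ →
        bounded-fix-≤ (λ ω → x ω i0) (signedDivisors X m₀) (signedDivisors-length X m₀)
          (λ { ω (((p , n) , refl) , _) → ∈-signedDivisors (bound ω p i0) (ℤ∣.∣m⇒∣m*n (y ω i0) ℤ∣.∣-refl) (n i0) })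
            λ x₀ →
        bounded-fix-≤ (λ ω → y ω i0) (signedDivisors X m₀) (signedDivisors-length X m₀)
          (λ { ω ((((p , n) , refl) , _) , _) → ∈-signedDivisors (bound ω p i0) (ℤ∣.∣n⇒∣m*n (x ω i0) ℤ∣.∣-refl)
            (n i0) }) λ y₀ →
        bounded-fix-≤ (λ ω → x ω i1) (signedDivisors X m₁) (signedDivisors-length X m₁)
          (λ { ω (((((p , n) , _) , refl) , _) , _) → ∈-signedDivisors (bound ω p i1) (ℤ∣.∣m⇒∣m*n (y ω i1) ℤ∣.∣-refl)
            (n i1) }) λ x₁ →
        bounded-fix-≤ (λ ω → y ω i1) (signedDivisors X m₁) (signedDivisors-length X m₁)
          (λ { ω ((((((p , n) , _) , refl) , _) , _) , _) → ∈-signedDivisors (bound ω p i1)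
            (ℤ∣.∣n⇒∣m*n (x ω i1) ℤ∣.∣-refl) (n i1) }) λ y₁ →
        -- Orthogonality determines the third product from the first two, so its factors cost only
        -- divisors.
        bounded-fix-≤ (λ ω → x ω i2) (signedDivisors X (- (m₀ + m₁))) (signedDivisors-length X (- (m₀ + m₁)))
          (λ { ω (((((((p , n) , refl) , refl) , _) , _) , _) , _) →
            subst (λ m → x ω i2 ∈ signedDivisors X m) (third ω p) (∈-signedDivisors (bound ω p i2)
              (ℤ∣.∣m⇒∣m*n (y ω i2) ℤ∣.∣-refl) (n i2)) }) λ x₂ →
        bounded-fix-≤ (λ ω → y ω i2) (signedDivisors X (- (m₀ + m₁))) (signedDivisors-length X (- (m₀ + m₁)))
          (λ { ω ((((((((p , n) , refl) , refl) , _) , _) , _) , _) , _) →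
            subst (λ m → y ω i2 ∈ signedDivisors X m) (third ω p) (∈-signedDivisors (bound ω p i2)
              (ℤ∣.∣n⇒∣m*n (x ω i2) ℤ∣.∣-refl) (n i2)) }) λ y₂ →
        bounded-⊆ (λ { ω (((((((((p , _) , _) , _) , a) , a′) , b) , b′) , c) , c′) → p , (a , b , c) ,
          (a′ , b′ , c′) })
          (leaf x₀ x₁ x₂ y₀ y₁ y₂)
        where
        bound : ∀ ω → P ω → ∀ a → ∣ x ω a * y ω a ∣ ℕ.≤ X
        bound ω p a = ℕₚ.≤-trans (small ω p a a) T≤X
        third : ∀ ω → P ω → x ω i2 * y ω i2 ≡ - (x ω i0 * y ω i0 + x ω i1 * y ω i1)
        third ω p = trans (identity (x ω i0 * y ω i0) (x ω i1 * y ω i1) (x ω i2 * y ω i2))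
          (trans (cong (λ z → z - (x ω i0 * y ω i0 + x ω i1 * y ω i1)) (orth ω p)) (ℤₚ.+-identityˡ _))
          where
          identity : ∀ a b c → c ≡ a + b + c - (a + b)
          identity = solve-∀

      Coordinates : Fin 3 → ℤ → ℤ → ℤ → ℤ → ℤ → ℤ → Ω → Set
      Coordinates k a b c a′ b′ c′ ω = (x ω k ≡ a × x ω (next k) ≡ b × x ω (prev k) ≡ c) ×
                                       (y ω k ≡ a′ × y ω (next k) ≡ b′ × y ω (prev k) ≡ c′)

      rotated-leaf : ∀ k a b c a′ b′ c′ → Bounded R (λ ω → P ω × Coordinates k a b c a′ b′ c′ ω) M
      rotated-leaf 0F a b c a′ b′ c′ = leaf a b c a′ b′ c′
      rotated-leaf 1F a b c a′ b′ c′ = bounded-⊆ (λ { ω (p , (e , f , g) , (e′ , f′ , g′)) → p , (g , e , f) ,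
        (g′ , e′ , f′) }) (leaf c a b c′ a′ b′)
      rotated-leaf 2F a b c a′ b′ c′ = bounded-⊆ (λ { ω (p , (e , f , g) , (e′ , f′ , g′)) → p , (f , g , e) ,
        (f′ , g′ , e′) }) (leaf b c a b′ c′ a′)

      degenerate : ∀ k → Bounded R (λ ω → P ω × ∃[ n ] Degenerate T k (x ω) (y ω) n)
        (3 ℕ.* T ℕ.* (3 ℕ.* Δ ℕ.* (3 ℕ.* Δ ℕ.* (3 ℕ.* Δ ℕ.* (3 ℕ.* Δ ℕ.* (3 ℕ.* T ℕ.* M ℕ.+ 3 ℕ.* T ℕ.* M))))))
      degenerate k =
        bounded-cover-≤ (λ ω n → Degenerate T k (x ω) (y ω) n) (interval T) (interval-length T 1≤T)
          (λ { ω (p , n , d) → lose (∈-interval (Degenerate.small d)) d }) λ n →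
        bounded-fix-≤ (λ ω → x ω (next k)) (zeroOrDivisor X n) (zeroOrDivisor-length X n)
          (λ { ω (_ , d) → member d (Degenerate.x-next d) }) λ b →
        bounded-fix-≤ (λ ω → y ω (next k)) (zeroOrDivisor X n) (zeroOrDivisor-length X n)
          (λ { ω ((_ , d) , _) → member d (Degenerate.y-next d) }) λ b′ →
        bounded-fix-≤ (λ ω → x ω (prev k)) (zeroOrDivisor X n) (zeroOrDivisor-length X n)
          (λ { ω (((_ , d) , _) , _) → member d (Degenerate.x-next² d) }) λ c →
        bounded-fix-≤ (λ ω → y ω (prev k)) (zeroOrDivisor X n) (zeroOrDivisor-length X n)
          (λ { ω ((((_ , d) , _) , _) , _) → member d (Degenerate.y-next² d) }) λ c′ →
        bounded-⊎ {Q = λ ω → (P ω × x ω (next k) ≡ b × y ω (next k) ≡ b′ × x ω (prev k) ≡ c × y ω (prev k) ≡ c′) ×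
          (x ω k ≡ 0ℤ × ∣ y ω k ∣ ℕ.≤ T)}
                  {O = λ ω → (P ω × x ω (next k) ≡ b × y ω (next k) ≡ b′ × x ω (prev k) ≡ c × y ω (prev k) ≡ c′) ×
                    (y ω k ≡ 0ℤ × ∣ x ω k ∣ ℕ.≤ T)}
          (λ { ω ((((((p , _) , d) , eb) , eb′) , ec) , ec′) → ×-distrib-⊎ (p , eb , eb′ , ec , ec′)
            (Degenerate.rest d) })
          (bounded-fix-≤ (λ ω → y ω k) (interval T) (interval-length T 1≤T) (λ { ω (_ , _ , le) → ∈-interval le })
            λ a′ →
            bounded-⊆ (λ { ω (((p , eb , eb′ , ec , ec′) , ea , _) , ea′) → p , (ea , eb , ec) , (ea′ , eb′ , ec′) })
              (rotated-leaf k 0ℤ b c a′ b′ c′))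
          (bounded-fix-≤ (λ ω → x ω k) (interval T) (interval-length T 1≤T) (λ { ω (_ , _ , le) → ∈-interval le }) λ a
            →
            bounded-⊆ (λ { ω (((p , eb , eb′ , ec , ec′) , ea′ , _) , ea) → p , (ea , eb , ec) , (ea′ , eb′ , ec′) })
              (rotated-leaf k a b c 0ℤ b′ c′))
        where
        member : ∀ {n z ω} → Degenerate T k (x ω) (y ω) n → ZeroOrDivides n z → z ∈ zeroOrDivisor X n
        member d z = ∈-zeroOrDivisor (ℕₚ.≤-trans (Degenerate.small d) T≤X) (Degenerate.nonzero d) z

    -- The regular pairs contribute 3² · 2⁶ = 576, the degenerate ones 3 · 3 · 3⁴ · 6 = 4374 with
    -- only Δ⁴; the sum is below 10⁴.
    orthogonal-pairs-bound : Bounded R P (10 ℕ.^ 4 ℕ.* (T ℕ.* T ℕ.* Δ ℕ.^ 6 ℕ.* M))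
    orthogonal-pairs-bound = bounded-≤ total (bounded-⊎
      {Q = λ ω → P ω × (∀ a → x ω a * y ω a ≢ 0ℤ)} {O = λ ω → P ω × ∃[ k ] ∃[ n ] Degenerate T k (x ω) (y ω) n}
      (λ ω p → ×-distrib-⊎ p (orthogonal-cases (orth ω p) (small ω p) (x≢0 ω p) (y≢0 ω p)))
      regular
      (bounded-cover (λ ω k → ∃[ n ] Degenerate T k (x ω) (y ω) n) indices
        (λ { ω (_ , 0F , d) → here d ; ω (_ , 1F , d) → there (here d) ; ω (_ , 2F , d) → there (there (here d)) })
        λ k → bounded-⊆ (λ { ω ((p , _) , d) → p , d }) (degenerate k)))
      where
      expand : ∀ T Δ M →
        3 ℕ.* T ℕ.* (3 ℕ.* T ℕ.*
          (2 ℕ.* Δ ℕ.* (2 ℕ.* Δ ℕ.* (2 ℕ.* Δ ℕ.* (2 ℕ.* Δ ℕ.* (2 ℕ.* Δ ℕ.* (2 ℕ.* Δ ℕ.* M)))))))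
        ℕ.+ 3 ℕ.* (3 ℕ.* T ℕ.*
          (3 ℕ.* Δ ℕ.* (3 ℕ.* Δ ℕ.* (3 ℕ.* Δ ℕ.* (3 ℕ.* Δ ℕ.* (3 ℕ.* T ℕ.* M ℕ.+ 3 ℕ.* T ℕ.* M))))))
        ≡ 576 ℕ.* (T ℕ.* T ℕ.* (Δ ℕ.* (Δ ℕ.* (Δ ℕ.* (Δ ℕ.* (Δ ℕ.* (Δ ℕ.* 1)))))) ℕ.* M) ℕ.+ 4374 ℕ.*
          (T ℕ.* T ℕ.* (Δ ℕ.* (Δ ℕ.* (Δ ℕ.* (Δ ℕ.* 1)))) ℕ.* M)
      expand = solveℕ-∀
      total : _ ℕ.≤ 10 ℕ.^ 4 ℕ.* (T ℕ.* T ℕ.* Δ ℕ.^ 6 ℕ.* M)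
      total = begin
        _ ≡⟨ expand T Δ M ⟩
        576 ℕ.* (T ℕ.* T ℕ.* Δ ℕ.^ 6 ℕ.* M) ℕ.+ 4374 ℕ.* (T ℕ.* T ℕ.* Δ ℕ.^ 4 ℕ.* M)
          ≤⟨ ℕₚ.+-monoʳ-≤ (576 ℕ.* (T ℕ.* T ℕ.* Δ ℕ.^ 6 ℕ.* M))
            (ℕₚ.*-monoʳ-≤ 4374 (ℕₚ.*-monoˡ-≤ M (ℕₚ.*-monoʳ-≤ (T ℕ.* T)
              (ℕₚ.^-monoʳ-≤ Δ {{>-nonZero (maxDivisors≥1 X)}} {4} {6} (s≤s (s≤s (s≤s (s≤s z≤n)))))))) ⟩
        576 ℕ.* (T ℕ.* T ℕ.* Δ ℕ.^ 6 ℕ.* M) ℕ.+ 4374 ℕ.* (T ℕ.* T ℕ.* Δ ℕ.^ 6 ℕ.* M)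
          ≡⟨ ℕₚ.*-distribʳ-+ (T ℕ.* T ℕ.* Δ ℕ.^ 6 ℕ.* M) 576 4374 ⟨
        4950 ℕ.* (T ℕ.* T ℕ.* Δ ℕ.^ 6 ℕ.* M)
          ≤⟨ ℕₚ.*-monoˡ-≤ (T ℕ.* T ℕ.* Δ ℕ.^ 6 ℕ.* M) {4950} {10000} (ℕₚ.m≤m+n 4950 5050) ⟩
        10 ℕ.^ 4 ℕ.* (T ℕ.* T ℕ.* Δ ℕ.^ 6 ℕ.* M) ∎
        where open ℕₚ.≤-Reasoning

-- Recovering a matrix from one column and one row of its inverse

module _ where
  open import Data.Integer.Base using (_+_; _*_; _-_; -_)

  DistinctMat : Mat3 → Mat3 → Set
  DistinctMat g h = ¬ MatEq g h

  record Small (T : ℕ) (g : Mat3) : Set where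
    field
      det≡1 : InSL3 g
      norm≤ : normInf g ℕ.* normInf (adj g) ℕ.≤ T

  column : Mat3 → Fin 3 → Vec3
  column g a x = g x a

  adj-dot : ∀ {g} → InSL3 g → ∀ a b → dot (adj g a) (column g b) ≡ idMat a b
  adj-dot {g} det≡1 a b = trans (adj-· g a b) (trans (cong (_* idMat a b) det≡1) (ℤₚ.*-identityˡ _))

  -- The rows of `adj g` form the basis dual to the columns of `g`, so pairing with them gives
  -- coordinates.
  expand-columns : ∀ {g} → InSL3 g → ∀ z t → z t ≡ sum3 λ a → dot (adj g a) z * g t a
  expand-columns {g} det≡1 z t = sym (trans
    (identity (g t i0) (g t i1) (g t i2) (h i0 i0) (h i0 i1) (h i0 i2) (h i1 i0) (h i1 i1) (h i1 i2) (h i2 i0)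
      (h i2 i1) (h i2 i2) (z i0) (z i1) (z i2))
    (trans (sum3-cong λ k → cong (_* z k)
      (trans (·-adj g t k) (trans (cong (_* idMat t k) det≡1) (ℤₚ.*-identityˡ _)))) (sum3-idˡ z t)))
    where
    h = adj g
    identity : ∀ x y z a b c d e f g h i u v w →
      (a * u + b * v + c * w) * x + (d * u + e * v + f * w) * y + (g * u + h * v + i * w) * z ≡
      (x * a + y * d + z * g) * u + (x * b + y * e + z * h) * v + (x * c + y * f + z * i) * w
    identity = solve-∀

  expand-rows : ∀ {g} → InSL3 g → ∀ z t → z t ≡ sum3 λ a → dot z (column g a) * adj g a t
  expand-rows {g} det≡1 z t = sym (trans
    (identity (h i0 t) (h i1 t) (h i2 t) (g i0 i0) (g i0 i1) (g i0 i2) (g i1 i0) (g i1 i1) (g i1 i2) (g i2 i0)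
      (g i2 i1) (g i2 i2) (z i0) (z i1) (z i2))
    (trans (sum3-cong λ k → cong (z k *_)
      (trans (·-adj g k t) (trans (cong (_* idMat k t) det≡1) (ℤₚ.*-identityˡ _)))) (sum3-idʳ z t)))
    where
    h = adj g
    identity : ∀ x y z a b c d e f g h i u v w →
      (u * a + v * d + w * g) * x + (u * b + v * e + w * h) * y + (u * c + v * f + w * i) * z ≡
      u * (a * x + b * y + c * z) + v * (d * x + e * y + f * z) + w * (g * x + h * y + i * z)
    identity = solve-∀

  maxAbs3-attained : ∀ x → ∃[ t ] maxAbs3 x ≡ ∣ x t ∣
  maxAbs3-attained x with ℕₚ.⊔-sel (∣ x i0 ∣ ℕ.⊔ ∣ x i1 ∣) ∣ x i2 ∣
  ... | inj₂ eq = i2 , eq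
  ... | inj₁ eq with ℕₚ.⊔-sel ∣ x i0 ∣ ∣ x i1 ∣
  ... | inj₁ eq′ = i0 , trans eq eq′
  ... | inj₂ eq′ = i1 , trans eq eq′

  maxAbs3-nonzero : ∀ {x} → NonzeroVec x → 1 ℕ.≤ maxAbs3 x
  maxAbs3-nonzero {x} (a , n) = ℕₚ.≤-trans (nonzero⇒1≤∣∣ n) (max3-upper (λ k → ∣ x k ∣) a)

  -- Evaluate at a coordinate where |z| is largest: there |a| |z| ≤ |x| + |y| ≤ 2 |z|. This is the
  -- only use made of extremality.
  scalar-≤2 : ∀ a {x y z : Vec3} → NonzeroVec z → (∀ t → a * z t ≡ x t - y t) →
              maxAbs3 x ℕ.≤ maxAbs3 z → maxAbs3 y ℕ.≤ maxAbs3 z → ∣ a ∣ ℕ.≤ 2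
  scalar-≤2 a {x} {y} {z} z≢0 eq x≤ y≤ with maxAbs3-attained z
  ... | t , max≡ = ℕₚ.*-cancelʳ-≤ ∣ a ∣ 2 (maxAbs3 z) {{>-nonZero (maxAbs3-nonzero z≢0)}} (begin
    ∣ a ∣ ℕ.* maxAbs3 z         ≡⟨ cong (∣ a ∣ ℕ.*_) max≡ ⟩
    ∣ a ∣ ℕ.* ∣ z t ∣           ≡⟨ ℤₚ.abs-* a (z t) ⟨
    ∣ a * z t ∣                 ≡⟨ cong ∣_∣ (eq t) ⟩
    ∣ x t - y t ∣               ≤⟨ abs---≤ {x t} (ℕₚ.≤-trans (max3-upper (λ k → ∣ x k ∣) t) x≤)
      (ℕₚ.≤-trans (max3-upper (λ k → ∣ y k ∣) t) y≤) ⟩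
    maxAbs3 z ℕ.+ maxAbs3 z     ≡⟨ cong (maxAbs3 z ℕ.+_) (ℕₚ.+-identityʳ _) ⟨
    2 ℕ.* maxAbs3 z             ∎)
    where open ℕₚ.≤-Reasoning

  -- Lets the arrangements of the three indices be treated at once: i is the column that is kept, j
  -- the row of the inverse that is kept, k the remaining index.
  record IsPermutation (i k j : Fin 3) : Set₁ where
    field
      sum : ∀ (f : Fin 3 → ℤ) → f i + f k + f j ≡ sum3 f
      cases : ∀ (Q : Fin 3 → Set) → Q i → Q k → Q j → ∀ a → Q a
      i≢k : i ≢ k
      i≢j : i ≢ j
      k≢j : k ≢ j

  swap-permutation : ∀ {i k j} → IsPermutation i k j → IsPermutation k i j
  swap-permutation {i} {k} {j} π = record
    { sum = λ f → trans (cong (_+ f j) (ℤₚ.+-comm (f k) (f i))) (sum f)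
    ; cases = λ Q a b c → cases Q b a c
    ; i≢k = i≢k ∘ sym ; i≢j = k≢j ; k≢j = i≢j }
    where open IsPermutation π

  next-permutation : ∀ j → IsPermutation (next j) (prev j) j
  next-permutation 0F = record
    { sum = λ f → +-rotateˡ (f i0) (f i1) (f i2) ; cases = λ { Q a b c 0F → c ; Q a b c 1F → a ; Q a b c 2F → b }
    ; i≢k = λ () ; i≢j = λ () ; k≢j = λ () }
  next-permutation 1F = record
    { sum = λ f → +-rotateʳ (f i0) (f i1) (f i2) ; cases = λ { Q a b c 1F → c ; Q a b c 2F → a ; Q a b c 0F → b }
    ; i≢k = λ () ; i≢j = λ () ; k≢j = λ () }
  next-permutation 2F = record
    { sum = λ f → refl ; cases = λ { Q a b c 2F → c ; Q a b c 0F → a ; Q a b c 1F → b }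
    ; i≢k = λ () ; i≢j = λ () ; k≢j = λ () }

  idMat-≢ : ∀ {i j} → i ≢ j → idMat i j ≡ 0ℤ
  idMat-≢ {0F} {0F} n = contradiction refl n
  idMat-≢ {0F} {1F} n = refl
  idMat-≢ {0F} {2F} n = refl
  idMat-≢ {1F} {0F} n = refl
  idMat-≢ {1F} {1F} n = contradiction refl n
  idMat-≢ {1F} {2F} n = refl
  idMat-≢ {2F} {0F} n = refl
  idMat-≢ {2F} {1F} n = refl
  idMat-≢ {2F} {2F} n = contradiction refl n

  idMat-diag : ∀ i → idMat i i ≡ 1ℤ
  idMat-diag 0F = refl
  idMat-diag 1F = refl
  idMat-diag 2F = refl

  dot-cong : ∀ {x x′ y y′ : Vec3} → (∀ t → x t ≡ x′ t) → (∀ t → y t ≡ y′ t) → dot x y ≡ dot x′ y′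
  dot-cong e f = sum3-cong λ t → cong₂ _*_ (e t) (f t)

  zero-or-nonzero : ∀ x → (∀ a → x a ≡ 0ℤ) ⊎ NonzeroVec x
  zero-or-nonzero x with x i0 ℤₚ.≟ 0ℤ | x i1 ℤₚ.≟ 0ℤ | x i2 ℤₚ.≟ 0ℤ
  ... | no n | _ | _ = inj₂ (i0 , n)
  ... | _ | no n | _ = inj₂ (i1 , n)
  ... | _ | _ | no n = inj₂ (i2 , n)
  ... | yes a | yes b | yes c = inj₁ λ { 0F → a ; 1F → b ; 2F → c }

  dot≡1⇒nonzeroˡ : ∀ {x y} → dot x y ≡ 1ℤ → NonzeroVec x
  dot≡1⇒nonzeroˡ {x} {y} eq with zero-or-nonzero x
  ... | inj₂ n = n
  ... | inj₁ z = contradiction (trans (sym eq) (sum3-cong λ t → cong (_* y t) (z t))) λ ()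

  dot≡1⇒nonzeroʳ : ∀ {x y} → dot x y ≡ 1ℤ → NonzeroVec y
  dot≡1⇒nonzeroʳ {x} {y} eq = dot≡1⇒nonzeroˡ {y} {x} (trans (sum3-cong λ t → ℤₚ.*-comm (y t) (x t)) eq)

  inverse-determines : ∀ {g g′} → InSL3 g → InSL3 g′ → MatEq (adj g) (adj g′) → MatEq g g′
  inverse-determines {g} {g′} d d′ eq a b = begin
    g a b                   ≡⟨ ℤₚ.*-identityˡ _ ⟨
    1ℤ * g a b              ≡⟨ cong (_* g a b) d ⟨
    det3 g * g a b          ≡⟨ adj-adj g a b ⟨
    adj (adj g) a b         ≡⟨ cong₂ _-_ (cong₂ _*_ (eq _ _) (eq _ _)) (cong₂ _*_ (eq _ _) (eq _ _)) ⟩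
    adj (adj g′) a b        ≡⟨ adj-adj g′ a b ⟩
    det3 g′ * g′ a b        ≡⟨ cong (_* g′ a b) d′ ⟩
    1ℤ * g′ a b             ≡⟨ ℤₚ.*-identityˡ _ ⟩
    g′ a b                  ∎
    where open ≡-Reasoning

  module Completion {i k j : Fin 3} (π : IsPermutation i k j) where
    open IsPermutation π

    -- Column i and row j pair to zero because i ≠ j. Their maximality bounds every multiple of them
    -- that can be added to column k, or to the rows i and k, by 2 in absolute value.
    record Extremal (T : ℕ) (g : Mat3) : Set where
      field
        det≡1 : InSL3 g
        column≤ : maxAbs3 (column g k) ℕ.≤ maxAbs3 (column g i)
        rowᵢ≤ : maxAbs3 (adj g i) ℕ.≤ maxAbs3 (adj g j)
        rowₖ≤ : maxAbs3 (adj g k) ℕ.≤ maxAbs3 (adj g j)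
        small : ∀ a b → ∣ g a i * adj g j b ∣ ℕ.≤ T

    open Extremal


    private
      pair₀ : ∀ {a b} g → InSL3 g → a ≢ b → dot (adj g a) (column g b) ≡ 0ℤ
      pair₀ {a} {b} g d n = trans (adj-dot {g} d a b) (idMat-≢ n)

      pair₁ : ∀ a g → InSL3 g → dot (adj g a) (column g a) ≡ 1ℤ
      pair₁ a g d = trans (adj-dot {g} d a a) (idMat-diag a)

      abs≡1 : ∀ c c′ → c * c′ ≡ 1ℤ → c ∈ 1ℤ ∷ -1ℤ ∷ []
      abs≡1 c c′ eq with ℕₚ.m*n≡1⇒m≡1 ∣ c ∣ ∣ c′ ∣ (trans (sym (ℤₚ.abs-* c c′)) (cong ∣_∣ eq))
      abs≡1 (+ 1) c′ eq | refl = here refl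
      abs≡1 -[1+ 0 ] c′ eq | refl = there (here refl)

    module _ {T X} (1≤T : 1 ℕ.≤ T) (T+T≤X : T ℕ.+ T ℕ.≤ X) where

      module _ (p r : Vec3) where

        WithPair : Mat3 → Set
        WithPair g = Extremal T g × (∀ t → g t i ≡ p t) × (∀ t → adj g j t ≡ r t)

        private
          p≢0 : ∀ {g} → WithPair g → NonzeroVec (column g i)
          p≢0 {g} (e , _) = dot≡1⇒nonzeroʳ {adj g i} (pair₁ i g (det≡1 e))

          r≢0 : ∀ {g} → WithPair g → NonzeroVec (adj g j)
          r≢0 {g} (e , _) = dot≡1⇒nonzeroˡ {adj g j} {column g j} (pair₁ j g (det≡1 e))

          coefficient : Mat3 → Mat3 → Fin 3 → ℤ
          coefficient g₀ g a = dot (adj g₀ a) (column g k)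

          -- The coefficient at column j vanishes, since `g₀` and `g` share row j of the inverse,
          -- which annihilates column k of `g`.
          expand-k : ∀ {g₀ g} → WithPair g₀ → WithPair g →
                     ∀ t → g t k ≡ coefficient g₀ g i * g₀ t i + coefficient g₀ g k * g₀ t k
          expand-k {g₀} {g} (e₀ , _ , r₀) (e , _ , r₁) t = begin
            g t k                                       ≡⟨ expand-columns {g₀} (det≡1 e₀) (column g k) t ⟩
            sum3 (λ a → dot (adj g₀ a) (column g k) * g₀ t a)
                                                        ≡⟨ sum (λ a → dot (adj g₀ a) (column g k) * g₀ t a) ⟨
            coefficient g₀ g i * g₀ t i + coefficient g₀ g k * g₀ t k + dot (adj g₀ j) (column g k) * g₀ t j
                                                        ≡⟨ cong (λ z → coefficient g₀ g i * g₀ t i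
                                                          + coefficient g₀ g k * g₀ t k + z * g₀ t j)
                                                            (trans (dot-cong {y = column g k}
                                                              (λ t → trans (r₀ t) (sym (r₁ t))) (λ _ → refl))
                                                              (pair₀ g (det≡1 e) (k≢j ∘ sym))) ⟩
            coefficient g₀ g i * g₀ t i + coefficient g₀ g k * g₀ t k + 0ℤ ≡⟨ ℤₚ.+-identityʳ _ ⟩
            coefficient g₀ g i * g₀ t i + coefficient g₀ g k * g₀ t k ∎
            where open ≡-Reasoning

          -- Interchanging `g₀` and `g` inverts the coefficient of column k, because both have the
          -- same column i. Hence that coefficient is ±1.
          coefficient-unit : ∀ {g₀ g} → WithPair g₀ → WithPair g → coefficient g₀ g k * coefficient g g₀ k ≡ 1ℤ
          coefficient-unit {g₀} {g} w₀@(e₀ , p₀ , _) w@(e , p₁ , _) = begin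
            c * c′                        ≡⟨ identity a′ c c′ ⟩
            a′ * 0ℤ + c′ * c              ≡⟨ cong (λ z → a′ * z + c′ * c)
              (trans (dot-cong {adj g₀ k} (λ _ → refl) (λ t → trans (p₁ t) (sym (p₀ t))))
              (pair₀ g₀ (det≡1 e₀) (i≢k ∘ sym))) ⟨
            a′ * dot (adj g₀ k) (column g i) + c′ * dot (adj g₀ k) (column g k)
                                          ≡⟨ linear a′ c′ (adj g₀ k i0) (adj g₀ k i1) (adj g₀ k i2) (g i0 i) (g i1 i)
                                            (g i2 i) (g i0 k) (g i1 k) (g i2 k) ⟨
            dot (adj g₀ k) (λ t → a′ * g t i + c′ * g t k)
                                          ≡⟨ dot-cong {adj g₀ k} (λ _ → refl) (λ t → expand-k {g} {g₀} w w₀ t) ⟨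
            dot (adj g₀ k) (column g₀ k)  ≡⟨ pair₁ k g₀ (det≡1 e₀) ⟩
            1ℤ                            ∎
            where
            open ≡-Reasoning
            c = coefficient g₀ g k
            c′ = coefficient g g₀ k
            a′ = coefficient g g₀ i
            identity : ∀ a c c′ → c * c′ ≡ a * 0ℤ + c′ * c
            identity = solve-∀
            linear : ∀ a c x y z u v w u′ v′ w′ →
              x * (a * u + c * u′) + y * (a * v + c * v′) + z * (a * w + c * w′) ≡
              a * (x * u + y * v + z * w) + c * (x * u′ + y * v′ + z * w′)
            linear = solve-∀

          abs-unit : ∀ {c} → c ∈ 1ℤ ∷ -1ℤ ∷ [] → ∣ c ∣ ≡ 1
          abs-unit (here refl) = refl
          abs-unit (there (here refl)) = refl

          scaled-max : ∀ c x → ∣ c ∣ ≡ 1 → maxAbs3 (λ t → c * x t) ℕ.≤ maxAbs3 x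
          scaled-max c x c≡1 = max3-least (λ t → ∣ c * x t ∣) λ t → ℕₚ.≤-trans
            (ℕₚ.≤-reflexive (trans (ℤₚ.abs-* c (x t)) (trans (cong (ℕ._* ∣ x t ∣) c≡1) (ℕₚ.*-identityˡ _))))
            (max3-upper (λ t → ∣ x t ∣) t)

          isolate : ∀ {x a b} → x ≡ a + b → a ≡ x - b
          isolate {a = a} {b} refl = identity a b
            where
            identity : ∀ a b → a ≡ a + b - b
            identity = solve-∀

          coefficient-small : ∀ {g₀ g} → WithPair g₀ → WithPair g → ∣ coefficient g₀ g i ∣ ℕ.≤ 2
          coefficient-small {g₀} {g} w₀@(e₀ , p₀ , _) w@(e , p₁ , _) =
            scalar-≤2 (coefficient g₀ g i) {column g k} {λ t → c * g₀ t k} {column g₀ i} (p≢0 {g₀} w₀)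
              (λ t → isolate (expand-k {g₀} {g} w₀ w t))
              (ℕₚ.≤-trans (column≤ e) (ℕₚ.≤-reflexive
                (cong₂ ℕ._⊔_ (cong₂ ℕ._⊔_ (cong ∣_∣ (same i0)) (cong ∣_∣ (same i1))) (cong ∣_∣ (same i2)))))
              (ℕₚ.≤-trans (scaled-max c (column g₀ k)
                (abs-unit (abs≡1 c (coefficient g g₀ k) (coefficient-unit {g₀} {g} w₀ w)))) (column≤ e₀))
            where
            c = coefficient g₀ g k
            same : ∀ t → g t i ≡ g₀ t i
            same t = trans (p₁ t) (sym (p₀ t))

        -- Relative to a base matrix with the same columns i and k, rows i and k of the inverse change by multiples of row j.
        module _ (u : Vec3) where

          WithColumns : Mat3 → Set
          WithColumns g = WithPair g × (∀ t → g t k ≡ u t)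

          private
            expand-row : ∀ {g₀ g} → WithColumns g₀ → WithColumns g → ∀ {a} → a ≢ j →
                         ∀ t → adj g a t ≡ idMat a i * adj g₀ i t + idMat a k * adj g₀ k t + dot (adj g a)
                           (column g₀ j) * adj g₀ j t
            expand-row {g₀} {g} ((e₀ , p₀ , _) , u₀) ((e , p₁ , _) , u₁) {a} a≢j t = begin
              adj g a t                                ≡⟨ expand-rows {g₀} (det≡1 e₀) (adj g a) t ⟩
              sum3 (λ b → dot (adj g a) (column g₀ b) * adj g₀ b t)
                                                       ≡⟨ sum (λ b → dot (adj g a) (column g₀ b) * adj g₀ b t) ⟨
              dot (adj g a) (column g₀ i) * adj g₀ i t + dot (adj g a) (column g₀ k) * adj g₀ k t + last
                                                       ≡⟨ cong₂ (λ x y → x * adj g₀ i t + y * adj g₀ k t + last)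
                (trans (dot-cong {adj g a} (λ _ → refl) (λ t → trans (p₀ t) (sym (p₁ t))))
                  (adj-dot {g} (det≡1 e) a i))
                (trans (dot-cong {adj g a} (λ _ → refl) (λ t → trans (u₀ t) (sym (u₁ t))))
                  (adj-dot {g} (det≡1 e) a k)) ⟩
              idMat a i * adj g₀ i t + idMat a k * adj g₀ k t + last ∎
              where
              open ≡-Reasoning
              last = dot (adj g a) (column g₀ j) * adj g₀ j t

            row-shift : ∀ {g₀ g} → WithColumns g₀ → WithColumns g → ∀ {a} → a ≡ i ⊎ a ≡ k →
                        ∀ t → adj g a t ≡ adj g₀ a t + dot (adj g a) (column g₀ j) * adj g₀ j t
            row-shift {g₀} {g} w₀ w (inj₁ refl) t = trans (expand-row {g₀} {g} w₀ w i≢j t)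
              (trans (cong₂ (λ x y → x * adj g₀ i t + y * adj g₀ k t + b * adj g₀ j t) (idMat-diag i) (idMat-≢ i≢k))
                (identity (adj g₀ i t) (adj g₀ k t) (b * adj g₀ j t)))
              where
              b = dot (adj g i) (column g₀ j)
              identity : ∀ x y z → 1ℤ * x + 0ℤ * y + z ≡ x + z
              identity = solve-∀
            row-shift {g₀} {g} w₀ w (inj₂ refl) t = trans (expand-row {g₀} {g} w₀ w k≢j t)
              (trans (cong₂ (λ x y → x * adj g₀ i t + y * adj g₀ k t + b * adj g₀ j t) (idMat-≢ (i≢k ∘ sym))
                (idMat-diag k))
                (identity (adj g₀ i t) (adj g₀ k t) (b * adj g₀ j t)))
              where
              b = dot (adj g k) (column g₀ j)
              identity : ∀ x y z → 0ℤ * x + 1ℤ * y + z ≡ y + z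
              identity = solve-∀

            row-≤ : ∀ {g} → WithColumns g → ∀ {a} → a ≡ i ⊎ a ≡ k → maxAbs3 (adj g a) ℕ.≤ maxAbs3 (adj g j)
            row-≤ ((e , _) , _) (inj₁ refl) = rowᵢ≤ e
            row-≤ ((e , _) , _) (inj₂ refl) = rowₖ≤ e

            row-code : ∀ {g₀ g} → WithColumns g₀ → WithColumns g → ∀ {a} → a ≡ i ⊎ a ≡ k →
                       Any (λ b → ∀ t → adj g a t ≡ adj g₀ a t + b * adj g₀ j t) (interval 2)
            row-code {g₀} {g} w₀@((e₀ , _ , r₀) , _) w@((e , _ , r₁) , _) {a} a≡ = lose
              {x = dot (adj g a) (column g₀ j)}
              (∈-interval (scalar-≤2 (dot (adj g a) (column g₀ j)) {adj g a} {adj g₀ a} {adj g₀ j}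
                (r≢0 {g₀} (proj₁ w₀))
                (λ t → isolate (trans (row-shift {g₀} {g} w₀ w a≡ t) (ℤₚ.+-comm (adj g₀ a t) _)))
                (ℕₚ.≤-trans (row-≤ {g} w a≡) (ℕₚ.≤-reflexive
                  (cong₂ ℕ._⊔_ (cong₂ ℕ._⊔_ (cong ∣_∣ (same i0)) (cong ∣_∣ (same i1))) (cong ∣_∣ (same i2)))))
                (row-≤ {g₀} w₀ a≡)))
              (row-shift {g₀} {g} w₀ w a≡)
              where
              same : ∀ t → adj g j t ≡ adj g₀ j t
              same t = trans (r₁ t) (sym (r₀ t))

          columns-bound : Bounded DistinctMat WithColumns (5 ℕ.* (5 ℕ.* 1))
          columns-bound = bounded-based λ g₀ w₀ →
            bounded-cover (λ g b → ∀ t → adj g i t ≡ adj g₀ i t + b * adj g₀ j t) (interval 2)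
              (λ g w → row-code {g₀} {g} w₀ w (inj₁ refl)) λ b →
            bounded-cover (λ g c → ∀ t → adj g k t ≡ adj g₀ k t + c * adj g₀ j t) (interval 2)
              (λ g (w , _) → row-code {g₀} {g} w₀ w (inj₂ refl)) λ c →
            bounded-one λ { g g′ ((((e , _ , r₁) , _) , eᵢ) , eₖ) ((((e′ , _ , r₁′) , _) , eᵢ′) , eₖ′) ne →
              ne (inverse-determines {g} {g′} (det≡1 e) (det≡1 e′) (cases (λ a → ∀ t → adj g a t ≡ adj g′ a t)
                (λ t → trans (eᵢ t) (sym (eᵢ′ t))) (λ t → trans (eₖ t) (sym (eₖ′ t)))
                  (λ t → trans (r₁ t) (sym (r₁′ t))))) }

        -- Ten possibilities for column k (a coefficient of absolute value at most 2 and a sign),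
        -- then five for each of the two free rows of the inverse: 250 in all.
        pair-bound : Bounded DistinctMat WithPair (10 ℕ.* (5 ℕ.* (5 ℕ.* 1)))
        pair-bound = bounded-based λ g₀ w₀ →
          bounded-cover-≤ (λ g (a , c) → ∀ t → g t k ≡ a * g₀ t i + c * g₀ t k)
            (cartesianProduct (interval 2) (1ℤ ∷ -1ℤ ∷ [])) ℕₚ.≤-refl
            (λ g w → lose {x = coefficient g₀ g i , coefficient g₀ g k}
              (∈-cartesianProduct⁺ (∈-interval (coefficient-small {g₀} {g} w₀ w))
                                               (abs≡1 (coefficient g₀ g k) (coefficient g g₀ k)
                                                 (coefficient-unit {g₀} {g} w₀ w)))
                          (expand-k {g₀} {g} w₀ w))
            λ (a , c) → columns-bound (λ t → a * g₀ t i + c * g₀ t k)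

      extremal-bound : Bounded DistinctMat (Extremal T) (10 ℕ.^ 4 ℕ.* (T ℕ.* T ℕ.* maxDivisors X ℕ.^ 6 ℕ.* 250))
      extremal-bound = orthogonal-pairs-bound (λ g → column g i) (λ g → adj g j) 1≤T T+T≤X
        (λ g e → trans (sum3-cong λ t → ℤₚ.*-comm (g t i) (adj g j t)) (pair₀ g (det≡1 e) (i≢j ∘ sym)))
        (λ g → small)
        (λ g e → dot≡1⇒nonzeroʳ {adj g i} (pair₁ i g (det≡1 e)))
        (λ g e → dot≡1⇒nonzeroˡ {adj g j} {column g j} (pair₁ j g (det≡1 e)))
        pair-bound

  argmax : ∀ (f : Fin 3 → ℕ) → ∃[ j ] ∀ a → f a ℕ.≤ f j
  argmax f with ℕₚ.≤-total (f i0) (f i1) | ℕₚ.≤-total (f i0) (f i2) | ℕₚ.≤-total (f i1) (f i2)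
  ... | inj₁ a | _ | inj₁ c = i2 , λ { 0F → ℕₚ.≤-trans a c ; 1F → c ; 2F → ℕₚ.≤-refl }
  ... | inj₁ a | _ | inj₂ c = i1 , λ { 0F → a ; 1F → ℕₚ.≤-refl ; 2F → c }
  ... | inj₂ a | inj₁ b | _ = i2 , λ { 0F → b ; 1F → ℕₚ.≤-trans a b ; 2F → ℕₚ.≤-refl }
  ... | inj₂ a | inj₂ b | _ = i0 , λ { 0F → ℕₚ.≤-refl ; 1F → a ; 2F → b }

  abstract
    -- Six arrangements of the indices, 10⁴ from the orthogonal pairs, 250 completions of each pair.
    smallConstant : ℕ
    smallConstant = 6 ℕ.* 10 ℕ.^ 4 ℕ.* 250

    smallConstant-≡ : ∀ n → 6 ℕ.* (10 ℕ.^ 4 ℕ.* (n ℕ.* 250)) ≡ smallConstant ℕ.* n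
    smallConstant-≡ n = identity 6 (10 ℕ.^ 4) 250 n
      where
      identity : ∀ a b c n → a ℕ.* (b ℕ.* (n ℕ.* c)) ≡ a ℕ.* b ℕ.* c ℕ.* n
      identity = solveℕ-∀

  -- Take j to be the largest row of the inverse and i the larger of the two columns other than j;
  -- the boolean says which one that is.
  small-bound : ∀ {T X} → 1 ℕ.≤ T → T ℕ.+ T ℕ.≤ X →
                Bounded DistinctMat (Small T) (smallConstant ℕ.* (T ℕ.* T ℕ.* maxDivisors X ℕ.^ 6))
  small-bound {T} {X} 1≤T T+T≤X = bounded-≤ (ℕₚ.≤-reflexive (smallConstant-≡ (T ℕ.* T ℕ.* maxDivisors X ℕ.^ 6)))
    (bounded-cover-≤ (λ g (j , s) → E j s g)
    (cartesianProduct indices (true ∷ false ∷ [])) ℕₚ.≤-refl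
    (λ g sm → let j , max = argmax (λ a → maxAbs3 (adj g a)) in choose g sm j max
                    (ℕₚ.≤-total (maxAbs3 (column g (prev j))) (maxAbs3 (column g (next j)))))
    λ { (j , true) → bounded-⊆ (λ _ → proj₂) (Completion.extremal-bound (next-permutation j) 1≤T T+T≤X)
      ; (j , false) → bounded-⊆ (λ _ → proj₂)
        (Completion.extremal-bound (swap-permutation (next-permutation j)) 1≤T T+T≤X) })
    where
    E : Fin 3 → Bool → Mat3 → Set
    E j true = Completion.Extremal (next-permutation j) T
    E j false = Completion.Extremal (swap-permutation (next-permutation j)) T
    true∈ : true ∈ true ∷ false ∷ []
    true∈ = here refl
    false∈ : false ∈ true ∷ false ∷ []
    false∈ = there (here refl)
    choose : ∀ g → Small T g → ∀ j → (∀ a → maxAbs3 (adj g a) ℕ.≤ maxAbs3 (adj g j)) →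
             maxAbs3 (column g (prev j)) ℕ.≤ maxAbs3 (column g (next j)) ⊎ maxAbs3 (column g (next j)) ℕ.≤ maxAbs3
               (column g (prev j)) →
             Any (λ (j , s) → E j s g) (cartesianProduct indices (true ∷ false ∷ []))
    choose g sm j max (inj₁ le) = lose (∈-cartesianProduct⁺ (∈-indices j) true∈) (record
      { det≡1 = Small.det≡1 sm ; column≤ = le ; rowᵢ≤ = max _ ; rowₖ≤ = max _
      ; small = λ a b → ℕₚ.≤-trans (abs-*-≤ {g a (next j)} (entry≤norm g _ _) (entry≤norm (adj g) _ _))
        (Small.norm≤ sm) })
    choose g sm j max (inj₂ le) = lose (∈-cartesianProduct⁺ (∈-indices j) false∈) (record
      { det≡1 = Small.det≡1 sm ; column≤ = le ; rowᵢ≤ = max _ ; rowₖ≤ = max _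
      ; small = λ a b → ℕₚ.≤-trans (abs-*-≤ {g a (prev j)} (entry≤norm g _ _) (entry≤norm (adj g) _ _))
        (Small.norm≤ sm) })

-- Linear algebra modulo q

module _ where
  open import Data.Integer.Base using (_+_; _*_; _-_; -_)

  cross : Vec3 → Vec3 → Vec3
  cross v w a = v (next a) * w (prev a) - v (prev a) * w (next a)

  dot-comm : ∀ x y → dot x y ≡ dot y x
  dot-comm x y = sum3-cong λ t → ℤₚ.*-comm (x t) (y t)

  dot-crossˡ : ∀ v w → dot v (cross v w) ≡ 0ℤ
  dot-crossˡ v w = identity (v i0) (v i1) (v i2) (w i0) (w i1) (w i2)
    where
    identity : ∀ a b c x y z → a * (b * z - c * y) + b * (c * x - a * z) + c * (a * y - b * x) ≡ 0ℤ
    identity = solve-∀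

  dot-crossʳ : ∀ v w → dot w (cross v w) ≡ 0ℤ
  dot-crossʳ v w = identity (v i0) (v i1) (v i2) (w i0) (w i1) (w i2)
    where
    identity : ∀ a b c x y z → x * (b * z - c * y) + y * (c * x - a * z) + z * (a * y - b * x) ≡ 0ℤ
    identity = solve-∀

  dot-linear : ∀ g (x y : Vec3) a b → dot g (λ t → a * x t + b * y t) ≡ a * dot g x + b * dot g y
  dot-linear g x y a b = identity (g i0) (g i1) (g i2) (x i0) (x i1) (x i2) (y i0) (y i1) (y i2) a b
    where
    identity : ∀ f g h u v w x y z a b →
      f * (a * u + b * x) + g * (a * v + b * y) + h * (a * w + b * z) ≡
      a * (f * u + g * v + h * w) + b * (f * x + g * y + h * z)
    identity = solve-∀

  -- The vector triple product. It shows that a vector orthogonal to v and w is parallel to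
  -- `cross v w`.
  cross-cross : ∀ g v w t → cross g (cross v w) t ≡ dot g w * v t + - dot g v * w t
  cross-cross g v w = λ { 0F → identity (g i0) (g i1) (g i2) (v i0) (v i1) (v i2) (w i0) (w i1) (w i2)
    ; 1F → trans (identity (g i1) (g i2) (g i0) (v i1) (v i2) (v i0) (w i1) (w i2) (w i0))
             (cong₂ (λ s t → s * v i1 + - t * w i1) (+-rotateˡ (g i0 * w i0) (g i1 * w i1) (g i2 * w i2))
               (+-rotateˡ (g i0 * v i0) (g i1 * v i1) (g i2 * v i2)))
    ; 2F → trans (identity (g i2) (g i0) (g i1) (v i2) (v i0) (v i1) (w i2) (w i0) (w i1))
             (cong₂ (λ s t → s * v i2 + - t * w i2) (+-rotateʳ (g i0 * w i0) (g i1 * w i1) (g i2 * w i2))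
               (+-rotateʳ (g i0 * v i0) (g i1 * v i1) (g i2 * v i2))) }
    where
    identity : ∀ a b c d e f g h i →
      b * (d * h - e * g) - c * (f * g - d * i) ≡ (a * g + b * h + c * i) * d + - (a * d + b * e + c * f) * g
    identity = solve-∀

  -- Cramer's rule without division: up to the factor `cross v w k`, the vector x is a combination
  -- of v and w, with an error proportional to the pairing of x with `cross v w`.
  cramer : ∀ x v w k t → cross v w k * x t ≡ cross x w k * v t + cross v x k * w t + dot x (cross v w) * idMat k t
  cramer x v w = λ
    { 0F 0F → same (x i0) (x i1) (x i2) (v i0) (v i1) (v i2) (w i0) (w i1) (w i2)
    ; 0F 1F → one (x i0) (x i1) (x i2) (v i0) (v i1) (v i2) (w i0) (w i1) (w i2) (dot x (cross v w))
    ; 0F 2F → two (x i0) (x i1) (x i2) (v i0) (v i1) (v i2) (w i0) (w i1) (w i2) (dot x (cross v w))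
    ; 1F 1F → trans (same (x i1) (x i2) (x i0) (v i1) (v i2) (v i0) (w i1) (w i2) (w i0))
                (cong (λ z → cross x w i1 * v i1 + cross v x i1 * w i1 + z * 1ℤ) (+-rotateˡ (x i0 * cross v w i0)
                  (x i1 * cross v w i1) (x i2 * cross v w i2)))
    ; 1F 2F → one (x i1) (x i2) (x i0) (v i1) (v i2) (v i0) (w i1) (w i2) (w i0) (dot x (cross v w))
    ; 1F 0F → two (x i1) (x i2) (x i0) (v i1) (v i2) (v i0) (w i1) (w i2) (w i0) (dot x (cross v w))
    ; 2F 2F → trans (same (x i2) (x i0) (x i1) (v i2) (v i0) (v i1) (w i2) (w i0) (w i1))
                (cong (λ z → cross x w i2 * v i2 + cross v x i2 * w i2 + z * 1ℤ) (+-rotateʳ (x i0 * cross v w i0)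
                  (x i1 * cross v w i1) (x i2 * cross v w i2)))
    ; 2F 0F → one (x i2) (x i0) (x i1) (v i2) (v i0) (v i1) (w i2) (w i0) (w i1) (dot x (cross v w))
    ; 2F 1F → two (x i2) (x i0) (x i1) (v i2) (v i0) (v i1) (w i2) (w i0) (w i1) (dot x (cross v w)) }
    where
    same : ∀ x y z a b c d e f → (b * f - c * e) * x ≡
      (y * f - z * e) * a + (b * z - c * y) * d + (x * (b * f - c * e) + y * (c * d - a * f) + z * (a * e - b * d))
        * 1ℤ
    same = solve-∀
    one : ∀ x y z a b c d e f m → (b * f - c * e) * y ≡ (y * f - z * e) * b + (b * z - c * y) * e + m * 0ℤ
    one = solve-∀
    two : ∀ x y z a b c d e f m → (b * f - c * e) * z ≡ (y * f - z * e) * c + (b * z - c * y) * f + m * 0ℤ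
    two = solve-∀

  length-cartesianProduct : ∀ {A B : Set} (xs : List A) (ys : List B) → length (cartesianProduct xs ys)
    ≡ length xs ℕ.* length ys
  length-cartesianProduct [] ys = refl
  length-cartesianProduct (x ∷ xs) ys = trans (length-++ (map (x ,_) ys))
    (cong₂ ℕ._+_ (length-map (x ,_) ys) (length-cartesianProduct xs ys))

  residues : ℕ → List ℤ
  residues q = map +_ (upTo q)

  residues-length : ∀ q → length (residues q) ≡ q
  residues-length q = trans (length-map +_ (upTo q)) (length-upTo q)

  module _ {q : ℕ} (pr : Prime q) where

    private instance
      q≢0 : NonZero q
      q≢0 = prime⇒nonZero pr

    residue : ∀ x → ∃[ r ] (r ∈ residues q × (+ q ∣ x - r))
    residue x = + (x ℤ÷.%ℕ q) , ∈-map⁺ +_ (∈-upTo⁺ (ℤ÷.n%ℕd<d x q)) ,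
      divides (x ℤ÷./ℕ q) (trans (cong (_- + (x ℤ÷.%ℕ q)) (ℤ÷.a≡a%ℕn+[a/ℕn]*n x q))
        (identity (+ (x ℤ÷.%ℕ q)) (x ℤ÷./ℕ q * + q)))
      where
      identity : ∀ a b → a + b - a ≡ b
      identity = solve-∀

    -- Divided differences. For pairwise incongruent roots the first and the second divided
    -- difference vanish modulo q, and the second ones at (x, y, z) and (x, y, w) differ by z - w.
    cubic-roots : ∀ a b c → Bounded (λ x y → ¬ + q ∣ x - y) (λ x → + q ∣ x * x * x + a * (x * x) + b * x + c) 3
    cubic-roots a b c [] _ _ = z≤n
    cubic-roots a b c (x ∷ []) _ _ = s≤s z≤n
    cubic-roots a b c (x ∷ y ∷ []) _ _ = s≤s (s≤s z≤n)
    cubic-roots a b c (x ∷ y ∷ z ∷ []) _ _ = s≤s (s≤s (s≤s z≤n))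
    cubic-roots a b c (x ∷ y ∷ z ∷ w ∷ L) ((xy ∷ xz ∷ xw ∷ _) ∷ (yz ∷ yw ∷ _) ∷ (zw ∷ _) ∷ _)
      (px ∷ py ∷ pz ∷ pw ∷ _) =
      contradiction (∣-combine₂ 1ℤ -1ℤ (third x y z w) (second x y z xy yz xz px py pz)
        (second x y w xy yw xw px py pw)) zw
      where
      first : ∀ x y → ¬ + q ∣ x - y → + q ∣ x * x * x + a * (x * x) + b * x + c → + q ∣ y * y * y + a *
        (y * y) + b * y + c →
              + q ∣ x * x + x * y + y * y + a * (x + y) + b
      first x y n px py = prime-cancel pr (x - y) _ n (∣-combine₂ 1ℤ -1ℤ (identity x y a b c) px py)
        where
        identity : ∀ x y a b c → (x - y) * (x * x + x * y + y * y + a * (x + y) + b) ≡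
          1ℤ * (x * x * x + a * (x * x) + b * x + c) + -1ℤ * (y * y * y + a * (y * y) + b * y + c)
        identity = solve-∀
      second : ∀ x y z → ¬ + q ∣ x - y → ¬ + q ∣ y - z → ¬ + q ∣ x - z → + q ∣ x * x * x + a * (x * x) + b * x + c →
               + q ∣ y * y * y + a * (y * y) + b * y + c → + q ∣ z * z * z + a * (z * z) + b * z + c
                 → + q ∣ x + y + z + a
      second x y z xy yz xz px py pz = prime-cancel pr (y - z) _ yz
        (∣-combine₂ 1ℤ -1ℤ (identity x y z a b) (first x y xy px py) (first x z xz px pz))
        where
        identity : ∀ x y z a b → (y - z) * (x + y + z + a) ≡
          1ℤ * (x * x + x * y + y * y + a * (x + y) + b) + -1ℤ * (x * x + x * z + z * z + a * (x + z) + b)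
        identity = solve-∀
      third : ∀ x y z w → z - w ≡ 1ℤ * (x + y + z + a) + -1ℤ * (x + y + w + a)
      third x y z w = identity x y z w a
        where
        identity : ∀ x y z w a → z - w ≡ 1ℤ * (x + y + z + a) + -1ℤ * (x + y + w + a)
        identity = solve-∀

    NonzeroMod : Vec3 → Set
    NonzeroMod v = ∃[ a ] ¬ + q ∣ v a

    nonzeroMod? : ∀ v → (∀ a → + q ∣ v a) ⊎ NonzeroMod v
    nonzeroMod? v with + q ∣? v i0 | + q ∣? v i1 | + q ∣? v i2
    ... | no n | _ | _ = inj₂ (i0 , n)
    ... | _ | no n | _ = inj₂ (i1 , n)
    ... | _ | _ | no n = inj₂ (i2 , n)
    ... | yes a | yes b | yes c = inj₁ λ { 0F → a ; 1F → b ; 2F → c }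

    -- Equality of lines as a polynomial condition. The zero vector is parallel to everything, so
    -- transitivity asks for a nonzero middle vector.
    Parallel : Vec3 → Vec3 → Set
    Parallel u v = ∀ c → + q ∣ cross u v c

    parallel-minor : ∀ {u v} → Parallel u v → ∀ a b → + q ∣ u a * v b - u b * v a
    parallel-minor {u} {v} p = λ
      { 0F 0F → same (u i0) (v i0) ; 0F 1F → p i2 ; 0F 2F → flip (u i0) (u i2) (v i0) (v i2) (p i1)
      ; 1F 0F → flip (u i1) (u i0) (v i1) (v i0) (p i2) ; 1F 1F → same (u i1) (v i1) ; 1F 2F → p i0
      ; 2F 0F → p i1 ; 2F 1F → flip (u i2) (u i1) (v i2) (v i1) (p i0) ; 2F 2F → same (u i2) (v i2) }
      where
      same : ∀ x y → + q ∣ x * y - x * y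
      same x y = ∣-zero (ℤₚ.+-inverseʳ (x * y))
      flip : ∀ a b c d → + q ∣ b * c - a * d → + q ∣ a * d - b * c
      flip a b c d = ∣-combine₁ -1ℤ (identity (a * d) (b * c))
        where
        identity : ∀ x y → x - y ≡ -1ℤ * (y - x)
        identity = solve-∀

    parallel-sym : ∀ {u v} → Parallel u v → Parallel v u
    parallel-sym {u} {v} p c = ∣-combine₁ -1ℤ (identity (u (next c)) (u (prev c)) (v (next c)) (v (prev c))) (p c)
      where
      identity : ∀ a b c d → c * b - d * a ≡ -1ℤ * (a * d - b * c)
      identity = solve-∀

    parallel-scalar : ∀ {u v} → NonzeroMod v → Parallel u v → ∃[ c ] ∀ a → + q ∣ u a - c * v a
    parallel-scalar {u} {v} (i , n) p = let inv , d = prime-inverse pr (v i) n in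
      u i * inv , λ a → ∣-combine₂ (- u a) inv (identity (u a) (u i) (v a) (v i) inv) d (parallel-minor {u} {v} p a i)
      where
      identity : ∀ x y a b c → x - y * c * a ≡ - x * (b * c - 1ℤ) + c * (x * b - y * a)
      identity = solve-∀

    parallel-trans : ∀ {u v w} → NonzeroMod u → Parallel v u → Parallel u w → Parallel v w
    parallel-trans {u} {v} {w} n p p′ t = let c , d = parallel-scalar {v} {u} n p in
      ∣-combine₃ (w (prev t)) (- w (next t)) c
        (identity (u (next t)) (u (prev t)) (v (next t)) (v (prev t)) (w (next t)) (w (prev t)) c)
        (d (next t)) (d (prev t)) (p′ t)
      where
      identity : ∀ a b x y z w c → x * w - y * z ≡ w * (x - c * a) + - z * (y - c * b) + c * (a * w - b * z)
      identity = solve-∀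

    parallel-orthogonal : ∀ {u v g} → NonzeroMod v → Parallel u v → + q ∣ dot g v → + q ∣ dot g u
    parallel-orthogonal {u} {v} {g} n p o = let c , d = parallel-scalar {u} {v} n p in
      ∣-combine₄ (g i0) (g i1) (g i2) c (identity (g i0) (g i1) (g i2) (u i0) (u i1) (u i2) (v i0) (v i1) (v i2) c)
        (d i0) (d i1) (d i2) o
      where
      identity : ∀ a b c u v w x y z k → a * u + b * v + c * w ≡
        a * (u - k * x) + b * (v - k * y) + c * (w - k * z) + k * (a * x + b * y + c * z)
      identity = solve-∀

    orthogonal-parallel : ∀ {g v w} → + q ∣ dot g v → + q ∣ dot g w → Parallel g (cross v w)
    orthogonal-parallel {g} {v} {w} d d′ t =
      ∣-combine₂ (v t) (- w t) (trans (cross-cross g v w t) (identity (dot g v) (dot g w) (v t) (w t))) d′ d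
      where
      identity : ∀ a b x y → b * x + - a * y ≡ x * b + - y * a
      identity = solve-∀

    module _ {X : Set} {R : X → X → Set} {P : X → Set} {M : ℕ} (v : X → Vec3) where

      -- Three affine charts of the projective plane: an index i with nonzero coordinate, and the
      -- two ratios to it. The factor 3 comes from overlapping charts.
      bounded-lines : (∀ x → P x → NonzeroMod (v x)) →
                      (∀ x → P x → Bounded R (λ y → P y × Parallel (v x) (v y)) M) → Bounded R P
                        (3 ℕ.* (q ℕ.* q) ℕ.* M)
      bounded-lines nz fiber = bounded-cover-≤ (λ x (i , r , s) → Code (v x) i r s)
        (cartesianProduct indices (cartesianProduct (residues q) (residues q)))
        (ℕₚ.≤-reflexive (trans (length-cartesianProduct indices (cartesianProduct (residues q) (residues q)))
          (cong (3 ℕ.*_) (trans (length-cartesianProduct (residues q) (residues q)) (cong₂ ℕ._*_ (residues-length q)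
            (residues-length q))))))
        (λ x p → encode x (nz x p))
        λ (i , r , s) → bounded-based λ x (p , e) → bounded-⊆ (λ y (p′ , e′) → p′ , same-code (v x) (v y) i r s e e′)
          (fiber x p)
        where
        Code : Vec3 → Fin 3 → ℤ → ℤ → Set
        Code u i r s = (+ q ∣ u (next i) - r * u i) × (+ q ∣ u (prev i) - s * u i)
        ratio : ∀ a b → ¬ + q ∣ b → ∃[ r ] (r ∈ residues q × (+ q ∣ a - r * b))
        ratio a b n = let inv , d = prime-inverse pr b n ; r , r∈ , e = residue (a * inv) in
          r , r∈ , ∣-combine₂ (- a) b (identity a b inv r) d e
          where
          identity : ∀ a b c r → a - r * b ≡ - a * (b * c - 1ℤ) + b * (a * c - r)
          identity = solve-∀
        encode : ∀ x → NonzeroMod (v x) → Any (λ (i , r , s) → Code (v x) i r s)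
          (cartesianProduct indices (cartesianProduct (residues q) (residues q)))
        encode x (i , n) =
          let r , r∈ , d = ratio (v x (next i)) (v x i) n ; s , s∈ , e = ratio (v x (prev i)) (v x i) n in
          lose {x = i , r , s} (∈-cartesianProduct⁺ (∈-indices i) (∈-cartesianProduct⁺ r∈ s∈)) (d , e)
        code-minor : ∀ a b a′ b′ r → + q ∣ a - r * b → + q ∣ a′ - r * b′ → + q ∣ a * b′ - b * a′
        code-minor a b a′ b′ r d d′ = ∣-combine₂ b′ (- b) (identity a b a′ b′ r) d d′
          where
          identity : ∀ a b c d r → a * d - b * c ≡ d * (a - r * b) + - b * (c - r * d)
          identity = solve-∀
        code-minor′ : ∀ a b a′ b′ r → + q ∣ a - r * b → + q ∣ a′ - r * b′ → + q ∣ b * a′ - a * b′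
        code-minor′ a b a′ b′ r d d′ = ∣-combine₂ (- b′) b (identity a b a′ b′ r) d d′
          where
          identity : ∀ a b c d r → b * c - a * d ≡ - d * (a - r * b) + b * (c - r * d)
          identity = solve-∀
        code-minor″ : ∀ a b c a′ b′ c′ r s → + q ∣ a - r * c → + q ∣ b - s * c → + q ∣ a′ - r * c′ → + q ∣ b′ - s * c′
          → + q ∣ a * b′ - b * a′
        code-minor″ a b c a′ b′ c′ r s d e d′ e′ =
          ∣-combine₄ b′ (- a′) (- (s * c)) (r * c) (identity a b c a′ b′ c′ r s) d e d′ e′
          where
          identity : ∀ a b c d e f r s → a * e - b * d ≡ e * (a - r * c) + - d * (b - s * c) + - (s * c) *
            (d - r * f) + r * c * (e - s * f)
          identity = solve-∀
        same-code : ∀ u w i r s → Code u i r s → Code w i r s → Parallel u w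
        same-code u w 0F r s (d , e) (d′ , e′) = λ
          { 0F → code-minor″ (u i1) (u i2) (u i0) (w i1) (w i2) (w i0) r s d e d′ e′
          ; 1F → code-minor (u i2) (u i0) (w i2) (w i0) s e e′
          ; 2F → code-minor′ (u i1) (u i0) (w i1) (w i0) r d d′ }
        same-code u w 1F r s (d , e) (d′ , e′) = λ
          { 1F → code-minor″ (u i2) (u i0) (u i1) (w i2) (w i0) (w i1) r s d e d′ e′
          ; 2F → code-minor (u i0) (u i1) (w i0) (w i1) s e e′
          ; 0F → code-minor′ (u i2) (u i1) (w i2) (w i1) r d d′ }
        same-code u w 2F r s (d , e) (d′ , e′) = λ
          { 2F → code-minor″ (u i0) (u i1) (u i2) (w i0) (w i1) (w i2) r s d e d′ e′
          ; 0F → code-minor (u i1) (u i2) (w i1) (w i2) s e e′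
          ; 1F → code-minor′ (u i0) (u i2) (w i0) (w i2) r d d′ }

      -- If g k is invertible, a vector orthogonal to g is determined by its other two coordinates,
      -- so its line is a point of a projective line. `nothing` encodes the point with vanishing
      -- coordinate at `next k`, `just r` the ratio r.
      bounded-lines-in-plane : ∀ g → NonzeroMod g → (∀ x → P x → + q ∣ dot g (v x)) →
                               (∀ x → P x → Bounded R (λ y → P y × Parallel (v x) (v y)) M) → Bounded R P
                                 (suc q ℕ.* M)
      bounded-lines-in-plane g (k , n) orth fiber = bounded-cover-≤ (λ x c → Code c (v x))
        (nothing ∷ map just (residues q))
          (ℕₚ.≤-reflexive (cong suc (trans (length-map just (residues q)) (residues-length q))))
        (λ x p → encode x (+ q ∣? v x (next k)))
        λ c → bounded-based λ x (p , e) → bounded-⊆ (λ y (p′ , e′) → p′ ,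
          spread k {g} {v x} {v y} n (orth x p) (orth y p′) (same-code c {v x} {v y} e e′)) (fiber x p)
        where
        Code : Maybe ℤ → Vec3 → Set
        Code nothing u = + q ∣ u (next k)
        Code (just r) u = + q ∣ u (prev k) - r * u (next k)
        encode : ∀ x → Dec (+ q ∣ v x (next k)) → Any (λ c → Code c (v x)) (nothing ∷ map just (residues q))
        encode x (yes d) = here d
        encode x (no n) = let inv , d = prime-inverse pr (v x (next k)) n ; r , r∈ , e = residue
                                (v x (prev k) * inv) in
          there (lose (∈-map⁺ just r∈) (∣-combine₂ (- v x (prev k)) (v x (next k))
            (identity (v x (prev k)) (v x (next k)) inv r) d e))
          where
          identity : ∀ a b c r → a - r * b ≡ - a * (b * c - 1ℤ) + b * (a * c - r)
          identity = solve-∀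
        same-code : ∀ c {u w} → Code c u → Code c w → + q ∣ cross u w k
        same-code nothing {u} {w} d d′ = ∣-combine₂ (w (prev k)) (- u (prev k))
          (identity (u (next k)) (u (prev k)) (w (next k)) (w (prev k))) d d′
          where
          identity : ∀ a b c d → a * d - b * c ≡ d * a + - b * c
          identity = solve-∀
        same-code (just r) {u} {w} d d′ = ∣-combine₂ (u (next k)) (- w (next k))
          (identity (u (next k)) (u (prev k)) (w (next k)) (w (prev k)) r) d′ d
          where
          identity : ∀ a b c d r → a * d - b * c ≡ a * (d - r * c) + - c * (b - r * a)
          identity = solve-∀
        spread₁ : ∀ a b c u v w x y z → a * (w * x - u * z) ≡ w * (a * x + b * y + c * z) + - z *
          (a * u + b * v + c * w) + b * (v * z - w * y)
        spread₁ = solve-∀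
        spread₂ : ∀ a b c u v w x y z → a * (u * y - v * x) ≡ - v * (a * x + b * y + c * z) + y *
          (a * u + b * v + c * w) + c * (v * z - w * y)
        spread₂ = solve-∀
        spread₀ : ∀ a b c u v w x y z → ¬ + q ∣ a → + q ∣ a * u + b * v + c * w → + q ∣ a * x + b * y + c * z
          → + q ∣ v * z - w * y →
                  (+ q ∣ w * x - u * z) × (+ q ∣ u * y - v * x)
        spread₀ a b c u v w x y z n d d′ m =
          prime-cancel pr a _ n (∣-combine₃ w (- z) b (spread₁ a b c u v w x y z) d′ d m) ,
          prime-cancel pr a _ n (∣-combine₃ (- v) y c (spread₂ a b c u v w x y z) d′ d m)
        spread : ∀ k {g u w} → ¬ + q ∣ g k → + q ∣ dot g u → + q ∣ dot g w → + q ∣ cross u w k → Parallel u w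
        spread 0F {g} {u} {w} n d d′ m =
          let m₁ , m₂ = spread₀ (g i0) (g i1) (g i2) (u i0) (u i1) (u i2) (w i0) (w i1) (w i2) n d d′ m in
          λ { 0F → m ; 1F → m₁ ; 2F → m₂ }
        spread 1F {g} {u} {w} n d d′ m =
          let m₁ , m₂ = spread₀ (g i1) (g i2) (g i0) (u i1) (u i2) (u i0) (w i1) (w i2) (w i0) n
                          (∣-resp-≡ (+-rotateˡ (g i0 * u i0) (g i1 * u i1) (g i2 * u i2)) d)
                            (∣-resp-≡ (+-rotateˡ (g i0 * w i0) (g i1 * w i1) (g i2 * w i2)) d′) m in
          λ { 1F → m ; 2F → m₁ ; 0F → m₂ }
        spread 2F {g} {u} {w} n d d′ m =
          let m₁ , m₂ = spread₀ (g i2) (g i0) (g i1) (u i2) (u i0) (u i1) (w i2) (w i0) (w i1) n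
                          (∣-resp-≡ (+-rotateʳ (g i0 * u i0) (g i1 * u i1) (g i2 * u i2)) d)
                            (∣-resp-≡ (+-rotateʳ (g i0 * w i0) (g i1 * w i1) (g i2 * w i2)) d′) m in
          λ { 2F → m ; 0F → m₁ ; 1F → m₂ }

-- Fixed flags

module _ where
  open import Data.Integer.Base using (_+_; _*_; _-_; -_)

  adj-cong : ∀ {g h} → MatEq g h → ∀ i j → adj g i j ≡ adj h i j
  adj-cong eq i j = cong₂ _-_ (cong₂ _*_ (eq _ _) (eq _ _)) (cong₂ _*_ (eq _ _) (eq _ _))

  dot-∸scalar : ∀ g α v a → dot ((g ∸scalar α) a) v ≡ (g ·ᵥ v) a - α * v a
  dot-∸scalar g α v a = trans
    (identity (g a i0) (g a i1) (g a i2) (idMat a i0) (idMat a i1) (idMat a i2) (v i0) (v i1) (v i2) α)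
    (cong (λ z → (g ·ᵥ v) a - α * z) (sum3-idˡ v a))
    where
    identity : ∀ a b c d e f u v w x →
      (a - x * d) * u + (b - x * e) * v + (c - x * f) * w ≡ a * u + b * v + c * w - x * (d * u + e * v + f * w)
    identity = solve-∀

  dot-∸scalarᵀ : ∀ g α v b → dot (transpose (g ∸scalar α) b) v ≡ dot v (column g b) - α * v b
  dot-∸scalarᵀ g α v b = trans
    (identity (g i0 b) (g i1 b) (g i2 b) (idMat i0 b) (idMat i1 b) (idMat i2 b) (v i0) (v i1) (v i2) α)
    (cong (λ z → dot v (column g b) - α * z) (sum3-idʳ v b))
    where
    identity : ∀ a b c d e f u v w x →
      (a - x * d) * u + (b - x * e) * v + (c - x * f) * w ≡ u * a + v * b + w * c - x * (u * d + v * e + w * f)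
    identity = solve-∀

  -- This is `adj N` applied to N v. A kernel vector modulo q that is nonzero therefore forces q to
  -- divide the determinant.
  det-kills : ∀ N v a → det3 N * v a ≡ sum3 λ k → adj N a k * dot (N k) v
  det-kills N v a = begin
    det3 N * v a                                 ≡⟨ cong (det3 N *_) (sum3-idˡ v a) ⟨
    det3 N * sum3 (λ k → idMat a k * v k)        ≡⟨ identity (det3 N) (idMat a i0) (idMat a i1) (idMat a i2) (v i0)
      (v i1) (v i2) ⟩
    sum3 (λ k → det3 N * idMat a k * v k)        ≡⟨ sum3-cong (λ k → cong (_* v k) (sym (adj-· N a k))) ⟩
    ((adj N ·ₘ N) ·ₘ λ k _ → v k) a i0           ≡⟨ ·ₘ-assoc (adj N) N (λ k _ → v k) a i0 ⟩
    sum3 (λ k → adj N a k * dot (N k) v)         ∎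
    where
    open ≡-Reasoning
    identity : ∀ m a b c x y z → m * (a * x + b * y + c * z) ≡ m * a * x + m * b * y + m * c * z
    identity = solve-∀

  module _ {q : ℕ} (pr : Prime q) where

    flagLine flagPlane : FlagRep q → Vec3
    flagLine ((v , _) , _) = v
    flagPlane ((v , w) , _) = cross v w

    DistinctFlags : FlagRep q → FlagRep q → Set
    DistinctFlags x y = ¬ SameFlag q (proj₁ x) (proj₁ y)

    flagLine-nonzero : ∀ x → NonzeroMod pr (flagLine x)
    flagLine-nonzero ((v , w) , indep) with nonzeroMod? pr v
    ... | inj₂ n = n
    ... | inj₁ z = contradiction (∣ᵤ⇒∣ (proj₁ (indep 1ℤ 0ℤ λ i → ∣⇒∣ᵤ (∣-combine₁ 1ℤ (identity (v i) (w i)) (z i)))))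
      (prime-∤-1 pr)
      where
      identity : ∀ a b → 1ℤ * a + 0ℤ * b - 0ℤ ≡ 1ℤ * a
      identity = solve-∀

    flagPlane-nonzero : ∀ x → NonzeroMod pr (flagPlane x)
    flagPlane-nonzero x@((v , w) , indep) with nonzeroMod? pr (cross v w)
    ... | inj₂ n = n
    ... | inj₁ z = let i , n = flagLine-nonzero x in
      contradiction (∣-resp-≡ (identity′ (v i))
        (∣ᵤ⇒∣ (proj₂ (indep (- w i) (v i) λ t → ∣⇒∣ᵤ (∣-resp-≡ (identity (v i) (v t) (w i) (w t))
        (parallel-minor pr {v} {w} z i t)))))) n
      where
      identity : ∀ a b c d → - c * b + a * d - 0ℤ ≡ a * d - b * c
      identity = solve-∀
      identity′ : ∀ a → a ≡ a - 0ℤ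
      identity′ = solve-∀

    flag-incident : ∀ x → dot (flagPlane x) (flagLine x) ≡ 0ℤ
    flag-incident ((v , w) , _) = trans (dot-comm (cross v w) v) (dot-crossˡ v w)

    parallel⇒inSpan₁ : ∀ {u v} → NonzeroMod pr v → Parallel pr u v → InSpan1 q u v
    parallel⇒inSpan₁ {u} {v} n p = let c , d = parallel-scalar pr {u} {v} n p in c , λ i → ∣⇒∣ᵤ (d i)

    -- `cramer` divided by a component of `cross v w` that is invertible modulo q.
    orthogonal⇒inSpan₂ : ∀ {x v w} → NonzeroMod pr (cross v w) → + q ∣ dot x (cross v w) → InSpan2 q x v w
    orthogonal⇒inSpan₂ {x} {v} {w} (k , n) o =
      let inv , d = prime-inverse pr (cross v w k) n in
      inv * cross x w k , inv * cross v x k , λ t → ∣⇒∣ᵤ (∣-combine₂ (- x t) (inv * idMat k t)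
        (trans (identity (x t) (v t) (w t) (cross v w k) inv (cross x w k) (cross v x k))
          (trans (cong (λ z → - x t * (cross v w k * inv - 1ℤ) + inv * (z - (cross x w k * v t + cross v x k * w t)))
            (cramer x v w k t))
            (identity′ (- x t * (cross v w k * inv - 1ℤ)) inv (cross x w k * v t + cross v x k * w t)
              (dot x (cross v w)) (idMat k t))))
        d o)
      where
      identity : ∀ x v w f c a b → x - (c * a * v + c * b * w) ≡ - x * (f * c - 1ℤ) + c * (f * x - (a * v + b * w))
      identity = solve-∀
      identity′ : ∀ s c z d e → s + c * (z + d * e - z) ≡ s + c * e * d
      identity′ = solve-∀

    parallel⇒sameFlag : ∀ x y → Parallel pr (flagLine x) (flagLine y) → Parallel pr (flagPlane x) (flagPlane y) →
                        SameFlag q (proj₁ x) (proj₁ y)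
    parallel⇒sameFlag x@((v , w) , _) y@((v′ , w′) , _) p p′ =
      (parallel⇒inSpan₁ {v} {v′} (flagLine-nonzero y) p , parallel⇒inSpan₁ {v′} {v} (flagLine-nonzero x)
        (parallel-sym pr {v} {v′} p)) ,
      (inside x y v p′ (dot-crossˡ v w) , inside x y w p′ (dot-crossʳ v w)) ,
      (inside y x v′ p″ (dot-crossˡ v′ w′) , inside y x w′ p″ (dot-crossʳ v′ w′))
      where
      p″ : Parallel pr (flagPlane y) (flagPlane x)
      p″ = parallel-sym pr {flagPlane x} {flagPlane y} p′
      inside : ∀ x y u → Parallel pr (flagPlane x) (flagPlane y) → dot u (flagPlane x) ≡ 0ℤ →
               InSpan2 q u (proj₁ (proj₁ y)) (proj₂ (proj₁ y))
      inside x y u p o = orthogonal⇒inSpan₂ {u} {proj₁ (proj₁ y)} {proj₂ (proj₁ y)} (flagPlane-nonzero y)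
        (parallel-orthogonal pr {flagPlane y} {flagPlane x} {u} (flagPlane-nonzero x) (parallel-sym pr {flagPlane x}
          {flagPlane y} p) (∣-zero o))

    Eigen : Mat3 → Vec3 → ℤ → Set
    Eigen N v κ = ∀ a → + q ∣ dot (N a) v - κ * v a

    -- The number `μ₁` is the eigenvalue of the functional under multiplication by g from the right,
    -- that is, of g on the quotient by the plane of the flag.
    record EigenFlag (g : Mat3) (x : FlagRep q) : Set where
      field
        λ₁ μ₁ : ℤ
        line : ∀ a → + q ∣ (g ·ᵥ flagLine x) a - λ₁ * flagLine x a
        plane : ∀ b → + q ∣ dot (flagPlane x) (column g b) - μ₁ * flagPlane x b

      line-∸scalar : ∀ α → Eigen (g ∸scalar α) (flagLine x) (λ₁ - α)
      line-∸scalar α a = ∣-resp-≡ (trans (cong (λ z → z - (λ₁ - α) * flagLine x a) (dot-∸scalar g α (flagLine x) a))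
        (identity ((g ·ᵥ flagLine x) a) (flagLine x a) α λ₁)) (line a)
        where
        identity : ∀ a b α κ → a - α * b - (κ - α) * b ≡ a - κ * b
        identity = solve-∀

      plane-∸scalar : ∀ α → Eigen (transpose (g ∸scalar α)) (flagPlane x) (μ₁ - α)
      plane-∸scalar α b = ∣-resp-≡
        (trans (cong (λ z → z - (μ₁ - α) * flagPlane x b) (dot-∸scalarᵀ g α (flagPlane x) b))
        (identity (dot (flagPlane x) (column g b)) (flagPlane x b) α μ₁)) (plane b)
        where
        identity : ∀ a b α κ → a - α * b - (κ - α) * b ≡ a - κ * b
        identity = solve-∀

    -- The functional f g annihilates v and w because g maps the plane into itself, so it is a
    -- multiple of f = v × w.
    fixes⇒eigenFlag : ∀ g x → Fixes q g x → EigenFlag g x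
    fixes⇒eigenFlag g x@((v , w) , indep) (((l , le) , _) , ((_ , (a , b , we)) , _)) =
      let m , me = parallel-scalar pr {row} {cross v w} (flagPlane-nonzero x)
            (orthogonal-parallel pr {row} {v} {w} row·v row·w)
      in record { λ₁ = l ; μ₁ = m ; line = λ t → ∣ᵤ⇒∣ (le t) ; plane = me }
      where
      f = cross v w
      row : Vec3
      row b = dot f (column g b)
      associate : ∀ u → dot row u ≡ dot f (g ·ᵥ u)
      associate u = ·ₘ-assoc (λ _ → f) g (λ k _ → u k) i0 i0
      row·v : + q ∣ dot row v
      row·v = ∣-combine₄ (f i0) (f i1) (f i2) l (trans (associate v)
        (trans (identity (f i0) (f i1) (f i2) ((g ·ᵥ v) i0) ((g ·ᵥ v) i1) ((g ·ᵥ v) i2) (v i0) (v i1) (v i2) l) refl))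
        (∣ᵤ⇒∣ (le i0)) (∣ᵤ⇒∣ (le i1)) (∣ᵤ⇒∣ (le i2)) (∣-zero (flag-incident x))
        where
        identity : ∀ a b c u v w x y z k → a * u + b * v + c * w ≡
          a * (u - k * x) + b * (v - k * y) + c * (w - k * z) + k * (a * x + b * y + c * z)
        identity = solve-∀
      row·w : + q ∣ dot row w
      row·w = ∣-combine₄ (f i0) (f i1) (f i2) 1ℤ (trans (associate w)
        (identity (f i0) (f i1) (f i2) ((g ·ᵥ w) i0) ((g ·ᵥ w) i1) ((g ·ᵥ w) i2)
          (a * v i0 + b * w i0) (a * v i1 + b * w i1) (a * v i2 + b * w i2)))
        (∣ᵤ⇒∣ (we i0)) (∣ᵤ⇒∣ (we i1)) (∣ᵤ⇒∣ (we i2))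
        (∣-zero (trans (dot-linear f v w a b) (trans (cong₂ (λ s t → a * s + b * t) (flag-incident x)
          (trans (dot-comm f w) (dot-crossʳ v w))) (zeros a b))))
        where
        identity : ∀ a b c u v w x y z → a * u + b * v + c * w ≡
          a * (u - x) + b * (v - y) + c * (w - z) + 1ℤ * (a * x + b * y + c * z)
        identity = solve-∀
        zeros : ∀ a b → a * 0ℤ + b * 0ℤ ≡ 0ℤ
        zeros = solve-∀

    eigenFlag-cong : ∀ {g h x} → MatEq g h → EigenFlag g x → EigenFlag h x
    eigenFlag-cong {g} {h} {x} eq e = record
      { λ₁ = λ₁ ; μ₁ = μ₁
      ; line = λ a → ∣-resp-≡ (cong (_- λ₁ * flagLine x a) (sum3-cong λ k → cong (_* flagLine x k) (sym (eq a k))))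
        (line a)
      ; plane = λ b → ∣-resp-≡ (cong (_- μ₁ * flagPlane x b) (sum3-cong λ k → cong (flagPlane x k *_) (sym (eq k b))))
        (plane b) }
      where open EigenFlag e

    -- First the line, then the functional, which lies in the plane orthogonal to that line.
    allFlags-bound : Bounded DistinctFlags (λ _ → ⊤) (3 ℕ.* (q ℕ.* q) ℕ.* (suc q ℕ.* 1))
    allFlags-bound = bounded-lines pr flagLine (λ x _ → flagLine-nonzero x) λ x _ →
      bounded-lines-in-plane pr flagPlane (flagLine x) (flagLine-nonzero x)
        (λ y (_ , p) → ∣-resp-≡ (dot-comm (flagLine x) (flagPlane y))
          (parallel-orthogonal pr {flagLine x} {flagLine y} {flagPlane y} (flagLine-nonzero y) p
            (∣-zero (flag-incident y))))
        λ y _ → bounded-one λ { z z′ ((_ , p) , r) ((_ , p′) , r′) ne → ne (parallel⇒sameFlag z z′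
          (parallel-trans pr {flagLine x} {flagLine z} {flagLine z′} (flagLine-nonzero x)
            (parallel-sym pr {flagLine x} {flagLine z} p) p′)
          (parallel-trans pr {flagPlane y} {flagPlane z} {flagPlane z′} (flagPlane-nonzero y)
            (parallel-sym pr {flagPlane y} {flagPlane z} r) r′)) }

    -- Vanishing of all 2 × 2 minors of g - α modulo q: the eigenspace of α contains a plane.
    Eigenplane ScalarMod : Mat3 → ℤ → Set
    Eigenplane g α = ∀ i j → + q ∣ adj (g ∸scalar α) i j
    ScalarMod g α = ∀ i j → + q ∣ (g ∸scalar α) i j

    MinorsVanish : Mat3 → Set
    MinorsVanish N = ∀ a b c d → + q ∣ N a b * N c d - N a d * N c b

    minors-vanish : ∀ N → (∀ i j → + q ∣ adj N i j) → MinorsVanish N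
    minors-vanish N z a b c d = ∣-resp-≡ (identity (N a b) (N c d) (N a d) (N c b)) (parallel-minor pr {N a} {N c}
      (rows a c) b d)
      where
      identity : ∀ x y z w → x * y - z * w ≡ x * y - z * w
      identity x y z w = refl
      refl-rows : ∀ a → Parallel pr (N a) (N a)
      refl-rows a t = ∣-zero (identity′ (N a (next t)) (N a (prev t)))
        where
        identity′ : ∀ x y → x * y - y * x ≡ 0ℤ
        identity′ = solve-∀
      rows : ∀ a c → Parallel pr (N a) (N c)
      rows 0F 0F = refl-rows 0F
      rows 0F 1F t = z t 2F
      rows 0F 2F = parallel-sym pr {N 2F} {N 0F} λ t → z t 1F
      rows 1F 0F = parallel-sym pr {N 0F} {N 1F} λ t → z t 2F
      rows 1F 1F = refl-rows 1F
      rows 1F 2F t = z t 0F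
      rows 2F 0F t = z t 1F
      rows 2F 1F = parallel-sym pr {N 1F} {N 2F} λ t → z t 0F
      rows 2F 2F = refl-rows 2F

    minors-transpose : ∀ {N} → MinorsVanish N → MinorsVanish (transpose N)
    minors-transpose {N} z a b c d = ∣-resp-≡ (cong (λ w → N b a * N d c - w) (ℤₚ.*-comm (N d a) (N b c))) (z b a d c)

    -- A matrix of rank one maps everything into the line of its j-th column.
    rank-one-eigen : ∀ {N v κ} i j → ¬ + q ∣ N i j → MinorsVanish N → Eigen N v κ → (+ q ∣ dot (N i) v) ⊎ Parallel pr
      (column N j) v
    rank-one-eigen {N} {v} {κ} i j n z e with + q ∣? dot (N i) v
    ... | yes d = inj₁ d
    ... | no G = inj₂ λ t → prime-cancel pr (dot (N i) v) _ G
      (∣-combine₂ (- v (prev t)) (v (next t))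
        (identity (dot (N i) v) (N (next t) j) (N (prev t) j) (v (next t)) (v (prev t)) (N i j * κ)) (scaled (next t))
          (scaled (prev t)))
      where
      identity : ∀ g a b x y c → g * (a * y - b * x) ≡ - y * (c * x - g * a) + x * (c * y - g * b)
      identity = solve-∀
      scaled : ∀ a → + q ∣ N i j * κ * v a - dot (N i) v * N a j
      scaled a = ∣-combine₂ 1ℤ (- N i j) (identity′ (N i j) κ (v a) (dot (N i) v) (N a j) (dot (N a) v))
        (∣-combine₃ (v i0) (v i1) (v i2)
          (identity″ (N a i0) (N a i1) (N a i2) (N i i0) (N i i1) (N i i2) (v i0) (v i1) (v i2) (N i j) (N a j))
          (z a i0 i j) (z a i1 i j) (z a i2 i j)) (e a)
        where
        identity′ : ∀ n κ v g u m → n * κ * v - g * u ≡ 1ℤ * (m * n - u * g) + - n * (m - κ * v)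
        identity′ = solve-∀
        identity″ : ∀ a b c d e f x y z n u → (a * x + b * y + c * z) * n - u * (d * x + e * y + f * z) ≡
          x * (a * n - u * d) + y * (b * n - u * e) + z * (c * n - u * f)
        identity″ = solve-∀

    -- Let N = g - α have image line u and kernel r = 0. A fixed flag has line u and any plane
    -- through it, or a line in the kernel and the kernel as plane, or a line in the kernel other
    -- than u and the plane spanned by both. Each family has at most q + 1 members.
    nonscalarFlags-bound : ∀ {g α} i j → Eigenplane g α → ¬ + q ∣ (g ∸scalar α) i j →
                           Bounded DistinctFlags (EigenFlag g) (suc q ℕ.* 1 ℕ.+ (suc q ℕ.* 1 ℕ.+ suc q ℕ.* 1))
    nonscalarFlags-bound {g} {α} i j plane n =
      bounded-⊎ {Q = λ x → Parallel pr u (flagLine x)}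
        {O = λ x → (+ q ∣ dot r (flagLine x)) × (¬ Parallel pr u (flagLine x)) × EigenFlag g x} classify₁
        (bounded-lines-in-plane pr flagPlane u (j-nonzero)
          (λ x p → ∣-resp-≡ (dot-comm u (flagPlane x)) (parallel-orthogonal pr {u} {flagLine x} {flagPlane x}
            (flagLine-nonzero x) p (∣-zero (flag-incident x))))
          λ y _ → bounded-one λ { z z′ (p , s) (p′ , s′) ne → ne (parallel⇒sameFlag z z′
            (parallel-trans pr {u} {flagLine z} {flagLine z′} j-nonzero (parallel-sym pr {u} {flagLine z} p) p′)
              (planes y z z′ s s′)) })
        (bounded-⊎ {Q = λ x → (+ q ∣ dot r (flagLine x)) × Parallel pr r (flagPlane x)}
          {O = λ x → (+ q ∣ dot r (flagLine x)) × (¬ Parallel pr u (flagLine x)) ×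
            (+ q ∣ dot u (flagPlane x))} classify₂
          (bounded-lines-in-plane pr flagLine r i-nonzero (λ x (d , _) → d)
            λ y _ → bounded-one λ { z z′ ((_ , p) , s) ((_ , p′) , s′) ne → ne
              (parallel⇒sameFlag z z′ (lines y z z′ s s′)
              (parallel-trans pr {r} {flagPlane z} {flagPlane z′} i-nonzero (parallel-sym pr {r} {flagPlane z} p) p′))
                })
          (bounded-lines-in-plane pr flagLine r i-nonzero (λ x (d , _) → d)
            λ y _ → bounded-one λ { z z′ ((_ , np , o) , s) ((_ , _ , o′) , s′) ne → ne
              (parallel⇒sameFlag z z′ (lines y z z′ s s′)
              (let m = determined z z (flagLine-nonzero z) o (reflexive z)
                   m′ = determined z z′ (flagLine-nonzero z′) o′ (lines y z z′ s s′)
                   c = cross u (flagLine z)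
               in parallel-trans pr {c} {flagPlane z} {flagPlane z′} (cross-nonzero z np) m
                 (parallel-sym pr {flagPlane z′} {c} m′))) }))
      where
      N = g ∸scalar α
      u = column N j
      r = N i
      z₀ = minors-vanish N plane
      j-nonzero : NonzeroMod pr u
      j-nonzero = i , n
      i-nonzero : NonzeroMod pr r
      i-nonzero = j , n
      lines : ∀ y z z′ → Parallel pr (flagLine y) (flagLine z) → Parallel pr (flagLine y) (flagLine z′) → Parallel pr
        (flagLine z) (flagLine z′)
      lines y z z′ p p′ = parallel-trans pr {flagLine y} {flagLine z} {flagLine z′} (flagLine-nonzero y)
        (parallel-sym pr {flagLine y} {flagLine z} p) p′
      planes : ∀ y z z′ → Parallel pr (flagPlane y) (flagPlane z) → Parallel pr (flagPlane y) (flagPlane z′)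
        → Parallel pr (flagPlane z) (flagPlane z′)
      planes y z z′ p p′ = parallel-trans pr {flagPlane y} {flagPlane z} {flagPlane z′} (flagPlane-nonzero y)
        (parallel-sym pr {flagPlane y} {flagPlane z} p) p′
      reflexive : ∀ z → Parallel pr (flagLine z) (flagLine z)
      reflexive z = parallel-trans pr {flagLine z} {flagLine z} {flagLine z} (flagLine-nonzero z) self self
        where
        self : Parallel pr (flagLine z) (flagLine z)
        self t = ∣-zero (identity (flagLine z (next t)) (flagLine z (prev t)))
          where
          identity : ∀ x y → x * y - y * x ≡ 0ℤ
          identity = solve-∀
      determined : ∀ z z′ → NonzeroMod pr (flagLine z′) → + q ∣ dot u (flagPlane z′) → Parallel pr (flagLine z)
        (flagLine z′) →
                   Parallel pr (flagPlane z′) (cross u (flagLine z))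
      determined z z′ nz o p = orthogonal-parallel pr {flagPlane z′} {u} {flagLine z}
        (∣-resp-≡ (dot-comm (flagPlane z′) u) o)
        (parallel-orthogonal pr {flagLine z} {flagLine z′} {flagPlane z′} nz p (∣-zero (flag-incident z′)))
      cross-nonzero : ∀ z → ¬ Parallel pr u (flagLine z) → NonzeroMod pr (cross u (flagLine z))
      cross-nonzero z np with nonzeroMod? pr (cross u (flagLine z))
      ... | inj₁ p = contradiction p np
      ... | inj₂ nz = nz
      parallel? : ∀ v → Parallel pr u v ⊎ ¬ Parallel pr u v
      parallel? v with nonzeroMod? pr (cross u v)
      ... | inj₁ p = inj₁ p
      ... | inj₂ (t , nt) = inj₂ λ p → nt (p t)
      classify₁ : ∀ x → EigenFlag g x → Parallel pr u (flagLine x) ⊎ ((+ q ∣ dot r (flagLine x)) ×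
        (¬ Parallel pr u (flagLine x)) × EigenFlag g x)
      classify₁ x e = decide (parallel? (flagLine x)) (rank-one-eigen {N} {flagLine x} {EigenFlag.λ₁ e - α} i j n z₀
        (EigenFlag.line-∸scalar e α))
        where
        decide : ∀ {A B : Set} → A ⊎ ¬ A → B ⊎ A → A ⊎ (B × ¬ A × EigenFlag g x)
        decide (inj₁ p) _ = inj₁ p
        decide (inj₂ np) (inj₁ d) = inj₂ (d , np , e)
        decide (inj₂ np) (inj₂ p) = inj₁ p
      classify₂ : ∀ x → (+ q ∣ dot r (flagLine x)) × (¬ Parallel pr u (flagLine x)) × EigenFlag g x →
                  ((+ q ∣ dot r (flagLine x)) × Parallel pr r (flagPlane x)) ⊎ ((+ q ∣ dot r (flagLine x)) ×
                    (¬ Parallel pr u (flagLine x)) × (+ q ∣ dot u (flagPlane x)))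
      classify₂ x (d , np , e) = decide d np (rank-one-eigen {transpose N} {flagPlane x} {EigenFlag.μ₁ e - α} j i n
        (minors-transpose {N} z₀) (EigenFlag.plane-∸scalar e α))
        where
        decide : ∀ {A B C D : Set} → A → B → C ⊎ D → (A × D) ⊎ (A × B × C)
        decide a b (inj₁ c) = inj₂ (a , b , c)
        decide a b (inj₂ d) = inj₁ (a , d)

    eigenvalue-root : ∀ {g v κ} → InSL3 g → NonzeroMod pr v → Eigen (g ∸scalar κ) v 0ℤ →
                      + q ∣ κ * κ * κ + - tr g * (κ * κ) + tr (adj g) * κ + -1ℤ
    eigenvalue-root {g} {v} {κ} d≡1 (a , n) e = ∣-combine₁ -1ℤ
      (trans (identity κ (tr g) (tr (adj g)))
        (cong (-1ℤ *_) (trans (cong (_- (κ * κ * κ - tr g * (κ * κ) + tr (adj g) * κ)) (sym d≡1))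
        (sym (char-poly g κ)))))
      (prime-cancel pr (v a) _ n (∣-combine₃ (adj N a i0) (adj N a i1) (adj N a i2)
        (trans (ℤₚ.*-comm (v a) (det3 N)) (det-kills N v a)) (e′ i0) (e′ i1) (e′ i2)))
      where
      N = g ∸scalar κ
      e′ : ∀ a → + q ∣ dot (N a) v
      e′ a = ∣-resp-≡ (identity′ (dot (N a) v) (v a)) (e a)
        where
        identity′ : ∀ x y → x ≡ x - 0ℤ * y
        identity′ = solve-∀
      identity : ∀ x t s → x * x * x + - t * (x * x) + s * x + -1ℤ ≡ -1ℤ * (1ℤ - (x * x * x - t * (x * x) + s * x))
      identity = solve-∀

    -- With a nonvanishing minor, the kernel is spanned by the cross product of the two rows that
    -- enter it.
    rank-two-kernel : ∀ {N v w} i j → ¬ + q ∣ adj N i j → Eigen N v 0ℤ → Eigen N w 0ℤ → Parallel pr v w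
    rank-two-kernel {N} {v} {w} i j n e e′ = parallel-trans pr {c} {v} {w} (i , n) (spanned v e)
      (parallel-sym pr {w} {c} (spanned w e′))
      where
      c = cross (N (next j)) (N (prev j))
      spanned : ∀ v → Eigen N v 0ℤ → Parallel pr v c
      spanned v e = orthogonal-parallel pr {v} {N (next j)} {N (prev j)} (at (next j)) (at (prev j))
        where
        at : ∀ k → + q ∣ dot v (N k)
        at k = ∣-resp-≡ (trans (dot-comm v (N k)) (identity (dot (N k) v) (v k))) (e k)
          where
          identity : ∀ x y → x ≡ x - 0ℤ * y
          identity = solve-∀

    congruent? : ∀ x y → Dec (+ q ∣ x - y)
    congruent? x y = + q ∣? x - y

    -- The eigenvalues of the line and of the functional are roots of a cubic modulo q, at most
    -- three classes each. Every eigenspace is a line, so the two classes determine the flag.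
    regularFlags-bound : ∀ {g} → InSL3 g → (∀ α → ∃[ i ] ∃[ j ] ¬ + q ∣ adj (g ∸scalar α) i j) →
                         Bounded DistinctFlags (EigenFlag g) (3 ℕ.* (3 ℕ.* 1))
    regularFlags-bound {g} d≡1 regular = bounded-⊆ (λ x e → (EigenFlag.λ₁ e , EigenFlag.μ₁ e) , e , refl , refl)
      (bounded-choose {Q = Marked}
      (bounded-fiber {P = λ (x , c) → Marked x c} {_~_ = λ x y → + q ∣ x - y} (λ (x , l , m) → l) congruent?
        (cubic-roots pr (- tr g) (tr (adj g)) -1ℤ)
        (λ { (x , l , m) (e , refl , refl) → eigenvalue-root {g} {flagLine x} {EigenFlag.λ₁ e} d≡1
          (flagLine-nonzero x) (line₀ e) })
        λ (x₀ , l₀ , _) _ → bounded-fiber {P = λ (x , l , m) → Marked x (l , m) × (+ q ∣ l₀ - l)}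
          {_~_ = λ x y → + q ∣ x - y}
          (λ (x , l , m) → m) congruent? (cubic-roots pr (- tr (transpose g)) (tr (adj (transpose g))) -1ℤ)
          (λ { (x , l , m) ((e , refl , refl) , _) → eigenvalue-root {transpose g} {flagPlane x} {EigenFlag.μ₁ e}
            (trans (det-transpose g) d≡1) (flagPlane-nonzero x)
             (λ a → ∣-resp-≡ (cong (λ z → z - 0ℤ * flagPlane x a)
               (sum3-cong λ k → cong (λ w → (g k a - EigenFlag.μ₁ e * w) * flagPlane x k) (idMat-sym a k)))
               (plane₀ e a)) })
          λ (x₁ , _ , m₀) _ → bounded-one λ { (z , _ , _) (z′ , _ , _) (((e , refl , refl) , l~) , m~)
            (((e′ , refl , refl) , l~′) , m~′) ne →
            ne (parallel⇒sameFlag z z′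
              (let i , j , n = regular l₀ in rank-two-kernel {g ∸scalar l₀} {flagLine z} {flagLine z′} i j n
                     (line-at {l = l₀} e l~) (line-at {l = l₀} e′ l~′))
              (let i , j , n = regular m₀ in rank-two-kernel {transpose (g ∸scalar m₀)} {flagPlane z}
                     {flagPlane z′} j i
                 (λ d → n (∣-resp-≡ (sym (transpose-adj (g ∸scalar m₀) j i)) d)) (plane-at {l = m₀} e m~)
                   (plane-at {l = m₀} e′ m~′))) }))
      where
      Marked : FlagRep q → ℤ × ℤ → Set
      Marked x (l , m) = Σ (EigenFlag g x) λ e → (EigenFlag.λ₁ e ≡ l) × (EigenFlag.μ₁ e ≡ m)
      line-at : ∀ {x l} (e : EigenFlag g x) → + q ∣ l - EigenFlag.λ₁ e → Eigen (g ∸scalar l) (flagLine x) 0ℤ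
      line-at {x} {l} e d a = ∣-combine₂ 1ℤ (- flagLine x a)
        (identity (dot ((g ∸scalar l) a) (flagLine x)) (flagLine x a) (EigenFlag.λ₁ e) l)
          (EigenFlag.line-∸scalar e l a) d
        where
        identity : ∀ a v m l → a - 0ℤ * v ≡ 1ℤ * (a - (m - l) * v) + - v * (l - m)
        identity = solve-∀
      plane-at : ∀ {x l} (e : EigenFlag g x) → + q ∣ l - EigenFlag.μ₁ e → Eigen (transpose (g ∸scalar l))
        (flagPlane x) 0ℤ
      plane-at {x} {l} e d a = ∣-combine₂ 1ℤ (- flagPlane x a)
        (identity (dot (transpose (g ∸scalar l) a) (flagPlane x)) (flagPlane x a) (EigenFlag.μ₁ e) l)
          (EigenFlag.plane-∸scalar e l a) d
        where
        identity : ∀ a v m l → a - 0ℤ * v ≡ 1ℤ * (a - (m - l) * v) + - v * (l - m)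
        identity = solve-∀
      line₀ : ∀ {x} (e : EigenFlag g x) → Eigen (g ∸scalar EigenFlag.λ₁ e) (flagLine x) 0ℤ
      line₀ e = line-at {l = EigenFlag.λ₁ e} e (∣-zero (ℤₚ.+-inverseʳ (EigenFlag.λ₁ e)))
      plane₀ : ∀ {x} (e : EigenFlag g x) → Eigen (transpose (g ∸scalar EigenFlag.μ₁ e)) (flagPlane x) 0ℤ
      plane₀ e = plane-at {l = EigenFlag.μ₁ e} e (∣-zero (ℤₚ.+-inverseʳ (EigenFlag.μ₁ e)))

-- Matrices with given diagonal and given diagonal of the inverse

module _ where
  open import Data.Integer.Base using (_+_; _*_; _-_; -_)

  RowReducible Reducible : Mat3 → Set
  RowReducible g = g i0 i1 ≡ 0ℤ × g i0 i2 ≡ 0ℤ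
  Reducible g = ∃[ t ] ((g t (next t) ≡ 0ℤ × g t (prev t) ≡ 0ℤ) ⊎ (g (next t) t ≡ 0ℤ × g (prev t) t ≡ 0ℤ))

  -- An entry is zero, or divides its product p with the mirrored entry, or, when the mirrored entry
  -- vanishes, divides the sum D of the 3-cycles.
  entryCodes : ℕ → ℤ → ℤ → List ℤ
  entryCodes X p D = 0ℤ ∷ signedDivisors X p ++ signedDivisors X D

  entryCodes-length : ∀ X p D → length (entryCodes X p D) ℕ.≤ 5 ℕ.* maxDivisors X
  entryCodes-length X p D = begin
    suc (length (signedDivisors X p ++ signedDivisors X D))  ≡⟨ cong suc (length-++ (signedDivisors X p)) ⟩
    suc (length (signedDivisors X p) ℕ.+ length (signedDivisors X D))
      ≤⟨ ℕₚ.+-mono-≤ (maxDivisors≥1 X) (ℕₚ.+-mono-≤ (signedDivisors-length X p) (signedDivisors-length X D)) ⟩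
    Δ ℕ.+ (2 ℕ.* Δ ℕ.+ 2 ℕ.* Δ)                              ≡⟨ identity Δ ⟩
    5 ℕ.* Δ                                                  ∎
    where
    open ℕₚ.≤-Reasoning
    Δ = maxDivisors X
    identity : ∀ d → d ℕ.+ (2 ℕ.* d ℕ.+ 2 ℕ.* d) ≡ 5 ℕ.* d
    identity = solveℕ-∀

  -- Applied with x = g i j, y = g j i, m = g j k, m′ = g k i and D the sum of the two 3-cycles; the exceptional cases
  -- say that row j or column i of g vanishes off the diagonal.
  entry-code : ∀ {X} x y m m′ n D → D ≡ x * (m * m′) + y * n → ∣ x * y ∣ ℕ.≤ X → ∣ D ∣ ℕ.≤ X →
               x ∈ entryCodes X (x * y) D ⊎ (y ≡ 0ℤ × m ≡ 0ℤ) ⊎ (y ≡ 0ℤ × m′ ≡ 0ℤ)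
  entry-code {X} x y m m′ n D eq xy≤ D≤ with x ℤₚ.≟ 0ℤ | y ℤₚ.≟ 0ℤ
  ... | yes refl | _ = inj₁ (here refl)
  ... | no x≢0 | no y≢0 = inj₁ (there (∈-++⁺ˡ (∈-signedDivisors xy≤ (ℤ∣.∣m⇒∣m*n y ℤ∣.∣-refl)
          λ e → case (ℤₚ.i*j≡0⇒i≡0∨j≡0 x e))))
    where
    case : ¬ (x ≡ 0ℤ ⊎ y ≡ 0ℤ)
    case (inj₁ e) = x≢0 e
    case (inj₂ e) = y≢0 e
  ... | no x≢0 | yes refl with D ℤₚ.≟ 0ℤ
  ... | no D≢0 = inj₁ (there (∈-++⁺ʳ (signedDivisors X (x * 0ℤ)) (∈-signedDivisors D≤
          (∣-resp-≡ (trans eq (ℤₚ.+-identityʳ _)) (ℤ∣.∣m⇒∣m*n (m * m′) ℤ∣.∣-refl)) D≢0)))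
  ... | yes D≡0 with ℤₚ.i*j≡0⇒i≡0∨j≡0 x (trans (sym (trans eq (ℤₚ.+-identityʳ _))) D≡0)
  ... | inj₁ x≡0 = contradiction x≡0 x≢0
  ... | inj₂ mm≡0 with ℤₚ.i*j≡0⇒i≡0∨j≡0 m mm≡0
  ... | inj₁ m≡0 = inj₂ (inj₁ (refl , m≡0))
  ... | inj₂ m′≡0 = inj₂ (inj₂ (refl , m′≡0))

  cycles : Mat3 → ℤ
  cycles g = g i0 i1 * g i1 i2 * g i2 i0 + g i0 i2 * g i2 i1 * g i1 i0

  module _ {X : ℕ} (d e : Fin 3 → ℤ) where

    private
      Δ = maxDivisors X
      -- The sum of the two 3-cycles in the Leibniz expansion of a determinant equal to 1, after the
      -- products of mirrored entries have been expressed by `d` and `e`.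
      D : ℤ
      D = 1ℤ + + 2 * (d i0 * d i1 * d i2) - (d i0 * e i0 + d i1 * e i1 + d i2 * e i2)
      p : Fin 3 → ℤ
      p t = d (next t) * d (prev t) - e t

    record KnownDiagonal (g : Mat3) : Set where
      field
        det≡1 : InSL3 g
        irreducible : ¬ Reducible g
        diagonal : ∀ t → g t t ≡ d t
        inverse-diagonal : ∀ t → adj g t t ≡ e t
        products≤ : ∀ i j → ∣ g i j * g j i ∣ ℕ.≤ X
        cycles≤ : ∣ cycles g ∣ ℕ.≤ X

    open KnownDiagonal

    private
      product≡ : ∀ {g} → KnownDiagonal g → ∀ t → g (next t) (prev t) * g (prev t) (next t) ≡ p t
      product≡ {g} k t = begin
        b * c                     ≡⟨ identity a b c a′ ⟩
        a * a′ - (a * a′ - b * c) ≡⟨ cong₂ _-_ (cong₂ _*_ (diagonal k _) (diagonal k _)) (inverse-diagonal k t) ⟩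
        p t                       ∎
        where
        open ≡-Reasoning
        a = g (next t) (next t)
        b = g (next t) (prev t)
        c = g (prev t) (next t)
        a′ = g (prev t) (prev t)
        identity : ∀ a b c d → b * c ≡ a * d - (a * d - b * c)
        identity = solve-∀

      cycles≡ : ∀ {g} → KnownDiagonal g → cycles g ≡ D
      cycles≡ {g} k = begin
        cycles g  ≡⟨ identity (g i0 i0) (g i0 i1) (g i0 i2) (g i1 i0) (g i1 i1) (g i1 i2) (g i2 i0) (g i2 i1)
          (g i2 i2) ⟩
        det3 g + + 2 * (g i0 i0 * g i1 i1 * g i2 i2) - (g i0 i0 * adj g i0 i0 + g i1 i1 * adj g i1 i1 + g i2 i2
          * adj g i2 i2)
                  ≡⟨ cong₂ (λ s t → s + + 2 * t - (g i0 i0 * adj g i0 i0 + g i1 i1 * adj g i1 i1 + g i2 i2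
                    * adj g i2 i2)) (det≡1 k) (cong₂ _*_ (cong₂ _*_ (diagonal k i0) (diagonal k i1))
                    (diagonal k i2)) ⟩
        1ℤ + + 2 * (d i0 * d i1 * d i2) - (g i0 i0 * adj g i0 i0 + g i1 i1 * adj g i1 i1 + g i2 i2 * adj g i2 i2)
                  ≡⟨ cong (λ z → 1ℤ + + 2 * (d i0 * d i1 * d i2) - z) (cong₂ _+_ (cong₂ _+_ (term i0) (term i1))
                    (term i2)) ⟩
        D         ∎
        where
        open ≡-Reasoning
        term : ∀ t → g t t * adj g t t ≡ d t * e t
        term t = cong₂ _*_ (diagonal k t) (inverse-diagonal k t)
        identity : ∀ a b c d e f g h i → b * f * g + c * h * d ≡
          (a * (e * i - f * h) - b * (d * i - f * g) + c * (d * h - e * g)) + + 2 * (a * e * i)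
          - (a * (e * i - f * h) + e * (i * a - g * c) + i * (a * e - b * d))
        identity = solve-∀

      cycles-upper : ∀ g t → cycles g ≡ g (next t) (prev t) * (g (prev t) t * g t (next t)) + g (prev t) (next t) *
        (g (next t) t * g t (prev t))
      cycles-upper g = λ { 0F → identity₀ (g i0 i1) (g i1 i2) (g i2 i0) (g i0 i2) (g i2 i1) (g i1 i0)
                         ; 1F → identity₁ (g i0 i1) (g i1 i2) (g i2 i0) (g i0 i2) (g i2 i1) (g i1 i0)
                         ; 2F → identity₂ (g i0 i1) (g i1 i2) (g i2 i0) (g i0 i2) (g i2 i1) (g i1 i0) }
        where
        identity₀ : ∀ a b c x y z → a * b * c + x * y * z ≡ b * (c * a) + y * (z * x)
        identity₀ = solve-∀
        identity₁ : ∀ a b c x y z → a * b * c + x * y * z ≡ c * (a * b) + x * (y * z)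
        identity₁ = solve-∀
        identity₂ : ∀ a b c x y z → a * b * c + x * y * z ≡ a * (b * c) + z * (x * y)
        identity₂ = solve-∀

      upper-code : ∀ {g} → KnownDiagonal g → ∀ t → g (next t) (prev t) ∈ entryCodes X (p t) D
      upper-code {g} k t with entry-code (g (next t) (prev t)) (g (prev t) (next t)) (g (prev t) t) (g t (next t))
                               (g (next t) t * g t (prev t)) (cycles g) (cycles-upper g t) (products≤ k _ _)
                                 (cycles≤ k)
      ... | inj₁ c = subst₂ (λ s z → g (next t) (prev t) ∈ entryCodes X s z) (product≡ k t) (cycles≡ k) c
      ... | inj₂ (inj₁ (y , m)) = contradiction (row t y m) (irreducible k)
        where
        row : ∀ t → g (prev t) (next t) ≡ 0ℤ → g (prev t) t ≡ 0ℤ → Reducible g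
        row 0F y m = 2F , inj₁ (m , y)
        row 1F y m = 0F , inj₁ (m , y)
        row 2F y m = 1F , inj₁ (m , y)
      ... | inj₂ (inj₂ (y , m)) = contradiction (col t y m) (irreducible k)
        where
        col : ∀ t → g (prev t) (next t) ≡ 0ℤ → g t (next t) ≡ 0ℤ → Reducible g
        col 0F y m = 1F , inj₂ (y , m)
        col 1F y m = 2F , inj₂ (y , m)
        col 2F y m = 0F , inj₂ (y , m)

      lower-code : ∀ {g} → KnownDiagonal g → ∀ t → g (prev t) (next t) ∈ entryCodes X (p t) D
      lower-code {g} k t with entry-code (g (prev t) (next t)) (g (next t) (prev t)) (g (next t) t) (g t (prev t))
                               (g (prev t) t * g t (next t)) (cycles g)
                                 (trans (cycles-upper g t)
                                 (ℤₚ.+-comm _ (g (prev t) (next t) * (g (next t) t * g t (prev t)))))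
                                 (products≤ k _ _) (cycles≤ k)
      ... | inj₁ c = subst₂ (λ s z → g (prev t) (next t) ∈ entryCodes X s z)
        (trans (ℤₚ.*-comm (g (prev t) (next t)) _) (product≡ k t)) (cycles≡ k) c
      ... | inj₂ (inj₁ (y , m)) = contradiction (row t y m) (irreducible k)
        where
        row : ∀ t → g (next t) (prev t) ≡ 0ℤ → g (next t) t ≡ 0ℤ → Reducible g
        row 0F y m = 1F , inj₁ (y , m)
        row 1F y m = 2F , inj₁ (y , m)
        row 2F y m = 0F , inj₁ (y , m)
      ... | inj₂ (inj₂ (y , m)) = contradiction (col t y m) (irreducible k)
        where
        col : ∀ t → g (next t) (prev t) ≡ 0ℤ → g t (prev t) ≡ 0ℤ → Reducible g
        col 0F y m = 2F , inj₂ (m , y)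
        col 1F y m = 0F , inj₂ (m , y)
        col 2F y m = 1F , inj₂ (m , y)

    -- Each of the six off-diagonal entries has its own list of at most 5Δ candidates. The
    -- exceptional cases of `entry-code` are excluded by irreducibility.
    knownDiagonal-bound : Bounded DistinctMat KnownDiagonal
      (5 ℕ.* Δ ℕ.* (5 ℕ.* Δ ℕ.* (5 ℕ.* Δ ℕ.* (5 ℕ.* Δ ℕ.* (5 ℕ.* Δ ℕ.* (5 ℕ.* Δ ℕ.* 1))))))
    knownDiagonal-bound =
      bounded-fix-≤ (λ g → g i1 i2) (entryCodes X (p i0) D) (entryCodes-length X (p i0) D) (λ g k → upper-code k i0)
        λ _ →
      bounded-fix-≤ (λ g → g i2 i1) (entryCodes X (p i0) D) (entryCodes-length X (p i0) D)
        (λ g (k , _) → lower-code k i0) λ _ →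
      bounded-fix-≤ (λ g → g i2 i0) (entryCodes X (p i1) D) (entryCodes-length X (p i1) D)
        (λ g ((k , _) , _) → upper-code k i1) λ _ →
      bounded-fix-≤ (λ g → g i0 i2) (entryCodes X (p i1) D) (entryCodes-length X (p i1) D)
        (λ g (((k , _) , _) , _) → lower-code k i1) λ _ →
      bounded-fix-≤ (λ g → g i0 i1) (entryCodes X (p i2) D) (entryCodes-length X (p i2) D)
        (λ g ((((k , _) , _) , _) , _) → upper-code k i2) λ _ →
      bounded-fix-≤ (λ g → g i1 i0) (entryCodes X (p i2) D) (entryCodes-length X (p i2) D)
        (λ g (((((k , _) , _) , _) , _) , _) → lower-code k i2) λ _ →
      bounded-one λ { g h ((((((k , a) , b) , c) , a′) , b′) , c′) ((((((k₁ , a₁) , b₁) , c₁) , a₁′) , b₁′) , c₁′) ne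
        → ne λ
        { 0F 0F → trans (diagonal k i0) (sym (diagonal k₁ i0)) ; 0F 1F → trans b′ (sym b₁′) ; 0F 2F → trans a′
          (sym a₁′)
        ; 1F 0F → trans c′ (sym c₁′) ; 1F 1F → trans (diagonal k i1) (sym (diagonal k₁ i1)) ; 1F 2F → trans a (sym a₁)
        ; 2F 0F → trans c (sym c₁) ; 2F 1F → trans b (sym b₁) ; 2F 2F → trans (diagonal k i2)
          (sym (diagonal k₁ i2)) } }

  -- The six positions of the vanishing row or column are carried to row 0 by cyclic relabelling and
  -- transposition, under which the property has to be stable.
  reducible-cases : ∀ {Pr : Mat3 → Set} {N} → (∀ g → Pr g → Pr (rot g)) → (∀ g → Pr g → Pr (transpose g)) →
                    Bounded DistinctMat (λ g → Pr g × RowReducible g) N →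
                    Bounded DistinctMat (λ g → Pr g × Reducible g) (6 ℕ.* N)
  reducible-cases {Pr} {N} Pr-rot Pr-transpose b = bounded-cover-≤ (λ g (t , s) → Case t s g)
    (cartesianProduct indices (true ∷ false ∷ [])) ℕₚ.≤-refl
    (λ { g (_ , t , inj₁ r) → lose (∈-cartesianProduct⁺ (∈-indices t) true∈) r
       ; g (_ , t , inj₂ r) → lose (∈-cartesianProduct⁺ (∈-indices t) false∈) r })
    λ (t , s) → bounded-⊆ (λ { g ((pr , _) , c) → pr , c }) (rotated t s)
    where
    Case : Fin 3 → Bool → Mat3 → Set
    Case t true g = g t (next t) ≡ 0ℤ × g t (prev t) ≡ 0ℤ
    Case t false g = g (next t) t ≡ 0ℤ × g (prev t) t ≡ 0ℤ
    true∈ : true ∈ true ∷ false ∷ []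
    true∈ = here refl
    false∈ : false ∈ true ∷ false ∷ []
    false∈ = there (here refl)
    unrot : ∀ {g h} → MatEq (rot g) (rot h) → MatEq g h
    unrot eq 0F 0F = eq 2F 2F
    unrot eq 0F 1F = eq 2F 0F
    unrot eq 0F 2F = eq 2F 1F
    unrot eq 1F 0F = eq 0F 2F
    unrot eq 1F 1F = eq 0F 0F
    unrot eq 1F 2F = eq 0F 1F
    unrot eq 2F 0F = eq 1F 2F
    unrot eq 2F 1F = eq 1F 0F
    unrot eq 2F 2F = eq 1F 1F
    row₁ : Bounded DistinctMat (λ g → Pr g × Case 1F true g) N
    row₁ = bounded-map rot (λ g h _ _ ne eq → ne (unrot {g} {h} eq)) (λ g (pr , c) → Pr-rot g pr , c) b
    row₂ : Bounded DistinctMat (λ g → Pr g × Case 2F true g) N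
    row₂ = bounded-map rot (λ g h _ _ ne eq → ne (unrot {g} {h} eq)) (λ g (pr , c) → Pr-rot g pr , c) row₁
    rows : ∀ t → Bounded DistinctMat (λ g → Pr g × Case t true g) N
    rows 0F = b
    rows 1F = row₁
    rows 2F = row₂
    rotated : ∀ t s → Bounded DistinctMat (λ g → Pr g × Case t s g) N
    rotated t true = rows t
    rotated t false = bounded-map transpose (λ g h _ _ ne eq → ne λ i j → eq j i) (λ g (pr , c) → Pr-transpose g pr
      , c) (rows t)

  units : List ℤ
  units = 1ℤ ∷ -1ℤ ∷ []

  unit : ∀ x y → x * y ≡ 1ℤ → x ∈ units × y ≡ x
  unit x y eq with ℕₚ.m*n≡1⇒m≡1 ∣ x ∣ ∣ y ∣ (trans (sym (ℤₚ.abs-* x y)) (cong ∣_∣ eq))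
  unit (+ 1) y eq | refl = here refl , trans (sym (ℤₚ.*-identityˡ y)) eq
  unit -[1+ 0 ] y eq | refl = there (here refl) , trans (identity y) (cong -_ eq)
    where
    identity : ∀ y → y ≡ - (-1ℤ * y)
    identity = solve-∀

  square-unit : ∀ {x} → x ∈ units → x * x ≡ 1ℤ
  square-unit (here refl) = refl
  square-unit (there (here refl)) = refl

  -- Expanding the determinant along row 0 gives e · det(block) = 1. So e = ±1, and the lower block
  -- has determinant e.
  corner : ∀ g → InSL3 g → RowReducible g → g i0 i0 ∈ units × adj g i0 i0 ≡ g i0 i0
  corner g d≡1 (z , z′) = unit (g i0 i0) (adj g i0 i0)
    (trans (identity (g i0 i0) (adj g i0 i0) (adj g i1 i0) (adj g i2 i0))
      (trans (cong₂ (λ s t → g i0 i0 * adj g i0 i0 + s * adj g i1 i0 + t * adj g i2 i0) (sym z) (sym z′))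
        (trans (·-adj g i0 i0) (trans (ℤₚ.*-identityʳ _) d≡1))))
    where
    identity : ∀ a b c d → a * b ≡ a * b + 0ℤ * c + 0ℤ * d
    identity = solve-∀

  module _ {X : ℕ} {Pr : Mat3 → Set} (Kᶜ K¹ Kᵒ : List ℤ) (K² : ℤ → ℤ → List ℤ) {kᶜ k¹ kᵒ k² : ℕ}
    (Kᶜ≤ : length Kᶜ ℕ.≤ kᶜ) (K¹≤ : length K¹ ℕ.≤ k¹) (Kᵒ≤ : length Kᵒ ℕ.≤ kᵒ) (K²≤ : ∀ a b → length (K² a b) ℕ.≤ k²)
    (det≡1 : ∀ g → Pr g → InSL3 g) (g₁₀ : ∀ g → Pr g → g i1 i0 ∈ Kᶜ) (g₂₀ : ∀ g → Pr g → g i2 i0 ∈ Kᶜ)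
    (g₁₁ : ∀ g → Pr g → g i1 i1 ∈ K¹) (g₂₂ : ∀ g → Pr g → RowReducible g → g i2 i2 ∈ K² (g i0 i0) (g i1 i1))
    (g₁₂ : ∀ g → Pr g → g i1 i2 ∈ Kᵒ) (g₂₁ : ∀ g → Pr g → g i2 i1 ∈ Kᵒ)
      (product≤ : ∀ g → Pr g → ∣ g i1 i2 * g i2 i1 ∣ ℕ.≤ X) where

    private
      Δ = maxDivisors X

    private
      product≡ : ∀ g → Pr g → RowReducible g → g i1 i2 * g i2 i1 ≡ g i1 i1 * g i2 i2 - g i0 i0
      product≡ g pr r = trans (identity (g i1 i1) (g i2 i2) (g i1 i2) (g i2 i1)) (cong (λ z → g i1 i1 * g i2 i2 - z)
        (proj₂ (corner g (det≡1 g pr) r)))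
        where
        identity : ∀ a b c d → c * d ≡ a * b - (a * b - c * d)
        identity = solve-∀

      Row : ℤ → ℤ → ℤ → Mat3 → Set
      Row a b c g = (Pr g × RowReducible g) × g i0 i0 ≡ a × g i1 i0 ≡ b × g i2 i0 ≡ c

      same : ∀ {a b c} g h → Row a b c g → Row a b c h → g i1 i1 ≡ h i1 i1 → g i2 i2 ≡ h i2 i2 → g i1 i2 ≡ h i1 i2
        → g i2 i1 ≡ h i2 i1 → MatEq g h
      same g h ((_ , z , z′) , a , b , c) ((_ , y , y′) , a′ , b′ , c′) e₁ e₂ e₃ e₄ = λ
        { 0F 0F → trans a (sym a′) ; 0F 1F → trans z (sym y) ; 0F 2F → trans z′ (sym y′)
        ; 1F 0F → trans b (sym b′) ; 1F 1F → e₁ ; 1F 2F → e₃ ; 2F 0F → trans c (sym c′) ; 2F 1F → e₄ ; 2F 2F → e₂ }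

      generic : ∀ a b c → Bounded DistinctMat (λ g → Row a b c g × g i1 i2 * g i2 i1 ≢ 0ℤ)
        (k¹ ℕ.* (k² ℕ.* (2 ℕ.* Δ ℕ.* (2 ℕ.* Δ ℕ.* 1))))
      generic a b c =
        bounded-fix-≤ (λ g → g i1 i1) K¹ K¹≤ (λ g ((((pr , _) , _)) , _) → g₁₁ g pr) λ x →
        bounded-fix-≤ (λ g → g i2 i2) (K² a x) (K²≤ a x) (λ { g (((((pr , r) , refl , _)) , _) , refl) → g₂₂ g pr r })
          λ y →
        bounded-fix-≤ (λ g → g i1 i2) (signedDivisors X (x * y - a)) (signedDivisors-length X (x * y - a))
          (λ { g ((((((pr , r) , refl , _)) , n) , refl) , refl) → subst (λ z → g i1 i2 ∈ signedDivisors X z)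
            (product≡ g pr r)
            (∈-signedDivisors (product≤ g pr) (ℤ∣.∣m⇒∣m*n (g i2 i1) ℤ∣.∣-refl) n) }) λ z →
        bounded-fix-≤ (λ g → g i2 i1) (signedDivisors X (x * y - a)) (signedDivisors-length X (x * y - a))
          (λ { g (((((((pr , r) , refl , _)) , n) , refl) , refl) , _) → subst (λ z → g i2 i1 ∈ signedDivisors X z)
            (product≡ g pr r)
            (∈-signedDivisors (product≤ g pr) (ℤ∣.∣n⇒∣m*n (g i1 i2) ℤ∣.∣-refl) n) }) λ w →
        bounded-one λ { g h (((((row , _) , e₁) , e₂) , e₃) , e₄) (((((row′ , _) , f₁) , f₂) , f₃) , f₄) ne →
          ne (same g h row row′ (trans e₁ (sym f₁)) (trans e₂ (sym f₂)) (trans e₃ (sym f₃)) (trans e₄ (sym f₄))) }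

      triangular : ∀ a b c → Bounded DistinctMat (λ g → Row a b c g × g i1 i2 * g i2 i1 ≡ 0ℤ)
        (2 ℕ.* (2 ℕ.* (kᵒ ℕ.* 1 ℕ.+ kᵒ ℕ.* 1)))
      triangular a b c =
        bounded-fix (λ g → g i1 i1) units (λ g (((pr , r) , _) , z) → proj₁ (diagonal g pr r z)) λ x →
        bounded-fix (λ g → g i2 i2) units (λ g ((((pr , r) , _) , z) , _) → proj₂ (diagonal g pr r z)) λ y →
        bounded-⊎ {Q = λ g → (Row a b c g × g i1 i1 ≡ x × g i2 i2 ≡ y) × g i1 i2 ≡ 0ℤ}
          {O = λ g → (Row a b c g × g i1 i1 ≡ x × g i2 i2 ≡ y) × g i2 i1 ≡ 0ℤ}
          (λ { g (((row , z) , e) , f) → ×-distrib-⊎ (row , e , f) (ℤₚ.i*j≡0⇒i≡0∨j≡0 (g i1 i2) z) })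
          (bounded-fix-≤ (λ g → g i2 i1) Kᵒ Kᵒ≤ (λ g (((((pr , _) , _)) , _) , _) → g₂₁ g pr) λ w →
            bounded-one λ { g h (((row , e₁ , e₂) , e₃) , e₄) (((row′ , f₁ , f₂) , f₃) , f₄) ne →
              ne (same g h row row′ (trans e₁ (sym f₁)) (trans e₂ (sym f₂)) (trans e₃ (sym f₃))
                (trans e₄ (sym f₄))) })
          (bounded-fix-≤ (λ g → g i1 i2) Kᵒ Kᵒ≤ (λ g (((((pr , _) , _)) , _) , _) → g₁₂ g pr) λ w →
            bounded-one λ { g h (((row , e₁ , e₂) , e₄) , e₃) (((row′ , f₁ , f₂) , f₄) , f₃) ne →
              ne (same g h row row′ (trans e₁ (sym f₁)) (trans e₂ (sym f₂)) (trans e₃ (sym f₃))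
                (trans e₄ (sym f₄))) })
        where
        diagonal : ∀ g → Pr g → RowReducible g → g i1 i2 * g i2 i1 ≡ 0ℤ → g i1 i1 ∈ units × g i2 i2 ∈ units
        diagonal g pr r z = proj₁ (unit (g i1 i1) (g i0 i0 * g i2 i2)
          (trans (identity (g i1 i1) (g i0 i0) (g i2 i2)) eq)) ,
                            proj₁ (unit (g i2 i2) (g i0 i0 * g i1 i1)
                              (trans (identity′ (g i1 i1) (g i0 i0) (g i2 i2)) eq))
          where
          identity : ∀ a e b → a * (e * b) ≡ e * (a * b)
          identity = solve-∀
          identity′ : ∀ a e b → b * (e * a) ≡ e * (a * b)
          identity′ = solve-∀
          eq : g i0 i0 * (g i1 i1 * g i2 i2) ≡ 1ℤ
          eq = trans (cong (g i0 i0 *_) (ℤₚ.i-j≡0⇒i≡j _ (g i0 i0) (trans (sym (product≡ g pr r)) z)))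
            (square-unit (proj₁ (corner g (det≡1 g pr) r)))

    -- The two entries below the corner are free. If g₁₂ g₂₁ ≠ 0, the diagonal of the block
    -- determines this product through the determinant, and its factors cost divisors. If it
    -- vanishes, the diagonal consists of units and one off-diagonal entry remains. The candidate
    -- lists are parameters because the scalar matrices restrict more entries modulo q than the
    -- others.
    rowReducible-bound : Bounded DistinctMat (λ g → Pr g × RowReducible g)
      (2 ℕ.* (kᶜ ℕ.* (kᶜ ℕ.* (k¹ ℕ.* (k² ℕ.* (2 ℕ.* Δ ℕ.* (2 ℕ.* Δ ℕ.* 1))) ℕ.+ 2 ℕ.*
        (2 ℕ.* (kᵒ ℕ.* 1 ℕ.+ kᵒ ℕ.* 1))))))
    rowReducible-bound =
      bounded-fix (λ g → g i0 i0) units (λ g (pr , r) → proj₁ (corner g (det≡1 g pr) r)) λ a →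
      bounded-fix-≤ (λ g → g i1 i0) Kᶜ Kᶜ≤ (λ g ((pr , _) , _) → g₁₀ g pr) λ b →
      bounded-fix-≤ (λ g → g i2 i0) Kᶜ Kᶜ≤ (λ g (((pr , _) , _) , _) → g₂₀ g pr) λ c →
      bounded-⊎ {Q = λ g → Row a b c g × g i1 i2 * g i2 i1 ≢ 0ℤ} {O = λ g → Row a b c g × g i1 i2 * g i2 i1 ≡ 0ℤ}
        (λ g (((p , ea) , eb) , ec) → swap (×-decide (p , ea , eb , ec) (g i1 i2 * g i2 i1 ℤₚ.≟ 0ℤ)))
        (generic a b c) (triangular a b c)

-- Matrices that differ from a scalar by rank at most one modulo q

module _ where
  open import Data.Integer.Base using (_+_; _*_; _-_; -_)

  record Box (A B : ℕ) (g : Mat3) : Set where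
    field
      det≡1 : InSL3 g
      entry≤ : ∀ i j → ∣ g i j ∣ ℕ.≤ A
      inverse-entry≤ : ∀ i j → ∣ adj g i j ∣ ℕ.≤ B

  box-rot : ∀ {A B} g → Box A B g → Box A B (rot g)
  box-rot g b = record { det≡1 = trans (det-rot g) det≡1 ; entry≤ = λ i j → entry≤ _ _ ; inverse-entry≤ = λ i j
    → inverse-entry≤ _ _ }
    where open Box b

  box-transpose : ∀ {A B} g → Box A B g → Box A B (transpose g)
  box-transpose g b = record
    { det≡1 = trans (det-transpose g) det≡1 ; entry≤ = λ i j → entry≤ _ _
    ; inverse-entry≤ = λ i j → subst (λ z → ∣ z ∣ ℕ.≤ _) (sym (transpose-adj g i j)) (inverse-entry≤ _ _) }
    where open Box b

  idMat-next : ∀ i j → idMat i j ≡ idMat (next i) (next j)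
  idMat-next 0F 0F = refl
  idMat-next 0F 1F = refl
  idMat-next 0F 2F = refl
  idMat-next 1F 0F = refl
  idMat-next 1F 1F = refl
  idMat-next 1F 2F = refl
  idMat-next 2F 0F = refl
  idMat-next 2F 1F = refl
  idMat-next 2F 2F = refl

  rot-∸scalar : ∀ g α → MatEq (rot g ∸scalar α) (rot (g ∸scalar α))
  rot-∸scalar g α i j = cong (λ z → g (next i) (next j) - α * z) (idMat-next i j)

  transpose-∸scalar : ∀ g α → MatEq (transpose g ∸scalar α) (transpose (g ∸scalar α))
  transpose-∸scalar g α i j = cong (λ z → g j i - α * z) (idMat-sym i j)

  adj-∸scalar-diagonal : ∀ g α t → adj (g ∸scalar α) t t ≡ adj g t t - (α * tr g - α * α - α * g t t)
  adj-∸scalar-diagonal g α = λ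
    { 0F → identity (g i0 i0) (g i1 i1) (g i1 i2) (g i2 i1) (g i2 i2) α
    ; 1F → trans (identity (g i1 i1) (g i2 i2) (g i2 i0) (g i0 i2) (g i0 i0) α)
      (cong (λ z → adj g i1 i1 - (α * z - α * α - α * g i1 i1)) (+-rotateˡ (g i0 i0) (g i1 i1) (g i2 i2)))
    ; 2F → trans (identity (g i2 i2) (g i0 i0) (g i0 i1) (g i1 i0) (g i1 i1) α)
      (cong (λ z → adj g i2 i2 - (α * z - α * α - α * g i2 i2)) (+-rotateʳ (g i0 i0) (g i1 i1) (g i2 i2))) }
    where
    identity : ∀ z u v y w x → (u - x * 1ℤ) * (w - x * 1ℤ) - (v - x * 0ℤ) * (y - x * 0ℤ) ≡
      u * w - v * y - (x * (z + u + w) - x * x - x * z)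
    identity = solve-∀

  -- If g - α has rank at most one mod q, then by this identity g⁻¹ is congruent to a scalar minus α (g - α).
  adj-shift : ∀ g α i j → (adj g ∸scalar (α * tr g - + 2 * (α * α))) i j + α * (g ∸scalar α) i j ≡ adj
    (g ∸scalar α) i j
  adj-shift g α = λ
    { 0F 0F → diag 0F ; 1F 1F → diag 1F ; 2F 2F → diag 2F
    ; 0F 1F → upper (g i2 i1) (g i0 i2) (g i2 i2) (g i0 i1) α β
    ; 1F 2F → upper (g i0 i2) (g i1 i0) (g i0 i0) (g i1 i2) α β
    ; 2F 0F → upper (g i1 i0) (g i2 i1) (g i1 i1) (g i2 i0) α β
    ; 1F 0F → lower (g i1 i2) (g i2 i0) (g i1 i0) (g i2 i2) α β
    ; 2F 1F → lower (g i2 i0) (g i0 i1) (g i2 i1) (g i0 i0) α β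
    ; 0F 2F → lower (g i0 i1) (g i1 i2) (g i0 i2) (g i1 i1) α β }
    where
    β = α * tr g - + 2 * (α * α)
    upper : ∀ a b c d x y → (a * b - c * d - y * 0ℤ) + x * (d - x * 0ℤ) ≡ (a - x * 0ℤ) * (b - x * 0ℤ) - (c - x * 1ℤ) *
      (d - x * 0ℤ)
    upper = solve-∀
    lower : ∀ a b c d x y → (a * b - c * d - y * 0ℤ) + x * (c - x * 0ℤ) ≡ (a - x * 0ℤ) * (b - x * 0ℤ) - (c - x * 0ℤ) *
      (d - x * 1ℤ)
    lower = solve-∀
    diag : ∀ t → (adj g ∸scalar β) t t + α * (g ∸scalar α) t t ≡ adj (g ∸scalar α) t t
    diag t = trans (cong₂ (λ s z → adj g t t - β * s + α * (g t t - α * z)) (idMat-diag t) (idMat-diag t))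
      (trans (identity (adj g t t) (g t t) (tr g) α) (sym (adj-∸scalar-diagonal g α t)))
      where
      identity : ∀ h d t x → h - (x * t - + 2 * (x * x)) * 1ℤ + x * (d - x * 1ℤ) ≡ h - (x * t - x * x - x * d)
      identity = solve-∀

  -- The right side is the derivative at α of the characteristic polynomial.
  trace-adj : ∀ g α → adj (g ∸scalar α) i0 i0 + adj (g ∸scalar α) i1 i1 + adj (g ∸scalar α) i2 i2 ≡ + 3 *
    (α * α) - + 2 * (tr g * α) + tr (adj g)
  trace-adj g α = trans (cong₂ _+_ (cong₂ _+_ (adj-∸scalar-diagonal g α i0) (adj-∸scalar-diagonal g α i1))
    (adj-∸scalar-diagonal g α i2))
    (identity (g i0 i0) (g i1 i1) (g i2 i2) (adj g i0 i0) (adj g i1 i1) (adj g i2 i2) α)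
    where
    identity : ∀ a b c d e f x →
      d - (x * (a + b + c) - x * x - x * a) + (e - (x * (a + b + c) - x * x - x * b)) +
        (f - (x * (a + b + c) - x * x - x * c)) ≡
      + 3 * (x * x) - + 2 * ((a + b + c) * x) + (d + e + f)
    identity = solve-∀

  module _ {q : ℕ} (pr : Prime q) where

    eigenplane-rot : ∀ {g} α → Eigenplane pr g α → Eigenplane pr (rot g) α
    eigenplane-rot {g} α e i j = ∣-resp-≡ (adj-cong {rot g ∸scalar α} {rot (g ∸scalar α)} (rot-∸scalar g α) i j)
      (e (next i) (next j))

    eigenplane-transpose : ∀ {g} α → Eigenplane pr g α → Eigenplane pr (transpose g) α
    eigenplane-transpose {g} α e i j = ∣-resp-≡
      (trans (adj-cong {transpose g ∸scalar α} {transpose (g ∸scalar α)} (transpose-∸scalar g α) i j)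
        (transpose-adj (g ∸scalar α) i j)) (e j i)

    scalarMod-rot : ∀ {g} α → ScalarMod pr g α → ScalarMod pr (rot g) α
    scalarMod-rot {g} α e i j = ∣-resp-≡ (rot-∸scalar g α i j) (e (next i) (next j))

    scalarMod-transpose : ∀ {g} α → ScalarMod pr g α → ScalarMod pr (transpose g) α
    scalarMod-transpose {g} α e i j = ∣-resp-≡ (transpose-∸scalar g α i j) (e j i)

    ∣-* : ∀ {x y} → + q ∣ x → + q ∣ y → + q * + q ∣ x * y
    ∣-* {x} {y} (divides a refl) (divides b refl) = divides (a * b) (identity a b (+ q))
      where
      identity : ∀ a b c → a * c * (b * c) ≡ a * b * (c * c)
      identity = solve-∀

    scalarMod⇒eigenplane : ∀ {g α} → ScalarMod pr g α → Eigenplane pr g α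
    scalarMod⇒eigenplane {g} {α} s i j = ℤ∣.∣m∣n⇒∣m-n (ℤ∣.∣m⇒∣m*n _ (s (next j) (next i)))
      (ℤ∣.∣m⇒∣m*n _ (s (next j) (prev i)))

    eigenplane-adj : ∀ {g α} → Eigenplane pr g α → ∃[ β ] Eigenplane pr (adj g) β
    eigenplane-adj {g} {α} e = β , λ i j → ∣-combine₃ 1ℤ (α * α) (- α) (identity i j)
      (ℤ∣.∣m∣n⇒∣m-n (ℤ∣.∣m⇒∣m*n (adj N (prev j) (prev i)) (e (next j) (next i)))
                     (ℤ∣.∣m⇒∣m*n (adj N (prev j) (next i)) (e (next j) (prev i))))
      (e i j)
      (ℤ∣.∣m∣n⇒∣m-n
        (ℤ∣.∣m∣n⇒∣m+n (ℤ∣.∣m⇒∣m*n (N (prev j) (prev i)) (e (next j) (next i))) (ℤ∣.∣n⇒∣m*n (N (next j) (next i))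
          (e (prev j) (prev i))))
        (ℤ∣.∣m∣n⇒∣m+n (ℤ∣.∣m⇒∣m*n (N (prev j) (next i)) (e (next j) (prev i))) (ℤ∣.∣n⇒∣m*n (N (next j) (prev i))
          (e (prev j) (next i)))))
      where
      N = g ∸scalar α
      β = α * tr g - + 2 * (α * α)
      M = adj g ∸scalar β
      shifted : ∀ i j → M i j ≡ adj N i j - α * N i j
      shifted i j = trans (rearrange (M i j) (α * N i j)) (cong (_- α * N i j) (adj-shift g α i j))
        where
        rearrange : ∀ a b → a ≡ a + b - b
        rearrange = solve-∀
      identity : ∀ i j → adj M i j ≡ 1ℤ * (adj N (next j) (next i) * adj N (prev j) (prev i) - adj N (next j)
        (prev i) * adj N (prev j) (next i))
        + (α * α) * adj N i j
        + - α * ((adj N (next j) (next i) * N (prev j) (prev i) + N (next j) (next i) * adj N (prev j) (prev i))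
               - (adj N (next j) (prev i) * N (prev j) (next i) + N (next j) (prev i) * adj N (prev j) (next i)))
      identity i j = trans (cong₂ _-_ (cong₂ _*_ (shifted _ _) (shifted _ _)) (cong₂ _*_ (shifted _ _) (shifted _ _)))
        (expand (adj N (next j) (next i)) (adj N (prev j) (prev i)) (adj N (next j) (prev i))
          (adj N (prev j) (next i))
                (N (next j) (next i)) (N (prev j) (prev i)) (N (next j) (prev i)) (N (prev j) (next i)) α)
        where
        expand : ∀ a b c d e f g h x → (a - x * e) * (b - x * f) - (c - x * g) * (d - x * h) ≡
          1ℤ * (a * b - c * d) + x * x * (e * f - g * h) + - x * ((a * f + e * b) - (c * h + g * d))
        expand = solve-∀

    scalarMod-adj : ∀ {g α} → ScalarMod pr g α → ∃[ β ] ScalarMod pr (adj g) β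
    scalarMod-adj {g} {α} s = α * tr g - + 2 * (α * α) , λ i j → ∣-combine₂ 1ℤ (- α)
      (trans (rearrange ((adj g ∸scalar (α * tr g - + 2 * (α * α))) i j) (α * (g ∸scalar α) i j) α
        ((g ∸scalar α) i j) refl)
             (cong (λ z → 1ℤ * z + - α * (g ∸scalar α) i j) (adj-shift g α i j)))
      (scalarMod⇒eigenplane {g} {α} s i j) (s i j)
      where
      rearrange : ∀ a b x n → b ≡ x * n → a ≡ 1ℤ * (a + b) + - x * n
      rearrange a .(x * n) x n refl = identity a x n
        where
        identity : ∀ a x n → a ≡ 1ℤ * (a + x * n) + - x * n
        identity = solve-∀

    -- The number det N · N_ij is an entry of `adj (adj N)`, hence quadratic in entries divisible by
    -- q; an N_ij prime to q can be cancelled. If there is none, expansion along a row gives two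
    -- factors q directly.
    det-square : ∀ N → (∀ i j → + q ∣ adj N i j) → + q * + q ∣ det3 N
    det-square N e = go (nonzeroEntry N)
      where
      nonzeroEntry : ∀ N → (∀ i j → + q ∣ N i j) ⊎ (∃[ i ] NonzeroMod pr (N i))
      nonzeroEntry N with nonzeroMod? pr (N i0) | nonzeroMod? pr (N i1) | nonzeroMod? pr (N i2)
      ... | inj₂ n | _ | _ = inj₂ (i0 , n)
      ... | _ | inj₂ n | _ = inj₂ (i1 , n)
      ... | _ | _ | inj₂ n = inj₂ (i2 , n)
      ... | inj₁ a | inj₁ b | inj₁ c = inj₁ λ { 0F → a ; 1F → b ; 2F → c }
      go : (∀ i j → + q ∣ N i j) ⊎ (∃[ i ] NonzeroMod pr (N i)) → + q * + q ∣ det3 N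
      go (inj₁ z) = ∣-resp-≡ (trans (sym (ℤₚ.*-identityʳ _)) (sym (·-adj N i0 i0)))
        (ℤ∣.∣m∣n⇒∣m+n (ℤ∣.∣m∣n⇒∣m+n (∣-* (z i0 i0) (e i0 i0)) (∣-* (z i0 i1) (e i1 i0))) (∣-* (z i0 i2) (e i2 i0)))
      go (inj₂ (i , j , n)) = prime-square-cancel pr (N i j) (det3 N) n
        (∣-resp-≡ (trans (ℤₚ.*-comm (N i j) (det3 N)) (sym (adj-adj N i j))) (ℤ∣.∣m∣n⇒∣m-n (∣-* (e _ _) (e _ _))
          (∣-* (e _ _) (e _ _))))

    -- For the polynomial x³ - t x² + s x - 1. A double root modulo q would give the value only
    -- modulo q; the value modulo q² is the gain from rank one.
    record DoubleRoot (α t s : ℤ) : Set where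
      field
        value : + q * + q ∣ α * α * α - t * (α * α) + s * α - 1ℤ
        derivative : + q ∣ + 3 * (α * α) - + 2 * (t * α) + s

    eigenplane⇒doubleRoot : ∀ {g α} → InSL3 g → Eigenplane pr g α → DoubleRoot α (tr g) (tr (adj g))
    eigenplane⇒doubleRoot {g} {α} d≡1 e = record
      { value = ∣-combine₁ -1ℤ (trans (identity (α * α * α - tr g * (α * α) + tr (adj g) * α))
                  (cong (-1ℤ *_) (trans (cong (_- (α * α * α - tr g * (α * α) + tr (adj g) * α)) (sym d≡1))
                    (sym (char-poly g α)))))
                  (det-square (g ∸scalar α) e)
      ; derivative = ∣-resp-≡ (sym (trace-adj g α)) (ℤ∣.∣m∣n⇒∣m+n (ℤ∣.∣m∣n⇒∣m+n (e i0 i0) (e i1 i1)) (e i2 i2)) }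
      where
      identity : ∀ x → x - 1ℤ ≡ -1ℤ * (1ℤ - x)
      identity = solve-∀

    doubleRoot-unit : ∀ {α t s} → DoubleRoot α t s → ¬ + q ∣ α
    doubleRoot-unit {α} {t} {s} r d = prime-∤-1 pr (∣-combine₂ (α * α - t * α + s) -1ℤ (identity α t s) d
      (ℤ∣.∣-trans (ℤ∣.∣m⇒∣m*n (+ q) ℤ∣.∣-refl) (DoubleRoot.value r)))
      where
      identity : ∀ x t s → 1ℤ ≡ (x * x - t * x + s) * x + -1ℤ * (x * x * x - t * (x * x) + s * x - 1ℤ)
      identity = solve-∀

    module _ {α t s t′ s′ : ℤ} (r : DoubleRoot α t s) (r′ : DoubleRoot α t′ s′) where

      private
        δt = t - t′
        δs = s - s′

      -- Subtracting the two values leaves α (δs - δt α), and α is a unit because the constant term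
      -- is -1.
      doubleRoot-difference : + q * + q ∣ δs - δt * α
      doubleRoot-difference = prime-square-cancel pr α _ (doubleRoot-unit r)
        (∣-combine₂ 1ℤ -1ℤ (identity α t s t′ s′) (DoubleRoot.value r) (DoubleRoot.value r′))
        where
        identity : ∀ x t s t′ s′ → x * (s - s′ - (t - t′) * x) ≡
          1ℤ * (x * x * x - t * (x * x) + s * x - 1ℤ) + -1ℤ * (x * x * x - t′ * (x * x) + s′ * x - 1ℤ)
        identity = solve-∀

      -- The derivatives give δs ≡ 2 α δt, the values δs ≡ α δt. Hence α δt ≡ 0 modulo q.
      doubleRoot-δt : + q ∣ δt
      doubleRoot-δt = prime-cancel pr α _ (doubleRoot-unit r)
        (∣-combine₃ 1ℤ -1ℤ 1ℤ (identity α t s t′ s′) (ℤ∣.∣-trans (ℤ∣.∣m⇒∣m*n (+ q) ℤ∣.∣-refl) doubleRoot-difference)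
          (DoubleRoot.derivative r) (DoubleRoot.derivative r′))
        where
        identity : ∀ x t s t′ s′ → x * (t - t′) ≡ 1ℤ * (s - s′ - (t - t′) * x)
          + -1ℤ * (+ 3 * (x * x) - + 2 * (t * x) + s) + 1ℤ * (+ 3 * (x * x) - + 2 * (t′ * x) + s′)
        identity = solve-∀

      doubleRoot-δs : + q ∣ δs
      doubleRoot-δs = ∣-combine₂ 1ℤ α (identity δs δt α)
        (ℤ∣.∣-trans (ℤ∣.∣m⇒∣m*n (+ q) ℤ∣.∣-refl) doubleRoot-difference) doubleRoot-δt
        where
        identity : ∀ a b x → a ≡ 1ℤ * (a - b * x) + x * b
        identity = solve-∀

    doubleRoot? : ∀ α t s → Dec (DoubleRoot α t s)
    doubleRoot? α t s with + q * + q ∣? (α * α * α - t * (α * α) + s * α - 1ℤ) | + q ∣?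
      (+ 3 * (α * α) - + 2 * (t * α) + s)
    ... | yes v | yes d = yes (record { value = v ; derivative = d })
    ... | no n | _ = no λ r → n (DoubleRoot.value r)
    ... | _ | no n = no λ r → n (DoubleRoot.derivative r)

    residue-≡ : ∀ {α β} → α ∈ residues q → β ∈ residues q → + q ∣ α - β → α ≡ β
    residue-≡ {α} {β} α∈ β∈ d with ∈-map⁻ +_ α∈ | ∈-map⁻ +_ β∈
    ... | a , a∈ , refl | b , b∈ , refl = cong +_ (residue-unique (∈-upTo⁻ a∈) (∈-upTo⁻ b∈) d)

    -- Counting the triples of a double root and two traces

    module _ {A B : ℕ} (A< : 6 ℕ.* A ℕ.< q ℕ.* q) (B< : 6 ℕ.* B ℕ.< q ℕ.* q) where

      private instance
        q≢0 : NonZero q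
        q≢0 = prime⇒nonZero pr

      record Triple (c : ℤ × ℤ × ℤ) : Set where
        private
          α = proj₁ c
          t = proj₁ (proj₂ c)
          s = proj₂ (proj₂ c)
        field
          α∈ : α ∈ residues q
          t≤ : ∣ t ∣ ℕ.≤ 3 ℕ.* A
          s≤ : ∣ s ∣ ℕ.≤ 3 ℕ.* B
          root : DoubleRoot α t s

      private
        box : List (ℤ × ℤ)
        box = cartesianProduct (interval (3 ℕ.* A)) (interval (3 ℕ.* B))

        Root : ℤ → ℤ × ℤ → Set
        Root α (t , s) = DoubleRoot α t s × ∣ t ∣ ℕ.≤ 3 ℕ.* A × ∣ s ∣ ℕ.≤ 3 ℕ.* B

        root? : ∀ α c → Dec (Root α c)
        root? α (t , s) = doubleRoot? α t s ×-dec (∣ t ∣ ℕₚ.≤? 3 ℕ.* A) ×-dec (∣ s ∣ ℕₚ.≤? 3 ℕ.* B)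

        basePoint : ∀ {α} → Dec (Any (Root α) box) → ℤ × ℤ
        basePoint (yes p) = proj₁ (find p)
        -- A dummy value: as soon as some triple with this α exists, the search in `box` succeeds.
        basePoint (no _) = 0ℤ , 0ℤ

        base : ℤ → ℤ × ℤ
        base α = basePoint (Any.any? (root? α) box)

        base-root : ∀ {α t s} → Triple (α , t , s) → Root α (base α)
        base-root {α} tr with Any.any? (root? α) box
        ... | yes p = proj₂ (proj₂ (find p))
        ... | no n = contradiction (lose (∈-cartesianProduct⁺ (∈-interval (Triple.t≤ tr)) (∈-interval (Triple.s≤ tr)))
                       (Triple.root tr , Triple.t≤ tr , Triple.s≤ tr)) n

        δt δs : ℤ × ℤ × ℤ → ℤ
        δt (α , t , s) = t - proj₁ (base α)
        δs (α , t , s) = s - proj₂ (base α)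

        3+3 : ∀ n → 3 ℕ.* n ℕ.+ 3 ℕ.* n ≡ 6 ℕ.* n
        3+3 = solveℕ-∀

        δt≤ : ∀ c → Triple c → ∣ δt c ∣ ℕ.≤ 6 ℕ.* A
        δt≤ (α , t , s) tr = subst (∣ t - proj₁ (base α) ∣ ℕ.≤_) (3+3 A)
          (abs---≤ {t} (Triple.t≤ tr) (proj₁ (proj₂ (base-root tr))))

        δs≤ : ∀ c → Triple c → ∣ δs c ∣ ℕ.≤ 6 ℕ.* B
        δs≤ (α , t , s) tr = subst (∣ s - proj₂ (base α) ∣ ℕ.≤_) (3+3 B)
          (abs---≤ {s} (Triple.s≤ tr) (proj₂ (proj₂ (base-root tr))))

        difference : ∀ c → Triple c → + q * + q ∣ δs c - δt c * proj₁ c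
        difference c tr = doubleRoot-difference (Triple.root tr) (proj₁ (base-root tr))

        square-zero : ∀ {x C} → 6 ℕ.* C ℕ.< q ℕ.* q → ∣ x ∣ ℕ.≤ 6 ℕ.* C → + q * + q ∣ x → x ≡ 0ℤ
        square-zero lt le d = ∣-small⇒≡0 (subst (_∣ _) (sym (ℤₚ.pos-* q q)) d) (ℕₚ.≤-<-trans le lt)

        cross-difference : ∀ s t s′ t′ x y → s ≡ s′ → t ≡ t′ → + q * + q ∣ s - t * x → + q * + q ∣ s′ - t′ * y
          → + q * + q ∣ (x - y) * t
        cross-difference s t .s .t x y refl refl d d′ = ∣-combine₂ 1ℤ -1ℤ (identity s t x y) d′ d
          where
          identity : ∀ s t x y → (x - y) * t ≡ 1ℤ * (s - t * y) + -1ℤ * (s - t * x)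
          identity = solve-∀

        -- The difference to the base point determines α, since q² ∣ δt (α − α′) with 0 < |δt| < q².
        α-determined : ∀ c c′ → Triple c → Triple c′ → δt c ≡ δt c′ → δs c ≡ δs c′ → proj₂ c ≢ base (proj₁ c)
          → proj₁ c ≡ proj₁ c′
        α-determined c@(α , t , s) c′@(α′ , t′ , s′) tr tr′ et es ne with + q ∣? α - α′
        ... | yes d = residue-≡ (Triple.α∈ tr) (Triple.α∈ tr′) d
        ... | no n = contradiction (cong₂ _,_ (m-n≡0⇒m≡n δt≡0) (m-n≡0⇒m≡n δs≡0)) ne
          where
          δt≡0 : δt c ≡ 0ℤ
          δt≡0 = square-zero {C = A} A< (δt≤ c tr) (prime-square-cancel pr (α - α′) (δt c) n
            (cross-difference (δs c) (δt c) (δs c′) (δt c′) α α′ es et (difference c tr) (difference c′ tr′)))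
          δs≡0 : δs c ≡ 0ℤ
          δs≡0 = square-zero {C = B} B< (δs≤ c tr)
            (∣-resp-≡ (trans (identity (δs c) α) (cong (λ z → δs c - z * α) (sym δt≡0))) (difference c tr))
            where
            identity : ∀ a x → a ≡ a - 0ℤ * x
            identity = solve-∀

      -- There are at most q reference triples. Any other triple is determined by its differences δt
      -- and δs from the reference, and these are multiples of q of size at most 6A and 6B.
      triples-bound : Bounded (λ c c′ → ¬ c ≡ c′) Triple
        (q ℕ.* 1 ℕ.+ length (residueClass q (6 ℕ.* A) 0ℤ) ℕ.* (length (residueClass q (6 ℕ.* B) 0ℤ) ℕ.* 1))
      triples-bound = bounded-⊎ {Q = λ c → Triple c × proj₂ c ≡ base (proj₁ c)} {O = λ c → Triple c × proj₂ c ≢ base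
        (proj₁ c)}
        (λ c tr → ×-decide tr (Productₚ.≡-dec ℤₚ._≟_ ℤₚ._≟_ (proj₂ c) (base (proj₁ c))))
        (bounded-fix-≤ proj₁ (residues q) (ℕₚ.≤-reflexive (residues-length q)) (λ c (tr , _) → Triple.α∈ tr) λ α →
          bounded-one λ { (_ , x) (_ , y) ((_ , ex) , refl) ((_ , ey) , refl) ne → ne
            (cong (α ,_) (trans ex (sym ey))) })
        (bounded-fix δt (residueClass q (6 ℕ.* A) 0ℤ) (λ c (tr , _) → ∈-residueClass q 0ℤ (δt≤ c tr)
            (∣-resp-≡ (minus-zero (δt c)) (doubleRoot-δt (Triple.root tr) (proj₁ (base-root tr))))) λ u →
          bounded-fix δs (residueClass q (6 ℕ.* B) 0ℤ) (λ c ((tr , _) , _) → ∈-residueClass q 0ℤ (δs≤ c tr)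
            (∣-resp-≡ (minus-zero (δs c)) (doubleRoot-δs (Triple.root tr) (proj₁ (base-root tr))))) λ w →
          bounded-one λ c c′ (((tr , n) , et) , es) (((tr′ , _) , et′) , es′) ne →
            ne (rebuild c c′ (trans et (sym et′)) (trans es (sym es′)) (α-determined c c′ tr tr′ (trans et (sym et′))
              (trans es (sym es′)) n)))
        where
        minus-zero : ∀ x → x - 0ℤ ≡ x
        minus-zero = solve-∀
        rebuild : ∀ c c′ → δt c ≡ δt c′ → δs c ≡ δs c′ → proj₁ c ≡ proj₁ c′ → c ≡ c′
        rebuild (α , t , s) (.α , t′ , s′) et es refl = cong₂ (λ a b → α , a , b)
          (cancel t t′ (proj₁ (base α)) et) (cancel s s′ (proj₂ (base α)) es)
          where
          cancel : ∀ x y b → x - b ≡ y - b → x ≡ y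
          cancel x y b e = trans (identity x b) (trans (cong (_+ b) e) (sym (identity y b)))
            where
            identity : ∀ x b → x ≡ x - b + b
            identity = solve-∀

-- Numerical estimates

module _ where
  open import Data.Nat.Base using (_+_; _*_; _^_; _≤_)
  open ℕₚ.≤-Reasoning

  module _ {q A B T : ℕ} .{{_ : NonZero q}} (AB≤ : A * B ≤ 4 * T) (AA≤ : A * A ≤ 4 * T) (T≤ : T ≤ q * q * q)
           (A≤ : A ≤ q * q) (B≤ : B ≤ q * q) where

    private
      cancel² : ∀ {x y} → q * q * x ≤ q * q * y → x ≤ y
      cancel² = ℕₚ.*-cancelˡ-≤ (q * q) {{ℕₚ.m*n≢0 q q}}

      qq≤qqq : q * q ≤ q * q * q
      qq≤qqq = ℕₚ.m≤m*n (q * q) q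

      TT≤ : T * T ≤ q * q * q * T
      TT≤ = ℕₚ.*-monoˡ-≤ T T≤

    -- Multiplying by q² clears the quotients by q. The main term is 144 A B ≤ 576 q³, and 602 = 1 +
    -- 576 + 12 + 12 + 1.
    triples-count : ∀ a b → a * q ≤ 6 * A + 6 * A + q → b * q ≤ 6 * B + 6 * B + q → q * 1 + a * (b * 1) ≤ 602 * q
    triples-count a b a≤ b≤ = cancel² (begin
      q * q * (q * 1 + a * (b * 1))                            ≡⟨ identity₁ q a b ⟩
      q * q * q + a * q * (b * q)                              ≤⟨ ℕₚ.+-monoʳ-≤ (q * q * q) (ℕₚ.*-mono-≤ a≤ b≤) ⟩
      q * q * q + (6 * A + 6 * A + q) * (6 * B + 6 * B + q)    ≡⟨ identity₂ q A B ⟩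
      q * q * q + (144 * (A * B) + 12 * (A * q) + 12 * (B * q) + q * q)
        ≤⟨ ℕₚ.+-monoʳ-≤ (q * q * q) (ℕₚ.+-mono-≤ (ℕₚ.+-mono-≤ (ℕₚ.+-mono-≤
             (ℕₚ.*-monoʳ-≤ 144 (ℕₚ.≤-trans AB≤ (ℕₚ.*-monoʳ-≤ 4 T≤)))
             (ℕₚ.*-monoʳ-≤ 12 (ℕₚ.*-monoˡ-≤ q A≤))) (ℕₚ.*-monoʳ-≤ 12 (ℕₚ.*-monoˡ-≤ q B≤))) qq≤qqq) ⟩
      q * q * q + (144 * (4 * (q * q * q)) + 12 * (q * q * q) + 12 * (q * q * q) + q * q * q)  ≡⟨ identity₃ q ⟩
      q * q * (602 * q)                                        ∎)
      where
      identity₁ : ∀ q a b → q * q * (q * 1 + a * (b * 1)) ≡ q * q * q + a * q * (b * q)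
      identity₁ = solveℕ-∀
      identity₂ : ∀ q A B → q * q * q + (6 * A + 6 * A + q) * (6 * B + 6 * B + q) ≡ q * q * q +
        (144 * (A * B) + 12 * (A * q) + 12 * (B * q) + q * q)
      identity₂ = solveℕ-∀
      identity₃ : ∀ q → q * q * q + (144 * (4 * (q * q * q)) + 12 * (q * q * q) + 12 * (q * q * q) + q * q * q)
        ≡ q * q * (602 * q)
      identity₃ = solveℕ-∀

    Aq≤ : A * q ≤ q * q * q
    Aq≤ = ℕₚ.*-monoˡ-≤ q A≤

    -- One diagonal position costs A choices for its entry and l, about 2B/q + 1, for the entry of
    -- the inverse. So A l is at most 8T/q + A, whose square is O(q T) because T ≤ q³; 84 = 64 + 16
    -- + 4.
    diagonal-count : ∀ l → l * q ≤ B + B + q → A * l * (A * l) ≤ 84 * (q * T)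
    diagonal-count l l≤ = cancel² (begin
      q * q * (A * l * (A * l))                     ≡⟨ identity₁ q A l ⟩
      A * (l * q) * (A * (l * q))                   ≤⟨ ℕₚ.*-mono-≤ bound bound ⟩
      (8 * T + A * q) * (8 * T + A * q)             ≡⟨ identity₂ T A q ⟩
      64 * (T * T) + 16 * (T * (A * q)) + q * q * (A * A)
        ≤⟨ ℕₚ.+-mono-≤ (ℕₚ.+-mono-≤ (ℕₚ.*-monoʳ-≤ 64 TT≤) (ℕₚ.*-monoʳ-≤ 16 (ℕₚ.*-monoʳ-≤ T Aq≤)))
             (ℕₚ.*-mono-≤ qq≤qqq AA≤) ⟩
      64 * (q * q * q * T) + 16 * (T * (q * q * q)) + q * q * q * (4 * T)  ≡⟨ identity₃ T q ⟩
      q * q * (84 * (q * T))                        ∎)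
      where
      bound : A * (l * q) ≤ 8 * T + A * q
      bound = begin
        A * (l * q)          ≤⟨ ℕₚ.*-monoʳ-≤ A l≤ ⟩
        A * (B + B + q)      ≡⟨ identity₄ A B q ⟩
        2 * (A * B) + A * q  ≤⟨ ℕₚ.+-monoˡ-≤ (A * q) (ℕₚ.*-monoʳ-≤ 2 AB≤) ⟩
        2 * (4 * T) + A * q  ≡⟨ cong (_+ A * q) (identity₅ T) ⟩
        8 * T + A * q        ∎
        where
        identity₄ : ∀ A B q → A * (B + B + q) ≡ 2 * (A * B) + A * q
        identity₄ = solveℕ-∀
        identity₅ : ∀ T → 2 * (4 * T) ≡ 8 * T
        identity₅ = solveℕ-∀
      identity₁ : ∀ q A l → q * q * (A * l * (A * l)) ≡ A * (l * q) * (A * (l * q))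
      identity₁ = solveℕ-∀
      identity₂ : ∀ T A q → (8 * T + A * q) * (8 * T + A * q) ≡ 64 * (T * T) + 16 * (T * (A * q)) + q * q * (A * A)
      identity₂ = solveℕ-∀
      identity₃ : ∀ T q → 64 * (q * q * q * T) + 16 * (T * (q * q * q)) + q * q * q * (4 * T) ≡ q * q * (84 * (q * T))
      identity₃ = solveℕ-∀

    cube-count : A * (A * A) ≤ 4 * (q * q * T)
    cube-count = begin
      A * (A * A)       ≤⟨ ℕₚ.*-mono-≤ A≤ AA≤ ⟩
      q * q * (4 * T)   ≡⟨ identity q T ⟩
      4 * (q * q * T)   ∎
      where
      identity : ∀ q T → q * q * (4 * T) ≡ 4 * (q * q * T)
      identity = solveℕ-∀

    -- Here A³ l is about 2A⁴/q + A³, where A⁴ ≤ 16 T² ≤ 16 q³ T.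
    corner-count : ∀ l → l * q ≤ A + A + q → A * (A * A) * l ≤ 36 * (q * q * T)
    corner-count l l≤ = ℕₚ.*-cancelˡ-≤ q (begin
      q * (A * (A * A) * l)                             ≡⟨ identity₁ q A l ⟩
      A * (A * A) * (l * q)                             ≤⟨ ℕₚ.*-monoʳ-≤ (A * (A * A)) l≤ ⟩
      A * (A * A) * (A + A + q)                         ≡⟨ identity₂ A q ⟩
      2 * (A * A * (A * A)) + A * q * (A * A)           ≤⟨ ℕₚ.+-mono-≤ (ℕₚ.*-monoʳ-≤ 2 (ℕₚ.*-mono-≤ AA≤ AA≤))
        (ℕₚ.*-mono-≤ Aq≤ AA≤) ⟩
      2 * (4 * T * (4 * T)) + q * q * q * (4 * T)       ≡⟨ identity₃ T q ⟩
      32 * (T * T) + 4 * (q * q * q * T)                ≤⟨ ℕₚ.+-monoˡ-≤ (4 * (q * q * q * T)) (ℕₚ.*-monoʳ-≤ 32 TT≤) ⟩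
      32 * (q * q * q * T) + 4 * (q * q * q * T)        ≡⟨ identity₄ T q ⟩
      q * (36 * (q * q * T))                            ∎)
      where
      identity₁ : ∀ q A l → q * (A * (A * A) * l) ≡ A * (A * A) * (l * q)
      identity₁ = solveℕ-∀
      identity₂ : ∀ A q → A * (A * A) * (A + A + q) ≡ 2 * (A * A * (A * A)) + A * q * (A * A)
      identity₂ = solveℕ-∀
      identity₃ : ∀ T q → 2 * (4 * T * (4 * T)) + q * q * q * (4 * T) ≡ 32 * (T * T) + 4 * (q * q * q * T)
      identity₃ = solveℕ-∀
      identity₄ : ∀ T q → 32 * (q * q * q * T) + 4 * (q * q * q * T) ≡ q * (36 * (q * q * T))
      identity₄ = solveℕ-∀

    -- For A ≤ q a residue class has at most three members. Otherwise l ≤ 3A/q, and A⁴ ≤ 16 T² ≤ 16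
    -- q⁴ T gives 81 · 16 = 1296.
    scalar-corner-count : ∀ l → 1 ≤ T → l * q ≤ A + A + q → l * l * (l * l) ≤ 1296 * T
    scalar-corner-count l 1≤T l≤ with ℕₚ.≤-total A q
    ... | inj₁ A≤q = begin
      l * l * (l * l)  ≤⟨ ℕₚ.*-mono-≤ (ℕₚ.*-mono-≤ l≤3 l≤3) (ℕₚ.*-mono-≤ l≤3 l≤3) ⟩
      81               ≤⟨ ℕₚ.m≤m+n 81 1215 ⟩
      1296             ≡⟨⟩
      1296 * 1         ≤⟨ ℕₚ.*-monoʳ-≤ 1296 1≤T ⟩
      1296 * T         ∎
      where
      l≤3 : l ≤ 3
      l≤3 = ℕₚ.*-cancelʳ-≤ l 3 q (ℕₚ.≤-trans l≤ (ℕₚ.≤-trans (ℕₚ.+-monoˡ-≤ q (ℕₚ.+-mono-≤ A≤q A≤q))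
        (ℕₚ.≤-reflexive (identity q))))
        where
        identity : ∀ q → q + q + q ≡ 3 * q
        identity = solveℕ-∀
    ... | inj₂ q≤A = cancel² (cancel² (begin
      q * q * (q * q * (l * l * (l * l)))               ≡⟨ identity₁ q l ⟩
      l * q * (l * q) * (l * q * (l * q))               ≤⟨ ℕₚ.*-mono-≤ (ℕₚ.*-mono-≤ lq≤ lq≤) (ℕₚ.*-mono-≤ lq≤ lq≤) ⟩
      3 * A * (3 * A) * (3 * A * (3 * A))               ≡⟨ identity₂ A ⟩
      81 * (A * A * (A * A))                            ≤⟨ ℕₚ.*-monoʳ-≤ 81 (ℕₚ.*-mono-≤ AA≤ AA≤) ⟩
      81 * (4 * T * (4 * T))                            ≡⟨ identity₃ T ⟩
      1296 * (T * T)                                    ≤⟨ ℕₚ.*-monoʳ-≤ 1296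
        (ℕₚ.≤-trans TT≤ (ℕₚ.*-monoˡ-≤ T (ℕₚ.m≤m*n (q * q * q) q))) ⟩
      1296 * (q * q * q * q * T)                        ≡⟨ identity₄ q T ⟩
      q * q * (q * q * (1296 * T))                      ∎))
      where
      lq≤ : l * q ≤ 3 * A
      lq≤ = ℕₚ.≤-trans l≤ (ℕₚ.≤-trans (ℕₚ.+-monoʳ-≤ (A + A) q≤A) (ℕₚ.≤-reflexive (identity A)))
        where
        identity : ∀ q → q + q + q ≡ 3 * q
        identity = solveℕ-∀
      identity₁ : ∀ q l → q * q * (q * q * (l * l * (l * l))) ≡ l * q * (l * q) * (l * q * (l * q))
      identity₁ = solveℕ-∀
      identity₂ : ∀ A → 3 * A * (3 * A) * (3 * A * (3 * A)) ≡ 81 * (A * A * (A * A))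
      identity₂ = solveℕ-∀
      identity₃ : ∀ T → 81 * (4 * T * (4 * T)) ≡ 1296 * (T * T)
      identity₃ = solveℕ-∀
      identity₄ : ∀ q T → 1296 * (q * q * q * q * T) ≡ q * q * (q * q * (1296 * T))
      identity₄ = solveℕ-∀

    -- The conditions q ≤ A and q ≤ 2B absorb the additive constants in the lengths of the classes,
    -- so that l m ≤ 48 T/q². Then T³ ≤ q⁶ T.
    scalar-diagonal-count : ∀ l m → q ≤ A → q ≤ 2 * B → l * q ≤ A + A + q → m * q ≤ B + B + q →
                            l * m * (l * m) * (l * m) ≤ 48 * 48 * 48 * T
    scalar-diagonal-count l m q≤A q≤B l≤ m≤ = cancel² (cancel² (cancel² (begin
      q * q * (q * q * (q * q * (l * m * (l * m) * (l * m))))                    ≡⟨ identity₁ q l m ⟩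
      l * q * (m * q) * (l * q * (m * q)) * (l * q * (m * q))                    ≤⟨ ℕₚ.*-mono-≤
        (ℕₚ.*-mono-≤ pair pair) pair ⟩
      48 * T * (48 * T) * (48 * T)                                               ≡⟨ identity₂ 48 T ⟩
      48 * 48 * 48 * (T * T * T)                                                    ≤⟨ ℕₚ.*-monoʳ-≤ (48 * 48 * 48)
        (ℕₚ.*-monoˡ-≤ T (ℕₚ.*-mono-≤ T≤ T≤)) ⟩
      48 * 48 * 48 * (q * q * q * (q * q * q) * T)                               ≡⟨ identity₃ (48 * 48 * 48) q T ⟩
      q * q * (q * q * (q * q * (48 * 48 * 48 * T)))                                  ∎)))
      where
      pair : l * q * (m * q) ≤ 48 * T
      pair = begin
        l * q * (m * q)                  ≤⟨ ℕₚ.*-mono-≤ (ℕₚ.≤-trans l≤ (ℕₚ.+-monoʳ-≤ (A + A) q≤A))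
          (ℕₚ.≤-trans m≤ (ℕₚ.+-monoʳ-≤ (B + B) q≤B)) ⟩
        (A + A + A) * (B + B + 2 * B)    ≡⟨ identity₄ A B ⟩
        12 * (A * B)                     ≤⟨ ℕₚ.*-monoʳ-≤ 12 AB≤ ⟩
        12 * (4 * T)                     ≡⟨ identity₅ T ⟩
        48 * T                           ∎
        where
        identity₄ : ∀ A B → (A + A + A) * (B + B + 2 * B) ≡ 12 * (A * B)
        identity₄ = solveℕ-∀
        identity₅ : ∀ T → 12 * (4 * T) ≡ 48 * T
        identity₅ = solveℕ-∀
      identity₁ : ∀ q l m → q * q * (q * q * (q * q * (l * m * (l * m) * (l * m)))) ≡ l * q * (m * q) *
        (l * q * (m * q)) * (l * q * (m * q))
      identity₁ = solveℕ-∀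
      identity₂ : ∀ c T → c * T * (c * T) * (c * T) ≡ c * c * c * (T * T * T)
      identity₂ = solveℕ-∀
      identity₃ : ∀ c q T → c * (q * q * q * (q * q * q) * T) ≡ q * q * (q * q * (q * q * (c * T)))
      identity₃ = solveℕ-∀

  module _ {q A T E n l K Δ l′ k : ℕ} where
    private
      S = q * q * T

    -- The first summand is triples, times (A l)² for two diagonal positions, times divisor codes.
    -- The second counts reducible matrices: its terms with l′ and without are each 2592 times what
    -- `corner-count` and `cube-count` bound, by 36 S and 4 S.
    eigenplane-count : ∀ {a b c} → n ≤ a * q → A * l * (A * l) ≤ b * (q * T) → K ≡ c * E →
      Δ * Δ ≤ E → 1 ≤ E → A * (A * A) * l′ ≤ 36 * S → A * (A * A) ≤ 4 * S → a * 9 * b * c + 2592 * 40 ≤ k →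
      n * (3 * A * (l * (3 * A * (l * K)))) +
      6 * (2 * (3 * A * (3 * A * (3 * A * ((l′ + l′) * (2 * Δ * (2 * Δ * 1))) + 2 * (2 * (3 * A * 1 + 3 * A * 1))))))
      ≤ k * (S * E)
    eigenplane-count {a} {b} {c} n≤ l≤ K≡ Δ≤ 1≤E l′≤ A≤ k≤ = begin
      N₁ + N₂                                               ≤⟨ ℕₚ.+-mono-≤ {N₁} {a * 9 * b * c * (S * E)}
        {N₂} irreducible reducible ⟩
      a * 9 * b * c * (S * E) + 2592 * 40 * (S * E)  ≡⟨ ℕₚ.*-distribʳ-+ (S * E) (a * 9 * b * c) (2592 * 40) ⟨
      (a * 9 * b * c + 2592 * 40) * (S * E)     ≤⟨ ℕₚ.*-monoˡ-≤ (S * E) k≤ ⟩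
      k * (S * E)                                         ∎
      where
      N₁ = n * (3 * A * (l * (3 * A * (l * K))))
      N₂ = 6 * (2 * (3 * A * (3 * A * (3 * A * ((l′ + l′) * (2 * Δ * (2 * Δ * 1))) + 2 *
        (2 * (3 * A * 1 + 3 * A * 1))))))
      irreducible : N₁ ≤ a * 9 * b * c * (S * E)
      irreducible = begin
        N₁                                                     ≡⟨ identity₁ n A l K ⟩
        n * (9 * (A * l * (A * l))) * K            ≤⟨ ℕₚ.*-mono-≤ (ℕₚ.*-mono-≤ n≤ (ℕₚ.*-monoʳ-≤ 9 l≤))
          (ℕₚ.≤-reflexive K≡) ⟩
        a * q * (9 * (b * (q * T))) * (c * E)    ≡⟨ identity₂ a b c q T E ⟩
        a * 9 * b * c * (S * E)                      ∎
        where
        identity₁ : ∀ n A l K → n * (3 * A * (l * (3 * A * (l * K)))) ≡ n * (9 * (A * l * (A * l))) * K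
        identity₁ = solveℕ-∀
        identity₂ : ∀ a b c q T E → a * q * (9 * (b * (q * T))) * (c * E) ≡ a * 9 * b * c * (q * q * T * E)
        identity₂ = solveℕ-∀
      reducible : N₂ ≤ 2592 * 40 * (S * E)
      reducible = begin
        N₂                                                     ≡⟨ identity₁ A l′ Δ ⟩
        2592 * (A * (A * A) * l′ * (Δ * Δ)) + 2592 * (A * (A * A) * 1)
          ≤⟨ ℕₚ.+-mono-≤ (ℕₚ.*-monoʳ-≤ 2592 (ℕₚ.*-mono-≤ l′≤ Δ≤)) (ℕₚ.*-monoʳ-≤ 2592 (ℕₚ.*-mono-≤ A≤ 1≤E)) ⟩
        2592 * (36 * S * E) + 2592 * (4 * S * E) ≡⟨ identity₂ 2592 S E ⟩
        2592 * 40 * (S * E)                              ∎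
        where
        identity₁ : ∀ A l Δ → 6 *
          (2 * (3 * A * (3 * A * (3 * A * ((l + l) * (2 * Δ * (2 * Δ * 1))) + 2 * (2 * (3 * A * 1 + 3 * A * 1))))))
          ≡ 2592 * (A * (A * A) * l * (Δ * Δ)) + 2592 * (A * (A * A) * 1)
        identity₁ = solveℕ-∀
        identity₂ : ∀ c S E → c * (36 * S * E) + c * (4 * S * E) ≡ c * 40 * (S * E)
        identity₂ = solveℕ-∀

  module _ {T E k : ℕ} where

    scalar-reducible-count : ∀ {Δ l d} → Δ * Δ ≤ E → 1 ≤ E → l * l * (l * l) ≤ d * T → 192 * d ≤ k →
      6 * (2 * (l * (l * ((l + l) * (l * (2 * Δ * (2 * Δ * 1))) + 2 * (2 * (l * 1 + l * 1))))))
      ≤ k * (T * E)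
    scalar-reducible-count {Δ} {l} {d} Δ≤ 1≤E l≤ k≤ = begin
      N₂                                                            ≡⟨ identity₁ l Δ ⟩
      96 * (l * l * (l * l) * (Δ * Δ)) + 96 * (l * l * l * 1)
        ≤⟨ ℕₚ.+-mono-≤ (ℕₚ.*-monoʳ-≤ 96 (ℕₚ.*-mono-≤ l≤ Δ≤))
          (ℕₚ.*-monoʳ-≤ 96 (ℕₚ.*-mono-≤ (ℕₚ.≤-trans (ℕₚ.*-monoʳ-≤ (l * l) (square l)) l≤) 1≤E)) ⟩
      96 * (d * T * E) + 96 * (d * T * E)             ≡⟨ identity₂ d T E ⟩
      192 * d * (T * E)                                       ≤⟨ ℕₚ.*-monoˡ-≤ (T * E) k≤ ⟩
      k * (T * E)                                               ∎
      where
      N₂ = 6 * (2 * (l * (l * ((l + l) * (l * (2 * Δ * (2 * Δ * 1))) + 2 * (2 * (l * 1 + l * 1))))))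
      square : ∀ l → l ≤ l * l
      square zero = z≤n
      square (suc l) = ℕₚ.m≤m*n (suc l) (suc l)
      identity₁ : ∀ l Δ → 6 * (2 * (l * (l * ((l + l) * (l * (2 * Δ * (2 * Δ * 1))) + 2 * (2 * (l * 1 + l * 1)))))) ≡
        96 * (l * l * (l * l) * (Δ * Δ)) + 96 * (l * l * l * 1)
      identity₁ = solveℕ-∀
      identity₂ : ∀ d T E → 96 * (d * T * E) + 96 * (d * T * E) ≡ 192 * d * (T * E)
      identity₂ = solveℕ-∀

  scalar-count : ∀ {T E k l m K Δ l′ a b c d} → l * m * (l * m) * (l * m) ≤ b * T → K ≡ c * E →
    Δ * Δ ≤ E → 1 ≤ E → l′ * l′ * (l′ * l′) ≤ d * T → a * b * c + 192 * d ≤ k →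
    a * (l * (m * (l * (m * (l * (m * K)))))) +
    6 * (2 * (l′ * (l′ * ((l′ + l′) * (l′ * (2 * Δ * (2 * Δ * 1))) + 2 * (2 * (l′ * 1 + l′ * 1))))))
    ≤ k * (T * E)
  scalar-count {T} {E} {k} {l} {m} {K} {Δ} {l′} {a} {b} {c} {d} l≤ K≡ Δ≤ 1≤E l′≤ k≤ = begin
    N₁ + N₂                                                 ≤⟨ ℕₚ.+-mono-≤ {N₁} {a * b * c * (T * E)} {N₂} irreducible
                                                                   (scalar-reducible-count {T} {E} {192 * d} {Δ} {l′}
                                                                     {d} Δ≤ 1≤E l′≤ ℕₚ.≤-refl) ⟩
    a * b * c * (T * E) + 192 * d * (T * E)   ≡⟨ ℕₚ.*-distribʳ-+ (T * E) (a * b * c) (192 * d) ⟨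
    (a * b * c + 192 * d) * (T * E)               ≤⟨ ℕₚ.*-monoˡ-≤ (T * E) k≤ ⟩
    k * (T * E)                                           ∎
    where
    N₁ = a * (l * (m * (l * (m * (l * (m * K))))))
    N₂ = 6 * (2 * (l′ * (l′ * ((l′ + l′) * (l′ * (2 * Δ * (2 * Δ * 1))) + 2 * (2 * (l′ * 1 + l′ * 1))))))
    irreducible : N₁ ≤ a * b * c * (T * E)
    irreducible = begin
      N₁                                                      ≡⟨ identity₁ a l m K ⟩
      a * (l * m * (l * m) * (l * m)) * K       ≤⟨ ℕₚ.*-mono-≤ (ℕₚ.*-monoʳ-≤ a l≤) (ℕₚ.≤-reflexive K≡) ⟩
      a * (b * T) * (c * E)                           ≡⟨ identity₂ a b c T E ⟩
      a * b * c * (T * E)                             ∎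
      where
      identity₁ : ∀ a l m K → a * (l * (m * (l * (m * (l * (m * K)))))) ≡ a * (l * m * (l * m) * (l * m)) * K
      identity₁ = solveℕ-∀
      identity₂ : ∀ a b c T E → a * (b * T) * (c * E) ≡ a * b * c * (T * E)
      identity₂ = solveℕ-∀

  -- Abstract, because unfolding a product with this literal is unary.
  abstract
    boxConstant : ℕ
    boxConstant = 10 ^ 10

    eigenplane-constant≤ : 602 * 9 * 84 * 15625 + 2592 * 40 ≤ boxConstant
    eigenplane-constant≤ = ℕₚ.m≤m+n (602 * 9 * 84 * 15625 + 2592 * 40) 2888771320

    scalar-constant≤ : 3 * (48 * 48 * 48) * 15625 + 192 * 1296 ≤ boxConstant
    scalar-constant≤ = ℕₚ.m≤m+n (3 * (48 * 48 * 48) * 15625 + 192 * 1296) 4815751168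

-- Counting at a dyadic scale

module _ where
  open import Data.Integer.Base using (_+_; _*_; _-_; -_)

  -- A bounds the entries of g, and B those of its inverse. Traces are at most 3A and 3B, so the
  -- factor 6 makes their differences smaller than q². X bounds the numbers to be factored: products
  -- of two entries and sums of two 3-cycles.
  record Scale (q A B T X : ℕ) : Set where
    field
      1≤T : 1 ℕ.≤ T
      1≤A : 1 ℕ.≤ A
      AB≤ : A ℕ.* B ℕ.≤ 4 ℕ.* T
      AA≤ : A ℕ.* A ℕ.≤ 4 ℕ.* T
      A≤2B : A ℕ.≤ 2 ℕ.* B
      6A< : 6 ℕ.* A ℕ.< q ℕ.* q
      6B< : 6 ℕ.* B ℕ.< q ℕ.* q
      T≤ : T ℕ.≤ q ℕ.* q ℕ.* q
      AA≤X : A ℕ.* A ℕ.≤ X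
      AAA≤X : A ℕ.* A ℕ.* A ℕ.+ A ℕ.* A ℕ.* A ℕ.≤ X

    A≤ : A ℕ.≤ q ℕ.* q
    A≤ = ℕₚ.≤-trans (ℕₚ.m≤n*m A 6) (ℕₚ.<⇒≤ 6A<)

    B≤ : B ℕ.≤ q ℕ.* q
    B≤ = ℕₚ.≤-trans (ℕₚ.m≤n*m B 6) (ℕₚ.<⇒≤ 6B<)

  box-product≤ : ∀ {A B X g} → A ℕ.* A ℕ.≤ X → Box A B g → ∀ i j → ∣ g i j * g j i ∣ ℕ.≤ X
  box-product≤ {g = g} le b i j = ℕₚ.≤-trans (abs-*-≤ {g i j} (Box.entry≤ b i j) (Box.entry≤ b j i)) le

  box-cycles≤ : ∀ {A B X g} → A ℕ.* A ℕ.* A ℕ.+ A ℕ.* A ℕ.* A ℕ.≤ X → Box A B g → ∣ cycles g ∣ ℕ.≤ X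
  box-cycles≤ {g = g} le b = ℕₚ.≤-trans (abs-+-≤ {g i0 i1 * g i1 i2 * g i2 i0}
    (abs-*-≤ {g i0 i1 * g i1 i2} (abs-*-≤ {g i0 i1} (e _ _) (e _ _)) (e _ _))
    (abs-*-≤ {g i0 i2 * g i2 i1} (abs-*-≤ {g i0 i2} (e _ _) (e _ _)) (e _ _))) le
    where e = Box.entry≤ b

  abs-tr≤ : ∀ g {A} → (∀ i j → ∣ g i j ∣ ℕ.≤ A) → ∣ tr g ∣ ℕ.≤ 3 ℕ.* A
  abs-tr≤ g {A} le = ℕₚ.≤-trans (abs-+-≤ {g i0 i0 + g i1 i1} (abs-+-≤ {g i0 i0} (le _ _) (le _ _)) (le _ _))
    (ℕₚ.≤-reflexive (identity A))
    where
    identity : ∀ a → a ℕ.+ a ℕ.+ a ≡ 3 ℕ.* a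
    identity = solveℕ-∀

  reducible? : ∀ g → Dec (Reducible g)
  reducible? g = decide (case? 0F) (case? 1F) (case? 2F)
    where
    Case : Fin 3 → Set
    Case t = (g t (next t) ≡ 0ℤ × g t (prev t) ≡ 0ℤ) ⊎ (g (next t) t ≡ 0ℤ × g (prev t) t ≡ 0ℤ)
    case? : ∀ t → Dec (Case t)
    case? t = ((g t (next t) ℤₚ.≟ 0ℤ) ×-dec (g t (prev t) ℤₚ.≟ 0ℤ)) ⊎-dec ((g (next t) t ℤₚ.≟ 0ℤ) ×-dec
      (g (prev t) t ℤₚ.≟ 0ℤ))
    decide : Dec (Case 0F) → Dec (Case 1F) → Dec (Case 2F) → Dec (Reducible g)
    decide (yes r) _ _ = yes (0F , r)
    decide _ (yes r) _ = yes (1F , r)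
    decide _ _ (yes r) = yes (2F , r)
    decide (no a) (no b) (no c) = no λ { (0F , r) → a r ; (1F , r) → b r ; (2F , r) → c r }

  split-reducible : ∀ {Pr : Mat3 → Set} {M N} → Bounded DistinctMat (λ g → Pr g × ¬ Reducible g) M →
                    Bounded DistinctMat (λ g → Pr g × Reducible g) N → Bounded DistinctMat Pr (M ℕ.+ N)
  split-reducible = bounded-⊎ λ g p → swap (×-decide p (reducible? g))

  sixth-power : ℕ → ℕ
  sixth-power Δ = Δ ℕ.* Δ ℕ.* (Δ ℕ.* Δ) ℕ.* (Δ ℕ.* Δ)

  private
    codes≡ : ∀ Δ → 5 ℕ.* Δ ℕ.* (5 ℕ.* Δ ℕ.* (5 ℕ.* Δ ℕ.* (5 ℕ.* Δ ℕ.* (5 ℕ.* Δ ℕ.* (5 ℕ.* Δ ℕ.* 1))))) ≡ 15625 ℕ.*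
      (Δ ℕ.* Δ ℕ.* (Δ ℕ.* Δ) ℕ.* (Δ ℕ.* Δ))
    codes≡ = identity 5
      where
      identity : ∀ c Δ → c ℕ.* Δ ℕ.* (c ℕ.* Δ ℕ.* (c ℕ.* Δ ℕ.* (c ℕ.* Δ ℕ.* (c ℕ.* Δ ℕ.* (c ℕ.* Δ ℕ.* 1))))) ≡
        c ℕ.* c ℕ.* c ℕ.* c ℕ.* c ℕ.* c ℕ.* (Δ ℕ.* Δ ℕ.* (Δ ℕ.* Δ) ℕ.* (Δ ℕ.* Δ))
      identity = solveℕ-∀

    square≤sixth : ∀ X → maxDivisors X ℕ.* maxDivisors X ℕ.≤ sixth-power (maxDivisors X)
    square≤sixth X = ℕₚ.≤-trans (ℕₚ.m≤m*n (Δ ℕ.* Δ) (Δ ℕ.* Δ)) (ℕₚ.m≤m*n _ (Δ ℕ.* Δ))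
      where
      Δ = maxDivisors X
      instance
        _ : NonZero (Δ ℕ.* Δ)
        _ = >-nonZero (ℕₚ.*-mono-≤ (maxDivisors≥1 X) (maxDivisors≥1 X))

    1≤sixth : ∀ X → 1 ℕ.≤ sixth-power (maxDivisors X)
    1≤sixth X = ℕₚ.≤-trans (ℕₚ.*-mono-≤ (maxDivisors≥1 X) (maxDivisors≥1 X)) (square≤sixth X)

  module _ {q : ℕ} (pr : Prime q) {A B T X : ℕ} (scale : Scale q A B T X) where

    open Scale scale

    private
      instance
        q≢0 : NonZero q
        q≢0 = prime⇒nonZero pr
      Δ = maxDivisors X
      E = sixth-power Δ
      lA = length (residueClass q A 0ℤ)
      lB = length (residueClass q B 0ℤ)

      lA≤ : lA ℕ.* q ℕ.≤ A ℕ.+ A ℕ.+ q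
      lA≤ = residueClass-length q A 0ℤ

      lB≤ : lB ℕ.* q ℕ.≤ B ℕ.+ B ℕ.+ q
      lB≤ = residueClass-length q B 0ℤ

      class≤ : ∀ C r → length (residueClass q C r) ℕ.≤ length (residueClass q C 0ℤ)
      class≤ C r = ℕₚ.≤-reflexive (trans (residueClass-length-≡ q C r) (sym (residueClass-length-≡ q C 0ℤ)))

    WithEigenplane WithScalar : Mat3 → Set
    WithEigenplane g = Box A B g × ∃[ α ] (α ∈ residues q × Eigenplane pr g α)
    WithScalar g = Box A B g × ∃[ α ] ScalarMod pr g α

    private
      Traced : ℤ → ℤ → ℤ → Mat3 → Set
      Traced α t s g = (Box A B g × Eigenplane pr g α × ¬ Reducible g) × tr g ≡ t × tr (adj g) ≡ s

      codes : ℕ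
      codes = 5 ℕ.* Δ ℕ.* (5 ℕ.* Δ ℕ.* (5 ℕ.* Δ ℕ.* (5 ℕ.* Δ ℕ.* (5 ℕ.* Δ ℕ.* (5 ℕ.* Δ ℕ.* 1)))))

      last-entry : ∀ {a b c t x y} → a + b + c ≡ t → a ≡ x → b ≡ y → c ≡ t - x - y
      last-entry {a} {b} {c} refl refl refl = identity a b c
        where
        identity : ∀ a b c → c ≡ a + b + c - a - b
        identity = solve-∀

      -- Two diagonal entries range over an interval, the matching diagonal entries of the inverse
      -- over residue classes modulo q, and the known traces supply the third ones.
      traced-bound : ∀ α t s → Bounded DistinctMat (Traced α t s) (3 ℕ.* A ℕ.* (lB ℕ.* (3 ℕ.* A ℕ.* (lB ℕ.* codes))))
      traced-bound α t s =
        bounded-fix-≤ (λ g → g i0 i0) (interval A) (interval-length A 1≤A) (λ g ((b , _) , _) → ∈-interval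
          (Box.entry≤ b i0 i0)) λ x →
        bounded-fix-≤ (λ g → adj g i0 i0) (residueClass q B (α * t - α * α - α * x))
          (class≤ B (α * t - α * α - α * x))
          (λ { g (((b , e , _) , refl , _) , refl) → ∈-residueClass q _ (Box.inverse-entry≤ b i0 i0)
            (∣-resp-≡ (sym (adj-∸scalar-diagonal g α i0)) (e i0 i0)) }) λ x′ →
        bounded-fix-≤ (λ g → g i1 i1) (interval A) (interval-length A 1≤A) (λ g ((((b , _) , _) , _) , _) → ∈-interval
          (Box.entry≤ b i1 i1)) λ y →
        bounded-fix-≤ (λ g → adj g i1 i1) (residueClass q B (α * t - α * α - α * y))
          (class≤ B (α * t - α * α - α * y))
          (λ { g (((((b , e , _) , refl , _) , _) , _) , refl) → ∈-residueClass q _ (Box.inverse-entry≤ b i1 i1)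
            (∣-resp-≡ (sym (adj-∸scalar-diagonal g α i1)) (e i1 i1)) }) λ y′ →
        bounded-⊆ (λ { g (((((((b , e , nr) , et , es)) , ex) , ex′) , ey) , ey′) → record
            { det≡1 = Box.det≡1 b ; irreducible = nr
            ; diagonal = λ { 0F → ex ; 1F → ey ; 2F → last-entry et ex ey }
            ; inverse-diagonal = λ { 0F → ex′ ; 1F → ey′ ; 2F → last-entry es ex′ ey′ }
            ; products≤ = box-product≤ AA≤X b ; cycles≤ = box-cycles≤ AAA≤X b } })
          (knownDiagonal-bound (vec x y (t - x - y)) (vec x′ y′ (s - x′ - y′)))

      eigenplane-irreducible : Bounded DistinctMat (λ g → WithEigenplane g × ¬ Reducible g)
        ((q ℕ.* 1 ℕ.+ length (residueClass q (6 ℕ.* A) 0ℤ) ℕ.* (length (residueClass q (6 ℕ.* B) 0ℤ) ℕ.* 1))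
          ℕ.* (3 ℕ.* A ℕ.* (lB ℕ.* (3 ℕ.* A ℕ.* (lB ℕ.* codes)))))
      eigenplane-irreducible = bounded-⊆ (λ { g ((b , α , α∈ , e) , n) → α , b , α∈ , e , n }) (bounded-choose
        {Q = λ g α → Box A B g × α ∈ residues q × Eigenplane pr g α × ¬ Reducible g}
        (bounded-fiber {_~_ = _≡_} (λ (g , α) → α , tr g , tr (adj g))
          (Productₚ.≡-dec ℤₚ._≟_ (Productₚ.≡-dec ℤₚ._≟_ ℤₚ._≟_))
          (triples-bound pr {A} {B} 6A< 6B<)
          (λ (g , α) (b , α∈ , e , _) → record
            { α∈ = α∈ ; t≤ = abs-tr≤ g (Box.entry≤ b) ; s≤ = abs-tr≤ (adj g) (Box.inverse-entry≤ b)
            ; root = eigenplane⇒doubleRoot pr {g} (Box.det≡1 b) e })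
          (λ (g₀ , α) _ → bounded-map proj₁ (λ _ _ _ _ ne → ne)
            (λ { (g , β) ((b , α∈ , e , n) , eq) → traced g eq b e n })
            (traced-bound α (tr g₀) (tr (adj g₀))))))
        where
        traced : ∀ {α β t s} g → (α , t , s) ≡ (β , tr g , tr (adj g)) → Box A B g → Eigenplane pr g β → ¬ Reducible g
          → Traced α t s g
        traced g refl b e n = (b , e , n) , refl , refl

      -- Three entries range over intervals, and the last diagonal entry over two classes modulo q,
      -- one for each case of `second`.
      eigenplane-rowReducible : Bounded DistinctMat (λ g → WithEigenplane g × RowReducible g)
        (2 ℕ.* (3 ℕ.* A ℕ.* (3 ℕ.* A ℕ.* (3 ℕ.* A ℕ.* ((lA ℕ.+ lA) ℕ.* (2 ℕ.* Δ ℕ.* (2 ℕ.* Δ ℕ.* 1))) ℕ.+ 2 ℕ.*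
          (2 ℕ.* (3 ℕ.* A ℕ.* 1 ℕ.+ 3 ℕ.* A ℕ.* 1))))))
      eigenplane-rowReducible = rowReducible-bound (interval A) (interval A) (interval A)
        (λ e x → residueClass q A (1ℤ + e - x) ++ residueClass q A x)
        (interval-length A 1≤A) (interval-length A 1≤A) (interval-length A 1≤A)
        (λ e x → ℕₚ.≤-trans (ℕₚ.≤-reflexive (length-++ (residueClass q A (1ℤ + e - x))))
          (ℕₚ.+-mono-≤ (class≤ A (1ℤ + e - x)) (class≤ A x)))
        (λ g (b , _) → Box.det≡1 b) (λ g (b , _) → ∈-interval (Box.entry≤ b _ _))
          (λ g (b , _) → ∈-interval (Box.entry≤ b _ _))
        (λ g (b , _) → ∈-interval (Box.entry≤ b _ _)) second
        (λ g (b , _) → ∈-interval (Box.entry≤ b _ _)) (λ g (b , _) → ∈-interval (Box.entry≤ b _ _))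
          (λ g (b , _) → box-product≤ AA≤X b _ _)
        where
        -- If row 0 is (e, 0, 0), then either α ≡ e is an eigenvalue of the lower block, or that block is ≡ α modulo q.
        second : ∀ g → WithEigenplane g → RowReducible g → g i2 i2 ∈ residueClass q A
          (1ℤ + g i0 i0 - g i1 i1) ++ residueClass q A (g i1 i1)
        second g (b , α , _ , e) r@(z , z′) with + q ∣? g i0 i0 - α
        ... | no n = ∈-++⁺ʳ (residueClass q A (1ℤ + g i0 i0 - g i1 i1)) (∈-residueClass q _ (Box.entry≤ b i2 i2)
              (∣-combine₂ 1ℤ -1ℤ (identity (g i1 i1) (g i2 i2) α)
                (prime-cancel pr (g i0 i0 - α) _ n (∣-resp-≡ (trans (block₁ (g i0 i0) (g i2 i2) (g i2 i0) α)
                  (cong (λ w → (g i2 i2 - α * 1ℤ) * (g i0 i0 - α * 1ℤ) - (g i2 i0 - α * 0ℤ) * (w - α * 0ℤ)) (sym z′)))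
                  (e i1 i1)))
                (prime-cancel pr (g i0 i0 - α) _ n (∣-resp-≡ (trans (block₂ (g i0 i0) (g i1 i1) (g i1 i0) α)
                  (cong (λ w → (g i0 i0 - α * 1ℤ) * (g i1 i1 - α * 1ℤ) - (w - α * 0ℤ) * (g i1 i0 - α * 0ℤ)) (sym z)))
                  (e i2 i2)))))
          where
          identity : ∀ x y a → y - x ≡ 1ℤ * (y - a) + -1ℤ * (x - a)
          identity = solve-∀
          block₁ : ∀ e y c a → (e - a) * (y - a) ≡ (y - a * 1ℤ) * (e - a * 1ℤ) - (c - a * 0ℤ) * (0ℤ - a * 0ℤ)
          block₁ = solve-∀
          block₂ : ∀ e y c a → (e - a) * (y - a) ≡ (e - a * 1ℤ) * (y - a * 1ℤ) - (0ℤ - a * 0ℤ) * (c - a * 0ℤ)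
          block₂ = solve-∀
        -- With α ≡ e, the minor of g - α at (0,0) gives e ≡ e (x + y) - 1 for the diagonal x, y of
        -- the block; multiplication by e, with e² = 1, yields y ≡ 1 + e - x.
        ... | yes d = ∈-++⁺ˡ (∈-residueClass q _ (Box.entry≤ b i2 i2)
              (∣-combine₂ (- g i0 i0) (- (g i0 i0 * (g i0 i0 + α - tr g + g i0 i0)))
                (trans (use-square (g i0 i0) (g i1 i1) (g i2 i2) (square-unit (proj₁ c)))
                  (trans (identity (g i0 i0) (g i1 i1) (g i2 i2) α)
                    (cong (λ w → - g i0 i0 * w + - (g i0 i0 * (g i0 i0 + α - tr g + g i0 i0)) * (g i0 i0 - α))
                      (trans (cong (_- (α * tr g - α * α - α * g i0 i0)) (sym (proj₂ c)))
                        (sym (adj-∸scalar-diagonal g α i0))))))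
                (e i0 i0) d))
          where
          c : g i0 i0 ∈ units × adj g i0 i0 ≡ g i0 i0
          c = corner g (Box.det≡1 b) r
          use-square : ∀ e x y → e * e ≡ 1ℤ → y - (1ℤ + e - x) ≡ e * e * (x + y) - e * e - e * e * e
          use-square e x y eq = trans (one e x y) (cong (λ s → s * (x + y) - s - s * e) (sym eq))
            where
            one : ∀ e x y → y - (1ℤ + e - x) ≡ 1ℤ * (x + y) - 1ℤ - 1ℤ * e
            one = solve-∀
          identity : ∀ e x y a → e * e * (x + y) - e * e - e * e * e ≡
            - e * (e - (a * (e + x + y) - a * a - a * e)) + - (e * (e + a - (e + x + y) + e)) * (e - a)
          identity = solve-∀

    eigenplane-bound : Bounded DistinctMat WithEigenplane (boxConstant ℕ.* (q ℕ.* q ℕ.* T ℕ.* E))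
    eigenplane-bound = bounded-≤
      (eigenplane-count {q} {A} {T} {E} {l = lB} {codes} {Δ} {lA} {boxConstant} {602} {84} {15625}
        (triples-count AB≤ AA≤ T≤ A≤ B≤ (length (residueClass q (6 ℕ.* A) 0ℤ)) (length (residueClass q (6 ℕ.* B) 0ℤ))
          (residueClass-length q (6 ℕ.* A) 0ℤ) (residueClass-length q (6 ℕ.* B) 0ℤ))
        (diagonal-count AB≤ AA≤ T≤ A≤ B≤ lB lB≤) (codes≡ Δ)
        (square≤sixth X) (1≤sixth X) (corner-count AB≤ AA≤ T≤ A≤ B≤ lA lA≤)
          (cube-count AB≤ AA≤ T≤ A≤ B≤) eigenplane-constant≤)
      (split-reducible eigenplane-irreducible (reducible-cases
        (λ { g (b , α , α∈ , e) → box-rot g b , α , α∈ , eigenplane-rot pr {g} α e })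
        (λ { g (b , α , α∈ , e) → box-transpose g b , α , α∈ , eigenplane-transpose pr {g} α e })
          eigenplane-rowReducible))

    private
      scalar-irreducible : Bounded DistinctMat (λ g → WithScalar g × ¬ Reducible g)
        (3 ℕ.* (lA ℕ.* (lB ℕ.* (lA ℕ.* (lB ℕ.* (lA ℕ.* (lB ℕ.* codes)))))))
      scalar-irreducible = bounded-⊆ (λ { g ((b , α , s) , n) → α , b , s , n }) (bounded-choose
        {Q = λ g α → Box A B g × ScalarMod pr g α × ¬ Reducible g}
        (bounded-fiber {_~_ = λ x y → + q ∣ x - y} (λ (g , α) → α) (congruent? pr) (cubic-roots pr 0ℤ 0ℤ -1ℤ)
          (λ (g , α) (b , s , _) → cube-root {α} g (Box.det≡1 b) s)
          (λ (g₀ , α) _ → bounded-map {Q = λ g → Box A B g × ScalarMod pr g α × ¬ Reducible g} proj₁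
            (λ _ _ _ _ ne → ne)
            (λ { (g , β) ((b , s , n) , d) → b , (λ i j → ∣-combine₂ 1ℤ (- idMat i j) (change (g i j) α β (idMat i j))
              (s i j) d) , n }) (leaf α))))
        where
        change : ∀ g a b e → g - a * e ≡ 1ℤ * (g - b * e) + - e * (a - b)
        change = solve-∀
        trace : ∀ {g α} → ScalarMod pr g α → + q ∣ tr g - + 3 * α
        trace {g} {α} s = ∣-combine₃ 1ℤ 1ℤ 1ℤ (identity (g i0 i0) (g i1 i1) (g i2 i2) α) (s i0 i0) (s i1 i1) (s i2 i2)
          where
          identity : ∀ a b c x → a + b + c - + 3 * x ≡ 1ℤ * (a - x * 1ℤ) + 1ℤ * (b - x * 1ℤ) + 1ℤ * (c - x * 1ℤ)
          identity = solve-∀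
        -- With the characteristic polynomial P, α³ - 1 = P(α) - α P′(α) - α² (tr g - 3α), and all
        -- three terms vanish modulo q.
        cube-root : ∀ {α} g → InSL3 g → ScalarMod pr g α → + q ∣ α * α * α + 0ℤ * (α * α) + 0ℤ * α + -1ℤ
        cube-root {α} g d≡1 s = let r = eigenplane⇒doubleRoot pr {g} {α} d≡1 (scalarMod⇒eigenplane pr {g} {α} s) in
          ∣-combine₃ 1ℤ (- α) (- (α * α)) (identity α (tr g) (tr (adj g)))
            (ℤ∣.∣-trans (ℤ∣.∣m⇒∣m*n (+ q) ℤ∣.∣-refl) (DoubleRoot.value r)) (DoubleRoot.derivative r) (trace {g} {α} s)
          where
          identity : ∀ x t s → x * x * x + 0ℤ * (x * x) + 0ℤ * x + -1ℤ ≡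
            1ℤ * (x * x * x - t * (x * x) + s * x - 1ℤ) + - x * (+ 3 * (x * x) - + 2 * (t * x) + s) + - (x * x) *
              (t - + 3 * x)
          identity = solve-∀
        diagonal : ∀ {g α} → ScalarMod pr g α → ∀ t → + q ∣ g t t - α
        diagonal {g} {α} s t = ∣-resp-≡ (trans (identity (g t t) α) (cong (λ z → g t t - α * z) (sym (idMat-diag t))))
          (s t t)
          where
          identity : ∀ a x → a - x ≡ a - x * 1ℤ
          identity = solve-∀
        -- The inverse is congruent to the scalar α⁻¹ = α².
        inverse-diagonal : ∀ {g α} → ScalarMod pr g α → ∀ t → + q ∣ adj g t t - α * α
        inverse-diagonal {g} {α} s t = ∣-combine₃ 1ℤ α (- α)
          (trans (identity (adj g t t) (tr g) (g t t) α)
            (cong (λ z → 1ℤ * z + α * (tr g - + 3 * α) + - α * (g t t - α)) (sym (adj-∸scalar-diagonal g α t))))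
          (scalarMod⇒eigenplane pr {g} {α} s t t) (trace {g} {α} s) (diagonal {g} {α} s t)
          where
          identity : ∀ h t d x → h - x * x ≡ 1ℤ * (h - (x * t - x * x - x * d)) + x * (t - + 3 * x) + - x * (d - x)
          identity = solve-∀
        leaf : ∀ α → Bounded DistinctMat (λ g → Box A B g × ScalarMod pr g α × ¬ Reducible g)
          (lA ℕ.* (lB ℕ.* (lA ℕ.* (lB ℕ.* (lA ℕ.* (lB ℕ.* codes))))))
        leaf α =
          bounded-fix-≤ (λ g → g i0 i0) (residueClass q A α) (class≤ A α) (λ g (b , s , _) → ∈-residueClass q α
            (Box.entry≤ b _ _) (diagonal {g} {α} s i0)) λ x →
          bounded-fix-≤ (λ g → adj g i0 i0) (residueClass q B (α * α)) (class≤ B (α * α))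
            (λ g ((b , s , _) , _) → ∈-residueClass q (α * α) (Box.inverse-entry≤ b i0 i0)
            (inverse-diagonal {g} {α} s i0)) λ x′ →
          bounded-fix-≤ (λ g → g i1 i1) (residueClass q A α) (class≤ A α) (λ g (((b , s , _) , _) , _)
            → ∈-residueClass q α (Box.entry≤ b _ _) (diagonal {g} {α} s i1)) λ y →
          bounded-fix-≤ (λ g → adj g i1 i1) (residueClass q B (α * α)) (class≤ B (α * α))
            (λ g ((((b , s , _) , _) , _) , _) → ∈-residueClass q (α * α) (Box.inverse-entry≤ b i1 i1)
            (inverse-diagonal {g} {α} s i1)) λ y′ →
          bounded-fix-≤ (λ g → g i2 i2) (residueClass q A α) (class≤ A α) (λ g (((((b , s , _) , _) , _) , _) , _)
            → ∈-residueClass q α (Box.entry≤ b _ _) (diagonal {g} {α} s i2)) λ z →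
          bounded-fix-≤ (λ g → adj g i2 i2) (residueClass q B (α * α)) (class≤ B (α * α))
            (λ g ((((((b , s , _) , _) , _) , _) , _) , _) → ∈-residueClass q (α * α) (Box.inverse-entry≤ b i2 i2)
            (inverse-diagonal {g} {α} s i2)) λ z′ →
          bounded-⊆ (λ { g (((((((b , s , nr) , ex) , ex′) , ey) , ey′) , ez) , ez′) → record
            { det≡1 = Box.det≡1 b ; irreducible = nr
            ; diagonal = λ { 0F → ex ; 1F → ey ; 2F → ez }
            ; inverse-diagonal = λ { 0F → ex′ ; 1F → ey′ ; 2F → ez′ }
            ; products≤ = box-product≤ AA≤X b ; cycles≤ = box-cycles≤ AAA≤X b } })
          (knownDiagonal-bound (vec x y z) (vec x′ y′ z′))

      offDiagonal∣ : ∀ {g α i j} → i ≢ j → ScalarMod pr g α → + q ∣ g i j - 0ℤ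
      offDiagonal∣ {g} {α} {i} {j} n s = ∣-resp-≡
        (trans (identity (g i j) α) (cong (λ z → g i j - α * z) (sym (idMat-≢ n)))) (s i j)
        where
        identity : ∀ a x → a - 0ℤ ≡ a - x * 0ℤ
        identity = solve-∀

      -- Irreducibility leaves a nonzero off-diagonal entry in row 0, and it is a multiple of q.
      scalar-irreducible-size : ∀ g → WithScalar g → ¬ Reducible g → q ℕ.≤ A
      scalar-irreducible-size g (b , α , s) nr with g i0 i1 ℤₚ.≟ 0ℤ | g i0 i2 ℤₚ.≟ 0ℤ
      ... | yes z | yes z′ = contradiction (0F , inj₁ (z , z′)) nr
      ... | no n | _ = size (g i0 i1) n (Box.entry≤ b _ _) (offDiagonal∣ {g} {α} {i0} {i1} (λ ()) s)
        where
        size : ∀ x → x ≢ 0ℤ → ∣ x ∣ ℕ.≤ A → + q ∣ x - 0ℤ → q ℕ.≤ A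
        size x x≢0 le d = ℕₚ.≮⇒≥ λ lt → x≢0 (∣-small⇒≡0 (∣-resp-≡ (sym (ℤₚ.+-identityʳ x)) d) (ℕₚ.≤-<-trans le lt))
      ... | yes _ | no n = size (g i0 i2) n (Box.entry≤ b _ _) (offDiagonal∣ {g} {α} {i0} {i2} (λ ()) s)
        where
        size : ∀ x → x ≢ 0ℤ → ∣ x ∣ ℕ.≤ A → + q ∣ x - 0ℤ → q ℕ.≤ A
        size x x≢0 le d = ℕₚ.≮⇒≥ λ lt → x≢0 (∣-small⇒≡0 (∣-resp-≡ (sym (ℤₚ.+-identityʳ x)) d) (ℕₚ.≤-<-trans le lt))

      ScalarRow : Mat3 → Set
      ScalarRow g = WithScalar g × RowReducible g

      corner-congruent : ∀ g → ScalarRow g → ∀ i → + q ∣ g i i - g i0 i0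
      corner-congruent g ((_ , α , s) , _) i = ∣-combine₂ 1ℤ -1ℤ
        (trans (identity (g i i) (g i0 i0) α) (cong (λ z → 1ℤ * (g i i - α * z) + -1ℤ * (g i0 i0 - α * 1ℤ))
          (sym (idMat-diag i))))
        (s i i) (s i0 i0)
        where
        identity : ∀ a e x → a - e ≡ 1ℤ * (a - x * 1ℤ) + -1ℤ * (e - x * 1ℤ)
        identity = solve-∀

      scalar-rowReducible : Bounded DistinctMat ScalarRow
        (2 ℕ.* (lA ℕ.* (lA ℕ.* ((lA ℕ.+ lA) ℕ.* (lA ℕ.* (2 ℕ.* Δ ℕ.* (2 ℕ.* Δ ℕ.* 1))) ℕ.+ 2 ℕ.*
          (2 ℕ.* (lA ℕ.* 1 ℕ.+ lA ℕ.* 1))))))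
      scalar-rowReducible = bounded-⊆ (λ g r → r , proj₂ r)
        (rowReducible-bound (residueClass q A 0ℤ) (residueClass q A 1ℤ ++ residueClass q A -1ℤ) (residueClass q A 0ℤ)
          (λ e x → residueClass q A e)
          ℕₚ.≤-refl
          (ℕₚ.≤-trans (ℕₚ.≤-reflexive (length-++ (residueClass q A 1ℤ))) (ℕₚ.+-mono-≤ (class≤ A 1ℤ) (class≤ A -1ℤ)))
          ℕₚ.≤-refl (λ e x → class≤ A e)
          (λ g ((b , _) , _) → Box.det≡1 b)
          (λ g (w , _) → off g w i1 i0 (λ ())) (λ g (w , _) → off g w i2 i0 (λ ()))
          (λ g r@((b , _) , z) → class g (Box.entry≤ b i1 i1) (corner-congruent g r i1)
            (proj₁ (corner g (Box.det≡1 b) z)))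
          (λ g r@((b , _) , _) _ → ∈-residueClass q (g i0 i0) (Box.entry≤ b i2 i2) (corner-congruent g r i2))
          (λ g (w , _) → off g w i1 i2 (λ ())) (λ g (w , _) → off g w i2 i1 (λ ()))
          (λ g ((b , _) , _) → box-product≤ AA≤X b i1 i2))
        where
        off : ∀ g → WithScalar g → ∀ i j → i ≢ j → g i j ∈ residueClass q A 0ℤ
        off g (b , α , s) i j n = ∈-residueClass q 0ℤ (Box.entry≤ b i j) (offDiagonal∣ {g} {α} {i} {j} n s)
        class : ∀ g → ∣ g i1 i1 ∣ ℕ.≤ A → + q ∣ g i1 i1 - g i0 i0 → g i0 i0 ∈ units
          → g i1 i1 ∈ residueClass q A 1ℤ ++ residueClass q A -1ℤ
        class g le d (here e) = ∈-++⁺ˡ (∈-residueClass q 1ℤ le (subst (λ z → + q ∣ g i1 i1 - z) e d))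
        class g le d (there (here e)) = ∈-++⁺ʳ (residueClass q A 1ℤ)
          (∈-residueClass q -1ℤ le (subst (λ z → + q ∣ g i1 i1 - z) e d))

      scalar-reducible : Bounded DistinctMat (λ g → WithScalar g × Reducible g)
        (6 ℕ.* (2 ℕ.* (lA ℕ.* (lA ℕ.* ((lA ℕ.+ lA) ℕ.* (lA ℕ.* (2 ℕ.* Δ ℕ.* (2 ℕ.* Δ ℕ.* 1))) ℕ.+ 2 ℕ.*
          (2 ℕ.* (lA ℕ.* 1 ℕ.+ lA ℕ.* 1)))))))
      scalar-reducible = reducible-cases (λ { g (b , α , s) → box-rot g b , α , scalarMod-rot pr {g} α s })
        (λ { g (b , α , s) → box-transpose g b , α , scalarMod-transpose pr {g} α s }) scalar-rowReducible

    -- The count of the irreducible matrices relies on q ≤ A. For A < q there are none, and only the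
    -- reducible ones contribute.
    scalar-bound : Bounded DistinctMat WithScalar (boxConstant ℕ.* (T ℕ.* E))
    scalar-bound with q ℕₚ.≤? A
    ... | yes q≤A = bounded-≤
      (scalar-count {T} {E} {boxConstant} {lA} {lB} {codes} {Δ} {lA} {3} {48 ℕ.* 48 ℕ.* 48} {15625} {1296}
        (scalar-diagonal-count AB≤ AA≤ T≤ A≤ B≤ lA lB q≤A (ℕₚ.≤-trans q≤A A≤2B) lA≤ lB≤) (codes≡ Δ)
        (square≤sixth X) (1≤sixth X) (scalar-corner-count AB≤ AA≤ T≤ A≤ B≤ lA 1≤T lA≤) scalar-constant≤)
      (split-reducible scalar-irreducible scalar-reducible)
    ... | no q≰A = bounded-≤
      (scalar-reducible-count {T} {E} {boxConstant} {Δ} {lA} {1296}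
        (square≤sixth X) (1≤sixth X) (scalar-corner-count AB≤ AA≤ T≤ A≤ B≤ lA 1≤T lA≤)
          (ℕₚ.≤-trans (ℕₚ.m≤n+m (192 ℕ.* 1296) (3 ℕ.* (48 ℕ.* 48 ℕ.* 48) ℕ.* 15625)) scalar-constant≤))
      (split-reducible (bounded-empty λ g (w , nr) → q≰A (scalar-irreducible-size g w nr)) scalar-reducible)

-- Summation over the scales

module _ where
  open import Data.Nat.Base using (_+_; _*_; _^_; _≤_; _<_)
  open ℕₚ.≤-Reasoning

  dyadic : ∀ n → 1 ≤ n → ∃[ a ] (n ≤ 2 ^ a × 2 ^ a ≤ 2 * n)
  dyadic (suc zero) _ = 0 , ℕₚ.≤-refl , s≤s z≤n
  dyadic (suc (suc n)) _ with dyadic (suc n) (s≤s z≤n)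
  ... | a , lo , hi with ℕₚ.m≤n⇒m<n∨m≡n lo
  ... | inj₁ lt = a , lt , ℕₚ.≤-trans hi (ℕₚ.*-monoʳ-≤ 2 (ℕₚ.n≤1+n (suc n)))
  ... | inj₂ eq = suc a , subst (λ z → suc (suc n) ≤ 2 * z) eq
    (s≤s (ℕₚ.≤-trans (ℕₚ.m≤m+n (suc n) 0) (ℕₚ.m≤n+m (suc n + 0) n)))
                , ℕₚ.*-monoʳ-≤ 2 (ℕₚ.≤-trans (ℕₚ.≤-reflexive (sym eq)) (ℕₚ.n≤1+n (suc n)))

  -- Turns the dyadic scales below 2^L into divisors of 2^L, so that `maxDivisors` bounds their
  -- number.
  power-divides : ∀ {a L} → 2 ^ a ≤ 2 ^ L → 2 ^ a ∣ℕ 2 ^ L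
  power-divides {a} {L} le with ℕₚ.≤-total a L
  ... | inj₁ a≤L = dividesℕ (2 ^ (L ℕ.∸ a)) (trans (cong (2 ^_) (sym (ℕₚ.m∸n+n≡m a≤L)))
    (ℕₚ.^-distribˡ-+-* 2 (L ℕ.∸ a) a))
  ... | inj₂ L≤a with ℕₚ.m≤n⇒m<n∨m≡n L≤a
  ... | inj₁ L<a = contradiction le (ℕₚ.<⇒≱ (ℕₚ.^-monoʳ-< 2 (s≤s (s≤s z≤n)) L<a))
  ... | inj₂ refl = ℕ∣.∣-refl

  private
    no-shrink : ∀ {x} m n → 1 ≤ x → n < m → ¬ m * x ≤ n * x
    no-shrink {x} m n 1≤x n<m le = ℕₚ.<⇒≱ n<m (ℕₚ.*-cancelʳ-≤ m n x {{>-nonZero 1≤x}} le)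

  norm≥1 : ∀ {g} → InSL3 g → 1 ≤ normInf g
  norm≥1 {g} d≡1 = let a , n = dot≡1⇒nonzeroʳ {adj g i0} {column g i0} (adj-dot {g} d≡1 i0 i0) in
    ℕₚ.≤-trans (nonzero⇒1≤∣∣ n) (entry≤norm g a i0)

  adj-norm≥1 : ∀ {g} → InSL3 g → 1 ≤ normInf (adj g)
  adj-norm≥1 {g} d≡1 = let a , n = dot≡1⇒nonzeroˡ {adj g i0} {column g i0} (adj-dot {g} d≡1 i0 i0) in
    ℕₚ.≤-trans (nonzero⇒1≤∣∣ n) (entry≤norm (adj g) i0 a)

  adj-adj-small : ∀ {g} → InSL3 g → MatEq (adj (adj g)) g
  adj-adj-small {g} d≡1 i j = trans (adj-adj g i j) (trans (cong (ℤ._* g i j) d≡1) (ℤₚ.*-identityˡ (g i j)))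

  small-adj : ∀ {T g} → Small T g → Small T (adj g)
  small-adj {g = g} s = record
    { det≡1 = trans (det-adj g) (cong₂ ℤ._*_ (Small.det≡1 s) (Small.det≡1 s))
    ; norm≤ = ℕₚ.≤-trans
      (ℕₚ.≤-reflexive (trans
      (cong (normInf (adj g) *_) (norm-cong {adj (adj g)} {g} (adj-adj-small {g} (Small.det≡1 s))))
      (ℕₚ.*-comm (normInf (adj g)) (normInf g)))) (Small.norm≤ s) }

  -- The value 2q⁶ dominates every number that is factored. The largest are the sums of two
  -- 3-cycles, at most 2A³ with A ≤ q².
  searchBound : ℕ → ℕ
  searchBound q = q * q * q * (q * q * q) + q * q * q * (q * q * q)

  abstract
    -- The reciprocal of the constant C of the theorem. It must exceed 144 = 6² · 4, to force 6A <
    -- q², and its square must exceed 3456 = 2 · 12³, to force 6B < q².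
    sizeConstant : ℕ
    sizeConstant = 145

    145≤sizeConstant : 145 ≤ sizeConstant
    145≤sizeConstant = ℕₚ.≤-refl

    3456<sizeConstant² : 3456 < sizeConstant * sizeConstant
    3456<sizeConstant² = ℕₚ.m≤m+n 3457 17568

  module _ {q T : ℕ} .{{_ : NonZero q}} (1≤T : 1 ≤ T) (T≪ : sizeConstant * T ≤ q * q * q) where

    private
      1≤qqq : 1 ≤ q * q * q
      1≤qqq = >-nonZero⁻¹ (q * q * q) {{ℕₚ.m*n≢0 (q * q) q {{ℕₚ.m*n≢0 q q}}}}

      1≤q⁶ : 1 ≤ q * q * q * (q * q * q)
      1≤q⁶ = ℕₚ.*-mono-≤ 1≤qqq 1≤qqq

      qqq≤q⁶ : q * q * q ≤ q * q * q * (q * q * q)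
      qqq≤q⁶ = ℕₚ.m≤m*n (q * q * q) (q * q * q) {{>-nonZero 1≤qqq}}

    T≤qqq : T ≤ q * q * q
    T≤qqq = ℕₚ.≤-trans (ℕₚ.m≤n*m T sizeConstant {{>-nonZero (ℕₚ.≤-trans (s≤s z≤n) 145≤sizeConstant)}}) T≪

    T+T≤searchBound : T + T ≤ searchBound q
    T+T≤searchBound = ℕₚ.+-mono-≤ (ℕₚ.≤-trans T≤qqq qqq≤q⁶) (ℕₚ.≤-trans T≤qqq qqq≤q⁶)

    4T≤searchBound : 4 * T ≤ searchBound q
    4T≤searchBound = ℕₚ.≤-trans (ℕₚ.*-monoˡ-≤ T (ℕₚ.≤-trans (ℕₚ.m≤m+n 4 141) 145≤sizeConstant))
      (ℕₚ.≤-trans T≪ (ℕₚ.≤-trans qqq≤q⁶ (ℕₚ.m≤m+n (q * q * q * (q * q * q)) (q * q * q * (q * q * q)))))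

    -- For A: (6A)² ≤ 144 T < q³. For B: an inverse has entries of size m ≤ 2n², so m³ ≤ 2 (n m)² ≤
    -- 2 T² and (6B)³ ≤ 3456 T² < q⁶.
    scale : ∀ {n m A B} → 1 ≤ n → n ≤ m → m ≤ n * n + n * n → n * m ≤ T → n ≤ A → A ≤ 2 * n → m ≤ B → B ≤ 2 * m →
            Scale q A B T (searchBound q)
    scale {n} {m} {A} {B} 1≤n n≤m m≤ nm≤T n≤A A≤ m≤B B≤ = record
      { 1≤T = 1≤T ; 1≤A = ℕₚ.≤-trans 1≤n n≤A ; AB≤ = AB≤4T ; AA≤ = AA≤4T
      ; A≤2B = ℕₚ.≤-trans A≤ (ℕₚ.*-monoʳ-≤ 2 (ℕₚ.≤-trans n≤m m≤B))
      ; 6A< = 6A<qq ; 6B< = ℕₚ.≰⇒> 6B≱ ; T≤ = T≤qqq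
      ; AA≤X = ℕₚ.≤-trans AA≤4T 4T≤searchBound
      ; AAA≤X = ℕₚ.+-mono-≤ AAA≤ AAA≤ }
      where
      AB≤4T : A * B ≤ 4 * T
      AB≤4T = begin
        A * B              ≤⟨ ℕₚ.*-mono-≤ A≤ B≤ ⟩
        2 * n * (2 * m)    ≡⟨ identity n m ⟩
        4 * (n * m)        ≤⟨ ℕₚ.*-monoʳ-≤ 4 nm≤T ⟩
        4 * T              ∎
        where
        identity : ∀ n m → 2 * n * (2 * m) ≡ 4 * (n * m)
        identity = solveℕ-∀
      AA≤4T : A * A ≤ 4 * T
      AA≤4T = begin
        A * A              ≤⟨ ℕₚ.*-mono-≤ A≤ A≤ ⟩
        2 * n * (2 * n)    ≡⟨ identity n ⟩
        4 * (n * n)        ≤⟨ ℕₚ.*-monoʳ-≤ 4 (ℕₚ.≤-trans (ℕₚ.*-monoʳ-≤ n n≤m) nm≤T) ⟩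
        4 * T              ∎
        where
        identity : ∀ n → 2 * n * (2 * n) ≡ 4 * (n * n)
        identity = solveℕ-∀
      6A≱ : ¬ q * q ≤ 6 * A
      6A≱ le = no-shrink {q * q * q * q} sizeConstant 144 (ℕₚ.*-mono-≤ 1≤qqq (>-nonZero⁻¹ q)) 145≤sizeConstant (begin
        sizeConstant * (q * q * q * q)     ≡⟨ identity₁ sizeConstant q ⟩
        sizeConstant * (q * q * (q * q))   ≤⟨ ℕₚ.*-monoʳ-≤ sizeConstant (ℕₚ.*-mono-≤ le le) ⟩
        sizeConstant * (6 * A * (6 * A))   ≡⟨ identity₂ sizeConstant A ⟩
        sizeConstant * (36 * (A * A))      ≤⟨ ℕₚ.*-monoʳ-≤ sizeConstant (ℕₚ.*-monoʳ-≤ 36 AA≤4T) ⟩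
        sizeConstant * (36 * (4 * T))      ≡⟨ identity₃ sizeConstant T ⟩
        144 * (sizeConstant * T)           ≤⟨ ℕₚ.*-monoʳ-≤ 144 (ℕₚ.≤-trans T≪ (ℕₚ.m≤m*n (q * q * q) q)) ⟩
        144 * (q * q * q * q)      ∎)
        where
        identity₁ : ∀ c q → c * (q * q * q * q) ≡ c * (q * q * (q * q))
        identity₁ = solveℕ-∀
        identity₂ : ∀ c A → c * (6 * A * (6 * A)) ≡ c * (36 * (A * A))
        identity₂ = solveℕ-∀
        identity₃ : ∀ c T → c * (36 * (4 * T)) ≡ 144 * (c * T)
        identity₃ = solveℕ-∀
      6A<qq : 6 * A < q * q
      6A<qq = ℕₚ.≰⇒> 6A≱
      A≤qq : A ≤ q * q
      A≤qq = ℕₚ.≤-trans (ℕₚ.m≤n*m A 6) (ℕₚ.<⇒≤ 6A<qq)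
      AAA≤ : A * A * A ≤ q * q * q * (q * q * q)
      AAA≤ = ℕₚ.≤-trans (ℕₚ.*-mono-≤ (ℕₚ.*-mono-≤ A≤qq A≤qq) A≤qq) (ℕₚ.≤-reflexive (identity q))
        where
        identity : ∀ q → q * q * (q * q) * (q * q) ≡ q * q * q * (q * q * q)
        identity = solveℕ-∀
      6B≱ : ¬ q * q ≤ 6 * B
      6B≱ le = no-shrink {q * q * q * (q * q * q)} (sizeConstant * sizeConstant) 3456 1≤q⁶ 3456<sizeConstant² (begin
        sizeConstant * sizeConstant * (q * q * q * (q * q * q))       ≡⟨ identity₁ (sizeConstant * sizeConstant) q ⟩
        sizeConstant * sizeConstant * (q * q * (q * q) * (q * q))     ≤⟨ ℕₚ.*-monoʳ-≤ (sizeConstant * sizeConstant)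
          (ℕₚ.*-mono-≤ (ℕₚ.*-mono-≤ 6B≤ 6B≤) 6B≤) ⟩
        sizeConstant * sizeConstant * (12 * m * (12 * m) * (12 * m))  ≡⟨ identity₂ (sizeConstant * sizeConstant) m ⟩
        sizeConstant * sizeConstant * (1728 * (m * m * m))            ≤⟨ ℕₚ.*-monoʳ-≤ (sizeConstant * sizeConstant)
          (ℕₚ.*-monoʳ-≤ 1728 (ℕₚ.*-monoʳ-≤ (m * m) m≤)) ⟩
        sizeConstant * sizeConstant * (1728 * (m * m * (n * n + n * n)))  ≡⟨ identity₃ sizeConstant 1728 n m ⟩
        2 * 1728 * (sizeConstant * (n * m) * (sizeConstant * (n * m)))    ≤⟨ ℕₚ.*-monoʳ-≤ (2 * 1728)
          (ℕₚ.*-mono-≤ nm≤ nm≤) ⟩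
        2 * 1728 * (q * q * q * (q * q * q))          ∎)
        where
        nm≤ : sizeConstant * (n * m) ≤ q * q * q
        nm≤ = ℕₚ.≤-trans (ℕₚ.*-monoʳ-≤ sizeConstant nm≤T) T≪
        6B≤ : q * q ≤ 12 * m
        6B≤ = ℕₚ.≤-trans le (ℕₚ.≤-trans (ℕₚ.*-monoʳ-≤ 6 B≤) (ℕₚ.≤-reflexive (identity m)))
          where
          identity : ∀ m → 6 * (2 * m) ≡ 12 * m
          identity = solveℕ-∀
        identity₁ : ∀ c q → c * (q * q * q * (q * q * q)) ≡ c * (q * q * (q * q) * (q * q))
        identity₁ = solveℕ-∀
        identity₂ : ∀ c m → c * (12 * m * (12 * m) * (12 * m)) ≡ c * (1728 * (m * m * m))
        identity₂ = solveℕ-∀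
        identity₃ : ∀ c d n m → c * c * (d * (m * m * (n * n + n * n))) ≡ 2 * d * (c * (n * m) * (c * (n * m)))
        identity₃ = solveℕ-∀

    module _ (Q : Mat3 → Set) (Q-adj : ∀ g → InSL3 g → Q g → Q (adj g)) {N : ℕ}
      (bound : ∀ A B → Scale q A B T (searchBound q) → Bounded DistinctMat (λ g → Box A B g × Q g) N) where

      private
        Δ = maxDivisors (searchBound q)
        top = dyadic (2 * T) (ℕₚ.≤-trans 1≤T (ℕₚ.m≤n*m T 2))
        L = proj₁ top
        scales : List ℕ
        scales = divisorList (2 ^ L)

        scales≤ : length scales ≤ Δ
        scales≤ = divisorList-≤-max (searchBound q) (2 ^ L) (begin
          2 ^ L          ≤⟨ proj₂ (proj₂ top) ⟩
          2 * (2 * T)    ≡⟨ identity T ⟩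
          4 * T          ≤⟨ 4T≤searchBound ⟩
          searchBound q  ∎)
          where
          identity : ∀ T → 2 * (2 * T) ≡ 4 * T
          identity = solveℕ-∀

        ∈-scales : ∀ n → 1 ≤ n → n ≤ T → ∃[ A ] (A ∈ scales × n ≤ A × A ≤ 2 * n)
        ∈-scales n 1≤n n≤T with dyadic n 1≤n
        ... | a , lo , hi = 2 ^ a , ∈-divisorList
          (power-divides {a} {L} (ℕₚ.≤-trans hi (ℕₚ.≤-trans (ℕₚ.*-monoʳ-≤ 2 n≤T) (proj₁ (proj₂ top)))))
                              (ℕₚ.m^n>0 2 L) , lo , hi

        Half : Mat3 → Set
        Half g = (Small T g × Q g) × normInf g ≤ normInf (adj g)

        AtScale : Mat3 → ℕ × ℕ → Set
        AtScale g (A , B) = (normInf g ≤ A × A ≤ 2 * normInf g) × (normInf (adj g) ≤ B × B ≤ 2 * normInf (adj g))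

        half-bound : Bounded DistinctMat Half (Δ * Δ * N)
        half-bound = bounded-cover-≤ AtScale (cartesianProduct scales scales)
          (ℕₚ.≤-trans (ℕₚ.≤-reflexive (length-cartesianProduct scales scales))
            (ℕₚ.*-mono-≤ scales≤ scales≤)) find-scale
          -- Any matrix found at the scale (A, B) certifies the inequalities that `Scale` demands of
          -- A and B.
          λ (A , B) → bounded-based λ g (((s , _) , le) , (lo , hi) , (lo′ , hi′)) →
            bounded-⊆ (λ h (((s , Qh) , _) , (lo , _) , (lo′ , _)) → record
              { det≡1 = Small.det≡1 s ; entry≤ = λ i j → ℕₚ.≤-trans (entry≤norm h i j) lo
              ; inverse-entry≤ = λ i j → ℕₚ.≤-trans (entry≤norm (adj h) i j) lo′ } , Qh)
              (bound A B (scale (norm≥1 {g} (Small.det≡1 s)) le (norm-least (adj g) (adj-≤ g (entry≤norm g)))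
                (Small.norm≤ s) lo hi lo′ hi′))
          where
          find-scale : ∀ g → Half g → Any (AtScale g) (cartesianProduct scales scales)
          find-scale g ((s , _) , _) =
            let 1≤n = norm≥1 {g} (Small.det≡1 s)
                1≤m = adj-norm≥1 {g} (Small.det≡1 s)
                A , A∈ , a = ∈-scales (normInf g) 1≤n
                  (ℕₚ.≤-trans (ℕₚ.m≤m*n (normInf g) (normInf (adj g)) {{>-nonZero 1≤m}}) (Small.norm≤ s))
                B , B∈ , b = ∈-scales (normInf (adj g)) 1≤m
                  (ℕₚ.≤-trans (ℕₚ.m≤n*m (normInf (adj g)) (normInf g) {{>-nonZero 1≤n}}) (Small.norm≤ s))
            in lose (∈-cartesianProduct⁺ A∈ B∈) (a , b)

      -- Replacing g by its inverse, one may assume that g is not larger than its inverse.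
      symmetrised-bound : Bounded DistinctMat (λ g → Small T g × Q g) (Δ * Δ * N + Δ * Δ * N)
      symmetrised-bound = bounded-⊎ {O = λ g → Half (adj g) × InSL3 g} classify half-bound
        (bounded-map adj (λ g h (_ , d) (_ , d′) ne eq → ne (inverse-determines {g} {h} d d′ eq))
          (λ g (h , _) → h) half-bound)
        where
        classify : ∀ g → Small T g × Q g → Half g ⊎ (Half (adj g) × InSL3 g)
        classify g (s , Qg) with ℕₚ.≤-total (normInf g) (normInf (adj g))
        ... | inj₁ le = inj₁ ((s , Qg) , le)
        ... | inj₂ ge = inj₂ (((small-adj {g = g} s , Q-adj g (Small.det≡1 s) Qg) ,
                ℕₚ.≤-trans ge (ℕₚ.≤-reflexive
                  (sym (norm-cong {adj (adj g)} {g} (adj-adj-small {g} (Small.det≡1 s)))))) , Small.det≡1 s)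

-- Counting pairs of a matrix and a fixed flag

module _ where
  open import Data.Integer.Base using (_+_; _*_; _-_; -_)

  matEq? : ∀ g h → Dec (MatEq g h)
  matEq? g h = all? λ i → all? λ j → g i j ℤₚ.≟ h i j

  module _ {q : ℕ} (pr : Prime q) where

    private instance
      q≢0 : NonZero q
      q≢0 = prime⇒nonZero pr

    eigenplane? : ∀ g α → Dec (Eigenplane pr g α)
    eigenplane? g α = all? λ i → all? λ j → + q ∣? adj (g ∸scalar α) i j

    scalarMod? : ∀ g α → Dec (ScalarMod pr g α)
    scalarMod? g α = all? λ i → all? λ j → + q ∣? (g ∸scalar α) i j

    ∃-nondivisible : ∀ (N : Mat3) → ¬ (∀ i j → + q ∣ N i j) → ∃[ i ] ∃[ j ] ¬ + q ∣ N i j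
    ∃-nondivisible N n =
      let i , ni = ¬∀⟶∃¬ 3 (λ i → ∀ j → + q ∣ N i j) (λ i → all? λ j → + q ∣? N i j) n
          j , nj = ¬∀⟶∃¬ 3 (λ j → + q ∣ N i j) (λ j → + q ∣? N i j) ni
      in i , j , nj

    eigenplane-residue : ∀ {g α r} → + q ∣ α - r → Eigenplane pr g α → Eigenplane pr g r
    eigenplane-residue {g} {α} {r} d e i j = ∣-resp-≡ (identity (adj M i j) (adj N i j))
      (ℤ∣.∣m∣n⇒∣m+n (e i j) (minor (next j) (next i) (prev j) (prev i) (next j) (prev i) (prev j) (next i)))
      where
      M = g ∸scalar r
      N = g ∸scalar α
      identity : ∀ m n → m ≡ n + (m - n)
      identity = solve-∀
      shift-∣ : ∀ i j → + q ∣ M i j - N i j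
      shift-∣ i j = ∣-combine₁ (idMat i j) (difference (g i j) α r (idMat i j)) d
        where
        difference : ∀ g a r e → g - r * e - (g - a * e) ≡ e * (a - r)
        difference = solve-∀
      minor : ∀ a b c d a′ b′ c′ d′ → + q ∣ M a b * M c d - M a′ b′ * M c′ d′ - (N a b * N c d - N a′ b′ * N c′ d′)
      minor a b c d a′ b′ c′ d′ = ∣-combine₄ (M c d) (N a b) (- M c′ d′) (- N a′ b′)
        (expand (M a b) (M c d) (M a′ b′) (M c′ d′) (N a b) (N c d) (N a′ b′) (N c′ d′)) (shift-∣ a b) (shift-∣ c d)
          (shift-∣ a′ b′) (shift-∣ c′ d′)
        where
        expand : ∀ a b c d e f g h → a * b - c * d - (e * f - g * h) ≡ b * (a - e) + e * (b - f) + - d *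
          (c - g) + - g * (d - h)
        expand = solve-∀

    HasEigenplane IsScalar Regular : Mat3 → Set
    HasEigenplane g = ∃[ α ] (α ∈ residues q × Eigenplane pr g α)
    IsScalar g = ∃[ α ] ScalarMod pr g α
    Regular g = ∀ α → ∃[ i ] ∃[ j ] ¬ + q ∣ adj (g ∸scalar α) i j

    hasEigenplane-adj : ∀ g → InSL3 g → HasEigenplane g → HasEigenplane (adj g)
    hasEigenplane-adj g _ (α , _ , e) = let β , e′ = eigenplane-adj pr {g} {α} e ; r , r∈ , d = residue pr β in
      r , r∈ , eigenplane-residue {adj g} {β} {r} d e′

    isScalar-adj : ∀ g → InSL3 g → IsScalar g → IsScalar (adj g)
    isScalar-adj g _ (α , s) = scalarMod-adj pr {g} {α} s

    NonscalarEigenplane : Mat3 → Set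
    NonscalarEigenplane g = ∃[ α ] (α ∈ residues q × Eigenplane pr g α × ∃[ i ] ∃[ j ] ¬ + q ∣ (g ∸scalar α) i j)

    classify : ∀ g → Regular g ⊎ (NonscalarEigenplane g ⊎ IsScalar g)
    classify g with Any.any? (eigenplane? g) (residues q)
    ... | no n = inj₁ λ α → ∃-nondivisible (adj (g ∸scalar α)) λ e →
            let r , r∈ , d = residue pr α in n (lose r∈ (eigenplane-residue {g} {α} {r} d e))
    ... | yes p with find p
    ... | α , α∈ , e with scalarMod? g α
    ... | yes s = inj₂ (inj₂ (α , s))
    ... | no n = inj₂ (inj₁ (α , α∈ , e , ∃-nondivisible (g ∸scalar α) n))

    FixedFlag : (Mat3 → Set) → Mat3 × FlagRep q → Set
    FixedFlag S (g , x) = S g × EigenFlag pr g x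

    -- The fibres of the projection to matrices: over one matrix, distinct pairs have distinct
    -- flags.
    fixedFlags-bound : ∀ {S M N} → Bounded DistinctMat S N → (∀ g → S g → Bounded (DistinctFlags pr)
      (EigenFlag pr g) M) →
                       Bounded (Distinct q) (FixedFlag S) (N ℕ.* M)
    fixedFlags-bound {S} matrices flags = bounded-fiber {_~_ = MatEq} proj₁ matEq? matrices (λ _ → proj₁)
      λ (g₀ , _) (s₀ , _) → bounded-map proj₂
        (λ { (g , x) (h , y) (_ , eq) (_ , eq′) ne same → ne ((λ i j → trans (sym (eq i j)) (eq′ i j)) , same) })
        (λ { (g , x) ((_ , e) , eq) → eigenFlag-cong pr {g} {g₀} {x} (λ i j → sym (eq i j)) e })
        (flags g₀ s₀)

    module _ {T : ℕ} (1≤T : 1 ℕ.≤ T) (T≪ : sizeConstant ℕ.* T ℕ.≤ q ℕ.* q ℕ.* q) where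

      private
        X = searchBound q
        Δ = maxDivisors X
        E = sixth-power Δ

      good⇒small : ∀ z → Good q T z → Small T (proj₁ z) × EigenFlag pr (proj₁ z) (proj₂ z)
      good⇒small (g , x) (d≡1 , (h , gh≡1 , _ , le) , fix) =
        record { det≡1 = d≡1 ; norm≤ = ℕₚ.≤-trans
            (ℕₚ.≤-reflexive (cong (normInf g ℕ.*_) (sym (norm-cong {h} {adj g} (right-inverse≡adj g h d≡1 gh≡1))))) le
            } ,
        fixes⇒eigenFlag pr g x fix

      good-bound : Bounded (Distinct q) (Good q T)
        (smallConstant ℕ.* (T ℕ.* T ℕ.* Δ ℕ.^ 6) ℕ.* (3 ℕ.* (3 ℕ.* 1)) ℕ.+
          ((Δ ℕ.* Δ ℕ.* (boxConstant ℕ.* (q ℕ.* q ℕ.* T ℕ.* E)) ℕ.+ Δ ℕ.* Δ ℕ.*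
            (boxConstant ℕ.* (q ℕ.* q ℕ.* T ℕ.* E))) ℕ.* (suc q ℕ.* 1 ℕ.+ (suc q ℕ.* 1 ℕ.+ suc q ℕ.* 1)) ℕ.+
           (Δ ℕ.* Δ ℕ.* (boxConstant ℕ.* (T ℕ.* E)) ℕ.+ Δ ℕ.* Δ ℕ.* (boxConstant ℕ.* (T ℕ.* E))) ℕ.*
             (3 ℕ.* (q ℕ.* q) ℕ.* (suc q ℕ.* 1))))
      good-bound = bounded-⊎ {Q = FixedFlag (λ g → Small T g × Regular g)}
        {O = λ z → FixedFlag (λ g → Small T g × NonscalarEigenplane g) z ⊎ FixedFlag (λ g → Small T g × IsScalar g) z}
        (λ z good → let s , e = good⇒small z good in sort z s e (classify (proj₁ z)))
        (fixedFlags-bound {S = λ g → Small T g × Regular g}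
          (bounded-⊆ (λ _ → proj₁) (small-bound 1≤T (T+T≤searchBound 1≤T T≪)))
          λ g (s , regular) → regularFlags-bound pr {g} (Small.det≡1 s) regular)
        (bounded-⊎ {Q = FixedFlag (λ g → Small T g × NonscalarEigenplane g)}
          {O = FixedFlag (λ g → Small T g × IsScalar g)} (λ _ c → c)
          (fixedFlags-bound {S = λ g → Small T g × NonscalarEigenplane g}
            (bounded-⊆ (λ { g (s , α , α∈ , e , _) → s , α , α∈ , e })
              (symmetrised-bound 1≤T T≪ HasEigenplane hasEigenplane-adj λ A B scale → eigenplane-bound pr scale))
            λ { g (s , α , _ , e , i , j , n) → nonscalarFlags-bound pr {g} {α} i j e n })
          (fixedFlags-bound {S = λ g → Small T g × IsScalar g}
            (symmetrised-bound 1≤T T≪ IsScalar isScalar-adj λ A B scale → scalar-bound pr scale)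
            λ _ _ → bounded-⊆ (λ _ _ → tt) (allFlags-bound pr)))
        where
        sort : ∀ z → Small T (proj₁ z) → EigenFlag pr (proj₁ z) (proj₂ z) → Regular (proj₁ z) ⊎
          (NonscalarEigenplane (proj₁ z) ⊎ IsScalar (proj₁ z)) →
               FixedFlag (λ g → Small T g × Regular g) z ⊎ (FixedFlag (λ g → Small T g × NonscalarEigenplane g) z
                 ⊎ FixedFlag (λ g → Small T g × IsScalar g) z)
        sort z s e (inj₁ r) = inj₁ ((s , r) , e)
        sort z s e (inj₂ (inj₁ r)) = inj₂ (inj₁ ((s , r) , e))
        sort z s e (inj₂ (inj₂ r)) = inj₂ (inj₂ ((s , r) , e))

-- The final estimate

module _ where
  open import Data.Nat.Base using (_+_; _*_; _^_; _≤_; _<_)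
  open ℕₚ.≤-Reasoning

  flagCount : ℕ → ℕ → ℕ → ℕ → ℕ → ℕ
  flagCount a b q T Δ = a * (T * T * Δ ^ 6) * (3 * (3 * 1)) +
    ((Δ * Δ * (b * (q * q * T * sixth-power Δ)) + Δ * Δ * (b * (q * q * T * sixth-power Δ))) *
      (suc q * 1 + (suc q * 1 + suc q * 1)) +
     (Δ * Δ * (b * (T * sixth-power Δ)) + Δ * Δ * (b * (T * sixth-power Δ))) * (3 * (q * q) * (suc q * 1)))

  -- The regular matrices need T² ≤ q³ T. The two other classes have q² T matrices with O(q) flags
  -- and T matrices with O(q³) flags, up to powers of Δ, and so balance at q³ T.
  flagCount-≤ : ∀ a b {q T Δ} → 1 ≤ q → 1 ≤ Δ → T ≤ q * q * q → flagCount a b q T Δ ≤ (9 * a + 24 * b) *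
    (q * q * q * T * Δ ^ 8)
  flagCount-≤ a b {q} {T} {Δ} 1≤q 1≤Δ T≤ = begin
    flagCount a b q T Δ                                        ≡⟨ identity₁ a b q T Δ ⟩
    9 * a * (T * T * Δ⁶) + 6 * b * (q * q * T * Δ⁸ * suc q) + 6 * b * (q * q * T * Δ⁸ * suc q)
      ≤⟨ ℕₚ.+-mono-≤ (ℕₚ.+-mono-≤ (ℕₚ.*-monoʳ-≤ (9 * a) (ℕₚ.*-mono-≤ (ℕₚ.*-monoˡ-≤ T T≤) Δ⁶≤Δ⁸)) flags) flags ⟩
    9 * a * (q * q * q * T * Δ⁸) + 6 * b * (q * q * T * Δ⁸ * (2 * q)) + 6 * b * (q * q * T * Δ⁸ * (2 * q))
                                                               ≡⟨ identity₂ a b q T Δ⁸ ⟩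
    (9 * a + 24 * b) * (q * q * q * T * Δ⁸)                    ∎
    where
    Δ⁶ = Δ ^ 6
    Δ⁸ = Δ ^ 8
    Δ⁶≤Δ⁸ : Δ⁶ ≤ Δ⁸
    Δ⁶≤Δ⁸ = ℕₚ.^-monoʳ-≤ Δ {{>-nonZero 1≤Δ}} {6} {8} (ℕₚ.m≤m+n 6 2)
    flags : 6 * b * (q * q * T * Δ⁸ * suc q) ≤ 6 * b * (q * q * T * Δ⁸ * (2 * q))
    flags = ℕₚ.*-monoʳ-≤ (6 * b) (ℕₚ.*-monoʳ-≤ (q * q * T * Δ⁸) (ℕₚ.≤-trans (ℕₚ.+-monoˡ-≤ q 1≤q)
      (ℕₚ.≤-reflexive (double q))))
      where
      double : ∀ q → q + q ≡ 2 * q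
      double = solveℕ-∀
    identity₁ : ∀ a b q T Δ →
      a * (T * T * (Δ * (Δ * (Δ * (Δ * (Δ * (Δ * 1))))))) * (3 * (3 * 1)) +
      ((Δ * Δ * (b * (q * q * T * (Δ * Δ * (Δ * Δ) * (Δ * Δ)))) + Δ * Δ *
        (b * (q * q * T * (Δ * Δ * (Δ * Δ) * (Δ * Δ))))) * ((1 + q) * 1 + ((1 + q) * 1 + (1 + q) * 1)) +
       (Δ * Δ * (b * (T * (Δ * Δ * (Δ * Δ) * (Δ * Δ)))) + Δ * Δ * (b * (T * (Δ * Δ * (Δ * Δ) * (Δ * Δ))))) *
         (3 * (q * q) * ((1 + q) * 1)))
      ≡ 9 * a * (T * T * (Δ * (Δ * (Δ * (Δ * (Δ * (Δ * 1)))))))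
        + 6 * b * (q * q * T * (Δ * (Δ * (Δ * (Δ * (Δ * (Δ * (Δ * (Δ * 1)))))))) * (1 + q))
        + 6 * b * (q * q * T * (Δ * (Δ * (Δ * (Δ * (Δ * (Δ * (Δ * (Δ * 1)))))))) * (1 + q))
    identity₁ = solveℕ-∀
    identity₂ : ∀ a b q T F → 9 * a * (q * q * q * T * F) + 6 * b * (q * q * T * F * (2 * q)) + 6 * b *
      (q * q * T * F * (2 * q)) ≡ (9 * a + 24 * b) * (q * q * q * T * F)
    identity₂ = solveℕ-∀

  -- Seventh powers are compared, since the numbers whose divisors are counted are of size q⁶.
  divisor-power-≤ : ∀ {q d C Δ} .{{_ : NonZero q}} → Δ ^ (8 * d * 7) ≤ suc C * suc (searchBound q) →
    (Δ ^ 8) ^ d ≤ 3 * suc C * q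
  divisor-power-≤ {q} {d} {C} {Δ} le = ℕₚ.≮⇒≥ λ lt → ℕₚ.<⇒≱ (ℕₚ.^-monoˡ-< 7 lt) (begin
    ((Δ ^ 8) ^ d) ^ 7                           ≡⟨ trans (cong (_^ 7) (ℕₚ.^-*-assoc Δ 8 d))
      (ℕₚ.^-*-assoc Δ (8 * d) 7) ⟩
    Δ ^ (8 * d * 7)                             ≤⟨ le ⟩
    suc C * suc (searchBound q)                 ≤⟨ ℕₚ.*-monoʳ-≤ (suc C) (ℕₚ.+-monoˡ-≤ (searchBound q) 1≤q⁶) ⟩
    suc C * (q⁶ + (q⁶ + q⁶))                    ≡⟨ identity (suc C) q ⟩
    3 * suc C * q ^ 6                           ≤⟨ ℕₚ.*-mono-≤ (ℕₚ.m≤m*n (3 * suc C) q)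
      (ℕₚ.^-monoˡ-≤ 6 (ℕₚ.m≤n*m q (3 * suc C))) ⟩
    3 * suc C * q * (3 * suc C * q) ^ 6         ∎)
    where
    q⁶ = q * q * q * (q * q * q)
    1≤q⁶ : 1 ≤ q⁶
    1≤q⁶ = >-nonZero⁻¹ q⁶ {{ℕₚ.m*n≢0 (q * q * q) (q * q * q) {{qqq≢0}} {{qqq≢0}}}}
      where
      qqq≢0 : NonZero (q * q * q)
      qqq≢0 = ℕₚ.m*n≢0 (q * q) q {{ℕₚ.m*n≢0 q q}}
    identity : ∀ c q → c * (q * q * q * (q * q * q) + (q * q * q * (q * q * q) + q * q * q * (q * q * q))) ≡ 3 * c *
      (q * (q * (q * (q * (q * (q * 1))))))
    identity = solveℕ-∀

  cube : ∀ q → q ^ 3 ≡ q * q * q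
  cube q = identity q
    where
    identity : ∀ q → q * (q * (q * 1)) ≡ q * q * q
    identity = solveℕ-∀

  -- With ε = n / d, the divisor loss satisfies F^d ≤ y q ≤ y^d q^n, since n and d are at least 1.
  -- So y enters the constant and q^n is the allowed factor q^ε.
  power-bound : ∀ {ℓ q T d n W F y} .{{_ : NonZero q}} .{{_ : NonZero y}} → 1 ≤ n → 1 ≤ d → ℓ ≤ W *
    (q * q * q * T * F) → F ^ d ≤ y * q →
                ℓ ^ d ≤ (W * y * q ^ 3 * T) ^ d * q ^ n
  power-bound {ℓ} {q} {T} {d} {n} {W} {F} {y} 1≤n 1≤d ℓ≤ F≤ = begin
    ℓ ^ d                                     ≤⟨ ℕₚ.^-monoˡ-≤ d ℓ≤ ⟩
    (W * (q * q * q * T * F)) ^ d             ≡⟨ cong (_^ d) (identity₁ W q T F) ⟩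
    (W * (q * q * q) * T * F) ^ d             ≡⟨ ^-distribʳ-* (W * (q * q * q) * T) F d ⟩
    (W * (q * q * q) * T) ^ d * F ^ d         ≤⟨ ℕₚ.*-monoʳ-≤ ((W * (q * q * q) * T) ^ d)
      (ℕₚ.≤-trans F≤ (ℕₚ.*-mono-≤ (self-power y 1≤d) (self-power q 1≤n))) ⟩
    (W * (q * q * q) * T) ^ d * (y ^ d * q ^ n)  ≡⟨ ℕₚ.*-assoc ((W * (q * q * q) * T) ^ d) (y ^ d) (q ^ n) ⟨
    (W * (q * q * q) * T) ^ d * y ^ d * q ^ n ≡⟨ cong (_* q ^ n) (^-distribʳ-* (W * (q * q * q) * T) y d) ⟨
    (W * (q * q * q) * T * y) ^ d * q ^ n     ≡⟨ cong (λ z → z ^ d * q ^ n) (trans (identity₂ W (q * q * q) T y)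
      (cong (λ z → W * y * z * T) (sym (cube q)))) ⟩
    (W * y * q ^ 3 * T) ^ d * q ^ n           ∎
    where
    self-power : ∀ x .{{_ : NonZero x}} {e} → 1 ≤ e → x ≤ x ^ e
    self-power x {e} 1≤e = ℕₚ.≤-trans (ℕₚ.≤-reflexive (sym (ℕₚ.*-identityʳ x))) (ℕₚ.^-monoʳ-≤ x {1} {e} 1≤e)
    identity₁ : ∀ W q T F → W * (q * q * q * T * F) ≡ W * (q * q * q) * T * F
    identity₁ = solveℕ-∀
    identity₂ : ∀ W c T y → W * c * T * y ≡ W * y * c * T
    identity₂ = solveℕ-∀

open import Data.Nat using (ℕ; _*_; _^_; _≤_; _+_)

theorem5p2 : ∃[ c₁ ] ∃[ c₂ ] (1 ≤ c₁ × 1 ≤ c₂ ×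
    ((n d : ℕ) → 1 ≤ n → 1 ≤ d →
    ∃[ A ] ((q : ℕ) → Prime q → (T : ℕ) → c₂ * T ≤ c₁ * q ^ 3 →
    (L : List (Mat3 × FlagRep q)) → AllPairs (Distinct q) L →
    All (Good q T) L →
    length L ^ d ≤ (A * q ^ 3 * T) ^ d * q ^ n)))
theorem5p2 = 1 , sizeConstant , s≤s z≤n , ℕₚ.≤-trans (s≤s z≤n) 145≤sizeConstant , λ n d 1≤n 1≤d →
  -- In the exponent, 8 is the total power of Δ (six from factoring entries, two from the scales), d
  -- the denominator of ε, and 7 exceeds the exponent 6 of q in `searchBound`.
  let C , divisors = maxDivisors-bound (8 * d * 7) {{exponent d 1≤d}} in
  (9 * smallConstant + 24 * boxConstant) * (3 * suc C) , λ q pr T T≪ L distinct good →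
    bound n d 1≤n 1≤d C divisors q pr T T≪ L distinct good
  where
  exponent : ∀ d → 1 ≤ d → NonZero (8 * d * 7)
  exponent (suc d) _ = nonZero
  bound : ∀ n d → 1 ≤ n → 1 ≤ d → ∀ C → (∀ X → maxDivisors X ^ (8 * d * 7) ≤ suc C * suc X) →
          ∀ q → Prime q → ∀ T → sizeConstant * T ≤ 1 * q ^ 3 → ∀ L → AllPairs (Distinct q) L → All (Good q T) L →
          length L ^ d ≤ ((9 * smallConstant + 24 * boxConstant) * (3 * suc C) * q ^ 3 * T) ^ d * q ^ n
  bound n d 1≤n 1≤d C divisors q pr zero _ [] _ _ = ℕₚ.≤-trans (ℕₚ.≤-reflexive (zero-power d 1≤d)) z≤n
    where
    zero-power : ∀ d → 1 ≤ d → 0 ^ d ≡ 0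
    zero-power (suc d) _ = refl
  -- For T = 0 no good pair exists, as both norms are at least 1.
  bound n d 1≤n 1≤d C divisors q pr zero _ ((g , x) ∷ L) _ ((d≡1 , (h , gh≡1 , _ , le) , _) ∷ _) =
    contradiction (ℕₚ.≤-trans (ℕₚ.*-mono-≤ (norm≥1 {g} d≡1) (ℕₚ.≤-trans (adj-norm≥1 {g} d≡1)
      (ℕₚ.≤-reflexive (sym (norm-cong {h} {adj g} (right-inverse≡adj g h d≡1 gh≡1)))))) le) λ ()
  bound n d 1≤n 1≤d C divisors q pr T@(suc _) T≪ L distinct good =
    power-bound {W = 9 * smallConstant + 24 * boxConstant} {F = maxDivisors (searchBound q) ^ 8} 1≤n 1≤d
      (ℕₚ.≤-trans (good-bound pr (s≤s z≤n) T≪′ L distinct good)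
        (flagCount-≤ smallConstant boxConstant {Δ = maxDivisors (searchBound q)} (>-nonZero⁻¹ q)
          (maxDivisors≥1 (searchBound q)) (T≤qqq (s≤s z≤n) T≪′)))
      (divisor-power-≤ {d = d} {C = C} (divisors (searchBound q)))
    where
    instance
      q≢0 : NonZero q
      q≢0 = prime⇒nonZero pr
    T≪′ : sizeConstant * T ≤ q * q * q
    T≪′ = ℕₚ.≤-trans T≪ (ℕₚ.≤-reflexive (trans (ℕₚ.*-identityˡ (q ^ 3)) (cube q)))
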